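{- Let $P,Q\subset\mathbb{R}^d$ be non-empty lattice polytopes. Then $P\mapsto\tilde\chi(\mathcal{C}_Q(P))$ defines a valuation on $\mathcal{P}(\mathbb{Z}^d)$, and $$E_{P,Q}(-1,1)=-\sum_{p\in\mathbb{Z}^d}\tilde\chi(\mathcal{C}_Q(P+p)).$$
   Context: $\mathcal{P}(\mathbb{Z}^d)$ denotes the set of lattice polytopes (convex hulls of finitely many points of $\mathbb{Z}^d$). For lattice polytopes $P,Q$, the function $(m,n)\mapsto|(mP+nQ)\cap\mathbb{Z}^d|$ on $\mathbb{Z}_{\ge0}^2$ (with $+$ the Minkowski sum) agrees with a polynomial in $(m,n)$; $E_{P,Q}$ denotes this polynomial. The $Q$-complement of $P$ is the polyhedral complex $\mathcal{C}_Q(P)=\{F\subseteq P \text{ face}: F\cap Q=\emptyset\}$ (faces include the empty face, of dimension $-1$). The reduced Euler characteristic of a polyhedral complex $\mathcal{K}$ is $\tilde\chi(\mathcal{K})=\sum_{F\in\mathcal{K}}(-1)^{\dim F}$.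
   Formalization: The lattice polytopes are taken in ℚ^d instead of ℝ^d: their points, and the linear inequalities that cut out their faces, have rational coordinates. -}

module Defs where

open import Data.Nat as ℕ using (ℕ; zero; suc)
open import Data.Integer as ℤ using (ℤ)
open import Data.Rational as ℚ using (ℚ; 0ℚ; 1ℚ; _/_)
open import Data.Fin using (Fin; zero; suc)
open import Data.Vec as Vec using (Vec; []; _∷_)
open import Data.List as List using (List; []; _∷_; length)
open import Data.List.Relation.Unary.Unique.Propositional using (Unique)
open import Data.List.Relation.Unary.All using (All)
open import Data.List.Relation.Unary.Any using (Any)
open import Data.List.Relation.Unary.AllPairs using (AllPairs)
open import Data.List.Membership.Propositional using (_∈_; _∉_)
open import Data.Product using (Σ; ∃; ∃₂; _×_; _,_)
open import Data.Sum using (_⊎_)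
open import Relation.Binary.PropositionalEquality using (_≡_)
open import Relation.Nullary using (¬_)

-- Points. Real points are represented by rational points: all sets below
-- are rational polyhedra, so every statement about them (membership,
-- non-emptiness of intersections, dimension) is the same over ℚ and ℝ.

Pt : ℕ → Set
Pt d = Vec ℚ d

LPt : ℕ → Set
LPt d = Vec ℤ d

ℤtoℚ : ℤ → ℚ
ℤtoℚ z = z / 1

ℕtoℚ : ℕ → ℚ
ℕtoℚ n = ℤ.+ n / 1

embed : ∀ {d} → LPt d → Pt d
embed = Vec.map ℤtoℚ

0ᵥ : ∀ {d} → Pt d
0ᵥ = Vec.replicate _ 0ℚ

_⊕_ : ∀ {d} → Pt d → Pt d → Pt d
_⊕_ = Vec.zipWith ℚ._+_

_•_ : ∀ {d} → ℚ → Pt d → Pt d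
a • x = Vec.map (a ℚ.*_) x

dot : ∀ {d} → Pt d → Pt d → ℚ
dot x y = Vec.foldr _ ℚ._+_ 0ℚ (Vec.zipWith ℚ._*_ x y)

sumF : ∀ {k} → (Fin k → ℚ) → ℚ
sumF {zero} w = 0ℚ
sumF {suc k} w = w zero ℚ.+ sumF (λ i → w (suc i))

combo : ∀ {d k} → (Fin k → ℚ) → (Fin k → Pt d) → Pt d
combo {k = zero} w p = 0ᵥ
combo {k = suc k} w p = (w zero • p zero) ⊕ combo (λ i → w (suc i)) (λ i → p (suc i))

PtSet : ℕ → Set₁
PtSet d = Pt d → Set

_≐_ : ∀ {d} → PtSet d → PtSet d → Set
S ≐ T = ∀ x → (S x → T x) × (T x → S x)

-- a lattice polytope = convex hull of finitely many (possibly zero) lattice points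
record LatticePolytope (d : ℕ) : Set where
  field
    k   : ℕ
    gen : Fin k → LPt d

open LatticePolytope public

_∈P_ : ∀ {d} → Pt d → LatticePolytope d → Set
x ∈P P = ∃ λ (w : Fin (k P) → ℚ) →
  (∀ i → 0ℚ ℚ.≤ w i) × (sumF w ≡ 1ℚ) × (combo w (λ i → embed (gen P i)) ≡ x)

⟦_⟧ : ∀ {d} → LatticePolytope d → PtSet d
⟦ P ⟧ x = x ∈P P

NonEmpty : ∀ {d} → LatticePolytope d → Set
NonEmpty P = ∃ λ x → x ∈P P

translate : ∀ {d} → LatticePolytope d → LPt d → LatticePolytope d
translate P p = record { k = k P ; gen = λ i → Vec.zipWith ℤ._+_ (gen P i) p }

Mink : ∀ {d} → ℕ → ℕ → LatticePolytope d → LatticePolytope d → PtSet d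
Mink m n P Q x = ∃₂ λ a b → a ∈P P × b ∈P Q × (x ≡ (ℕtoℚ m • a) ⊕ (ℕtoℚ n • b))

-- Faces.  A face of P is P ∩ {x | c·x = b} for a valid inequality c·x ≤ b
-- of P (c = 0, b = 0 gives P itself; c = 0, b = 1 gives the empty face).

Supporting : ∀ {d} → LatticePolytope d → Pt d → ℚ → Set
Supporting P c b = ∀ y → y ∈P P → dot c y ℚ.≤ b

FaceSet : ∀ {d} → LatticePolytope d → Pt d → ℚ → PtSet d
FaceSet P c b x = x ∈P P × (dot c x ≡ b)

InComplement : ∀ {d} → LatticePolytope d → LatticePolytope d → Pt d → ℚ → Set
InComplement Q P c b = Supporting P c b × (∀ x → FaceSet P c b x → ¬ (x ∈P Q))

AffIndep : ∀ {d m} → (Fin m → Pt d) → Set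
AffIndep {m = m} p = ∀ (a : Fin m → ℚ) → sumF a ≡ 0ℚ → combo a p ≡ 0ᵥ → ∀ i → a i ≡ 0ℚ

-- DimPlusOne S n : the affine dimension of S is n - 1
-- (S contains n affinely independent points but not n+1); empty set ↦ n = 0, dim = -1
DimPlusOne : ∀ {d} → PtSet d → ℕ → Set
DimPlusOne {d} S n =
  (∃ λ (p : Fin n → Pt d) → (∀ i → S (p i)) × AffIndep p) ×
  (∀ (p : Fin (suc n) → Pt d) → (∀ i → S (p i)) → ¬ AffIndep p)

-- (-1)^(n-1), i.e. (-1)^dim when n = dim + 1
signDim : ℕ → ℤ
signDim zero = ℤ.-[1+ 0 ]
signDim (suc zero) = ℤ.+ 1
signDim (suc (suc n)) = signDim n

-- A face of the complex, recorded as (c , b , dim+1)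
FaceEntry : ℕ → Set
FaceEntry d = Pt d × ℚ × ℕ

entrySet : ∀ {d} → LatticePolytope d → FaceEntry d → PtSet d
entrySet P (c , b , _) = FaceSet P c b

sumSigns : ∀ {d} → List (FaceEntry d) → ℤ
sumSigns [] = ℤ.+ 0
sumSigns ((_ , _ , n) ∷ L) = signDim n ℤ.+ sumSigns L

-- RedEuler Q P z :  χ̃(C_Q(P)) = z.
-- L lists every face of the Q-complement exactly once (faces compared as sets),
-- each with its dimension, and z = Σ_F (-1)^dim F.
RedEuler : ∀ {d} → LatticePolytope d → LatticePolytope d → ℤ → Set
RedEuler {d} Q P z = ∃ λ (L : List (FaceEntry d)) →
  All (λ { (c , b , n) → InComplement Q P c b × DimPlusOne (FaceSet P c b) n }) L ×
  AllPairs (λ e e′ → ¬ (entrySet P e ≐ entrySet P e′)) L ×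
  (∀ c b → InComplement Q P c b → Any (λ e → FaceSet P c b ≐ entrySet P e) L) ×
  (z ≡ sumSigns L)

-- Valuations on 𝒫(ℤ^d), for a function given as a relation φ P z ("φ(P) = z").
-- φ is total and well defined, and φ(P₁ ∪ P₂) + φ(P₁ ∩ P₂) = φ(P₁) + φ(P₂)
-- whenever P₁ ∪ P₂ and P₁ ∩ P₂ are lattice polytopes.

IsValuation : ∀ {d} → (LatticePolytope d → ℤ → Set) → Set
IsValuation {d} φ =
  (∀ P → ∃ λ z → φ P z) ×
  (∀ P z z′ → φ P z → φ P z′ → z ≡ z′) ×
  (∀ (P₁ P₂ U I : LatticePolytope d) →
     ((λ x → (x ∈P P₁) ⊎ (x ∈P P₂)) ≐ ⟦ U ⟧) →
     ((λ x → (x ∈P P₁) × (x ∈P P₂)) ≐ ⟦ I ⟧) →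
     ∀ a b u i → φ P₁ a → φ P₂ b → φ U u → φ I i →
     u ℤ.+ i ≡ a ℤ.+ b)

LatticeCount : ∀ {d} → PtSet d → ℕ → Set
LatticeCount {d} S N = ∃ λ (L : List (LPt d)) →
  Unique L × All (λ p → S (embed p)) L × (∀ p → S (embed p) → p ∈ L) × (length L ≡ N)

-- a polynomial in two variables with rational coefficients: list of terms (i , j , a) = a·x^i·y^j
Poly2 : Set
Poly2 = List (ℕ × ℕ × ℚ)

powℚ : ℚ → ℕ → ℚ
powℚ x zero = 1ℚ
powℚ x (suc n) = x ℚ.* powℚ x n

eval2 : Poly2 → ℚ → ℚ → ℚ
eval2 [] x y = 0ℚ
eval2 ((i , j , a) ∷ E) x y = a ℚ.* powℚ x i ℚ.* powℚ y j ℚ.+ eval2 E x y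

IsEhrhartPoly : ∀ {d} → LatticePolytope d → LatticePolytope d → Poly2 → Set
IsEhrhartPoly P Q E = ∀ m n → ∃ λ N → LatticeCount (Mink m n P Q) N × (eval2 E (ℕtoℚ m) (ℕtoℚ n) ≡ ℕtoℚ N)

-- Σ_{p ∈ ℤ^d} χ̃(C_Q(P+p)) = s : the summand vanishes outside a finite set L of
-- distinct lattice points, and s is the sum of the summands over L.
SumOverTranslates : ∀ {d} → LatticePolytope d → LatticePolytope d → ℤ → Set
SumOverTranslates {d} Q P s = ∃ λ (L : List (LPt d)) → Unique L ×
  (∀ p → p ∉ L → ∀ z → RedEuler Q (translate P p) z → z ≡ ℤ.+ 0) ×
  SumOn L s
  where
    SumOn : List (LPt d) → ℤ → Set
    SumOn [] s = s ≡ ℤ.+ 0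
    SumOn (p ∷ L) s = ∃₂ λ z s′ → RedEuler Q (translate P p) z × SumOn L s′ × (s ≡ z ℤ.+ s′)

{-# OPTIONS --safe #-}
-- An affine functional on ℚ^d is a vector y of ℚ^(d+1), paired with the homogenizations 1 ∷ v. A split (E , S) of
-- the generators of P is a face F when some y vanishes on E and is positive on S. These y form a relatively open
-- cone of dimension d - dim F, so (-1)^dim F is up to a global sign its Euler characteristic, which is additive
-- under cutting by hyperplanes. A linear relation between indicators of open cones, valid at every functional y,
-- therefore persists for their nonemptiness. Separation by hyperplanes turns "the hull of T avoids Q" into
-- nonemptiness of an open cone, and this principle gives, with T ranging over the sets of generators of P,
--     χ̃(C_Q(P)) = - Σ_T (-1)^|T| [conv T ∩ Q = ∅] ,
-- as well as the valuation property, because P ↦ [y ≤ 0 on P] is a valuation for every y.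
--
-- Let v₁ , … , v_k be the generators of P and e(m) = E(m , 1). The k-th backward difference of e at m is
--     Σ_x Σ_T (-1)^|T| [x ∈ Σ_{i ∈ T} v_i + (m - |T|) P + Q] ,
-- and the condition says that x = Σ w_i v_i + q with q ∈ Q, w ≥ 0, Σ w_i = m and w_i ≥ 1 for i ∈ T. Convexity
-- allows replacing the alternatives w_i ≥ 0, w_i ≥ 1 by 0 ≤ w_i ≤ 1, w_i = 1. For m > k nothing is left, so the
-- difference vanishes identically. For m = k - 1 the substitution u = 1 - w turns the sum into (-1)^k times the sum
-- of χ̃(C_Q(P + p)) over p = x - Σ v_i, while the term with T everything contributes (-1)^k e(-1) to the difference.
module Submission where

open import Defs
open import Data.Bool using (Bool; true; false; if_then_else_)
open import Data.Empty using (⊥-elim)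
open import Data.Fin using (Fin; zero; suc; punchIn; punchOut)
open import Data.Fin.Properties using (punchIn-punchOut) renaming (_≟_ to _≟F_; any? to any?F)
open import Data.Integer as ℤ using (ℤ)
import Data.Integer.Properties as ℤP
open import Data.Integer.Tactic.RingSolver using () renaming (solve-∀ to ℤ-solve-∀)
open import Data.List as List using (List; []; _∷_; _++_; length)
open import Data.List.Membership.Propositional using (_∈_; _∉_; find; lose)
open import Data.List.Membership.Propositional.Properties using (∈-map⁺; ∈-map⁻; ∈-++⁺ˡ; ∈-++⁺ʳ; ∈-++⁻; ∈-filter⁺; ∈-filter⁻; ∈-cartesianProductWith⁺; ∈-cartesianProductWith⁻; ∈-concatMap⁺; ∈-tabulate⁺; ∈-tabulate⁻)
open import Data.List.Relation.Unary.All as All using (All; []; _∷_)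
import Data.List.Relation.Unary.All.Properties as AllP
open import Data.List.Relation.Unary.AllPairs as AllPairs using (AllPairs; []; _∷_)
import Data.List.Relation.Unary.AllPairs.Properties as AllPairsP
open import Data.List.Relation.Unary.Any as Any using (Any; here; there)
open import Data.List.Properties using (length-map)
open import Data.List.Relation.Unary.Unique.Propositional using (Unique)
import Data.List.Relation.Unary.Unique.Propositional.Properties as UniqueP
open import Data.Nat as ℕ using (ℕ; zero; suc)
import Data.Nat.Properties as ℕP
open import Data.Product using (∃; ∃₂; _×_; _,_; proj₁; proj₂)
open import Data.Rational as ℚ using (ℚ; 0ℚ; 1ℚ; _+_; _*_; -_; _-_; _<_; _≤_; 1/_)
import Data.Rational.Properties as ℚP
import Data.Rational.Unnormalised as ℚᵘ
import Data.Rational.Unnormalised.Properties as ℚᵘP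
open import Data.Sum using (_⊎_; inj₁; inj₂) renaming (map to ⊎-map)
open import Data.Unit using (⊤; tt)
open import Data.Vec as Vec using (Vec; []; _∷_; lookup)
import Data.Vec.Properties as VecP
open import Function using (_∘_; case_of_)
open import Level using (0ℓ)
open import Relation.Binary.Definitions using (tri<; tri≈; tri>)
open import Relation.Binary.PropositionalEquality using (_≡_; _≢_; refl; sym; trans; cong; cong₂; subst; subst₂; module ≡-Reasoning)
open import Relation.Nullary using (¬_; Dec; yes; no; _×-dec_)
open import Relation.Nullary.Decidable using (dec⇒maybe; decidable-stable; ¬?)
open import Tactic.RingSolver using (solve-∀)
open import Tactic.RingSolver.Core.AlmostCommutativeRing using (AlmostCommutativeRing; fromCommutativeRing)


-- The argument is constructive throughout, and this shapes it. Motzkin's alternative decides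
-- whether an open cone is empty, so the Euler characteristic of a cone becomes an integer computed
-- from a decision and a parity. The weight systems of the second half are not decided; their
-- indicators are only obtained under double negation, which is harmless because the conclusions are
-- equalities of integers. The generators of a polytope may be redundant or repeated. Splits are
-- therefore taken over positions in the list: a split with copies of a vector on both sides admits
-- no functional, and each face belongs to exactly one feasible split. No relation between the
-- degree of `E` and `P` is assumed. The order of the difference is tied to the number `k` of
-- generators instead, because then `m = k - 1` makes every argument `m - |T|` a dilation factor
-- except the last, which is -1. Polynomiality only serves to propagate zeros from large `m` down to
-- this one.

ℚ-ring : AlmostCommutativeRing 0ℓ 0ℓ
ℚ-ring = fromCommutativeRing ℚP.+-*-commutativeRing (λ x → dec⇒maybe (0ℚ ℚ.≟ x))

-- Arithmetic and order of the rationals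

+-interchange : ∀ a b c d → (a + b) + (c + d) ≡ (a + c) + (b + d)
+-interchange = solve-∀ ℚ-ring

neg-involutive : ∀ a → - - a ≡ a
neg-involutive = solve-∀ ℚ-ring

a-b+b≡a : ∀ a b → a - b + b ≡ a
a-b+b≡a = solve-∀ ℚ-ring

a+b-a≡b : ∀ a b → a + b - a ≡ b
a+b-a≡b = solve-∀ ℚ-ring

a-0≡a : ∀ a → a - 0ℚ ≡ a
a-0≡a = solve-∀ ℚ-ring

pos+pos : ∀ {a b} → 0ℚ < a → 0ℚ < b → 0ℚ < a + b
pos+pos p q = ℚP.+-mono-< p q

pos+nonneg : ∀ {a b} → 0ℚ < a → 0ℚ ≤ b → 0ℚ < a + b
pos+nonneg p q = ℚP.+-mono-<-≤ p q

nonneg+pos : ∀ {a b} → 0ℚ ≤ a → 0ℚ < b → 0ℚ < a + b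
nonneg+pos p q = ℚP.+-mono-≤-< p q

nonneg+nonneg : ∀ {a b} → 0ℚ ≤ a → 0ℚ ≤ b → 0ℚ ≤ a + b
nonneg+nonneg p q = ℚP.+-mono-≤ p q

pos*pos : ∀ {a b} → 0ℚ < a → 0ℚ < b → 0ℚ < a * b
pos*pos {a} {b} p q = ℚP.positive⁻¹ (a * b) {{ℚP.pos*pos⇒pos a {{ℚ.positive p}} b {{ℚ.positive q}}}}

nonneg*nonneg : ∀ {a b} → 0ℚ ≤ a → 0ℚ ≤ b → 0ℚ ≤ a * b
nonneg*nonneg {a} {b} p q = ℚP.nonNegative⁻¹ (a * b) {{ℚP.nonNeg*nonNeg⇒nonNeg a {{ℚ.nonNegative p}} b {{ℚ.nonNegative q}}}}

neg-pos : ∀ {a} → a < 0ℚ → 0ℚ < - a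
neg-pos p = ℚP.neg-antimono-< p

pos-neg : ∀ {a} → 0ℚ < a → - a < 0ℚ
pos-neg p = ℚP.neg-antimono-< p

nonpos-neg : ∀ {a} → a ≤ 0ℚ → 0ℚ ≤ - a
nonpos-neg p = ℚP.neg-antimono-≤ p

neg-pos⁻ : ∀ {a} → 0ℚ < - a → a < 0ℚ
neg-pos⁻ {a} p = subst (_< 0ℚ) (neg-involutive a) (pos-neg p)

pos⇒≢0 : ∀ {a} → 0ℚ < a → a ≢ 0ℚ
pos⇒≢0 p refl = ℚP.<-irrefl refl p

<⇒0<- : ∀ {a b} → a < b → 0ℚ < b - a
<⇒0<- {a} {b} p = subst (_< b - a) (ℚP.+-inverseʳ a) (ℚP.+-monoˡ-< (- a) p)

0<-⇒< : ∀ {a b} → 0ℚ < b - a → a < b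
0<-⇒< {a} {b} p = subst₂ _<_ (ℚP.+-identityˡ a) (a-b+b≡a b a) (ℚP.+-monoˡ-< a p)

≤⇒0≤- : ∀ {a b} → a ≤ b → 0ℚ ≤ b - a
≤⇒0≤- {a} {b} p = subst (_≤ b - a) (ℚP.+-inverseʳ a) (ℚP.+-monoˡ-≤ (- a) p)

0≤-⇒≤ : ∀ {a b} → 0ℚ ≤ b - a → a ≤ b
0≤-⇒≤ {a} {b} p = subst₂ _≤_ (ℚP.+-identityˡ a) (a-b+b≡a b a) (ℚP.+-monoˡ-≤ a p)

0<1 : 0ℚ < 1ℚ
0<1 = ℚP.positive⁻¹ 1ℚ

0≤1 : 0ℚ ≤ 1ℚ
0≤1 = ℚP.<⇒≤ 0<1

recip : ∀ a → a ≢ 0ℚ → ∃ λ b → b * a ≡ 1ℚ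
recip a a≢0 = (1/ a) {{ℚ.≢-nonZero a≢0}} , ℚP.*-inverseˡ a {{ℚ.≢-nonZero a≢0}}

pos-recip : ∀ {a} → 0ℚ < a → ∃ λ b → 0ℚ < b × b * a ≡ 1ℚ
pos-recip {a} p = (1/ a) {{nz}} , ℚP.positive⁻¹ _ {{ℚP.1/pos⇒pos a {{ℚ.positive p}}}} , ℚP.*-inverseˡ a {{nz}}
  where
  nz = ℚP.pos⇒nonZero a {{ℚ.positive p}}

*-cancel-0 : ∀ a b → a ≢ 0ℚ → a * b ≡ 0ℚ → b ≡ 0ℚ
*-cancel-0 a b a≢0 e with recip a a≢0
... | c , ca = begin
  b ≡⟨ sym (ℚP.*-identityˡ b) ⟩
  1ℚ * b ≡⟨ cong (_* b) (sym ca) ⟩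
  c * a * b ≡⟨ ℚP.*-assoc c a b ⟩
  c * (a * b) ≡⟨ cong (c *_) e ⟩
  c * 0ℚ ≡⟨ ℚP.*-zeroʳ c ⟩
  0ℚ ∎
  where open ≡-Reasoning

nonneg+nonneg≡0 : ∀ {a b} → 0ℚ ≤ a → 0ℚ ≤ b → a + b ≡ 0ℚ → a ≡ 0ℚ × b ≡ 0ℚ
nonneg+nonneg≡0 {a} {b} p q e = a≡0 , trans (sym (ℚP.+-identityˡ b)) (trans (cong (_+ b) (sym a≡0)) e)
  where
  a≤0 : a ≤ 0ℚ
  a≤0 = subst₂ _≤_ (ℚP.+-identityʳ a) e (ℚP.+-monoʳ-≤ a q)
  a≡0 = ℚP.≤-antisym a≤0 p

nonneg-cases : ∀ {a} → 0ℚ ≤ a → a ≡ 0ℚ ⊎ 0ℚ < a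
nonneg-cases {a} p with ℚP.<-cmp 0ℚ a
... | tri< l _ _ = inj₂ l
... | tri≈ _ e _ = inj₁ (sym e)
... | tri> _ _ g = ⊥-elim (ℚP.<-irrefl refl (ℚP.≤-<-trans p g))

neg⇒≢0 : ∀ {a} → a < 0ℚ → a ≢ 0ℚ
neg⇒≢0 p refl = ℚP.<-irrefl refl p

-- Vectors and linear functionals

lookup-⊕ : ∀ {n} (x y : Pt n) i → lookup (x ⊕ y) i ≡ lookup x i + lookup y i
lookup-⊕ x y i = VecP.lookup-zipWith _+_ i x y

lookup-• : ∀ {n} a (x : Pt n) i → lookup (a • x) i ≡ a * lookup x i
lookup-• a x i = VecP.lookup-map i (a *_) x

-- Opaque, because unification otherwise unfolds it coordinatewise at great cost.
opaque
  neg : ∀ {n} → Pt n → Pt n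
  neg x = (- 1ℚ) • x

  neg-def : ∀ {n} (x : Pt n) → neg x ≡ (- 1ℚ) • x
  neg-def x = refl

⊕-assoc : ∀ {n} (x y z : Pt n) → (x ⊕ y) ⊕ z ≡ x ⊕ (y ⊕ z)
⊕-assoc = VecP.zipWith-assoc ℚP.+-assoc

⊕-comm : ∀ {n} (x y : Pt n) → x ⊕ y ≡ y ⊕ x
⊕-comm = VecP.zipWith-comm ℚP.+-comm

⊕-identityˡ : ∀ {n} (x : Pt n) → 0ᵥ ⊕ x ≡ x
⊕-identityˡ = VecP.zipWith-identityˡ ℚP.+-identityˡ

⊕-identityʳ : ∀ {n} (x : Pt n) → x ⊕ 0ᵥ ≡ x
⊕-identityʳ = VecP.zipWith-identityʳ ℚP.+-identityʳ

⊕-interchange : ∀ {n} (x y z w : Pt n) → (x ⊕ y) ⊕ (z ⊕ w) ≡ (x ⊕ z) ⊕ (y ⊕ w)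
⊕-interchange [] [] [] [] = refl
⊕-interchange (x ∷ xs) (y ∷ ys) (z ∷ zs) (w ∷ ws) = cong₂ _∷_ (+-interchange x y z w) (⊕-interchange xs ys zs ws)

•-distribˡ : ∀ {n} a (x y : Pt n) → a • (x ⊕ y) ≡ (a • x) ⊕ (a • y)
•-distribˡ a [] [] = refl
•-distribˡ a (x ∷ xs) (y ∷ ys) = cong₂ _∷_ (ℚP.*-distribˡ-+ a x y) (•-distribˡ a xs ys)

•-distribʳ : ∀ {n} a b (x : Pt n) → (a + b) • x ≡ (a • x) ⊕ (b • x)
•-distribʳ a b [] = refl
•-distribʳ a b (x ∷ xs) = cong₂ _∷_ (ℚP.*-distribʳ-+ x a b) (•-distribʳ a b xs)

•-assoc : ∀ {n} a b (x : Pt n) → (a * b) • x ≡ a • (b • x)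
•-assoc a b [] = refl
•-assoc a b (x ∷ xs) = cong₂ _∷_ (ℚP.*-assoc a b x) (•-assoc a b xs)

•-identity : ∀ {n} (x : Pt n) → 1ℚ • x ≡ x
•-identity [] = refl
•-identity (x ∷ xs) = cong₂ _∷_ (ℚP.*-identityˡ x) (•-identity xs)

•-zeroˡ : ∀ {n} (x : Pt n) → 0ℚ • x ≡ 0ᵥ
•-zeroˡ [] = refl
•-zeroˡ (x ∷ xs) = cong₂ _∷_ (ℚP.*-zeroˡ x) (•-zeroˡ xs)

•-zeroʳ : ∀ {n} a → a • 0ᵥ {n} ≡ 0ᵥ
•-zeroʳ {zero} a = refl
•-zeroʳ {suc n} a = cong₂ _∷_ (ℚP.*-zeroʳ a) (•-zeroʳ a)

⊕-neg : ∀ {n} (x : Pt n) → x ⊕ neg x ≡ 0ᵥ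
⊕-neg x = trans (cong₂ _⊕_ (sym (•-identity x)) (neg-def x))
         (trans (sym (•-distribʳ 1ℚ (- 1ℚ) x)) (•-zeroˡ x))

⊕≡0⇒≡neg : ∀ {n} (x y : Pt n) → x ⊕ y ≡ 0ᵥ → x ≡ neg y
⊕≡0⇒≡neg x y e = begin
  x ≡⟨ sym (⊕-identityʳ x) ⟩
  x ⊕ 0ᵥ ≡⟨ cong (x ⊕_) (sym (⊕-neg y)) ⟩
  x ⊕ (y ⊕ neg y) ≡⟨ sym (⊕-assoc x y (neg y)) ⟩
  (x ⊕ y) ⊕ neg y ≡⟨ cong (_⊕ neg y) e ⟩
  0ᵥ ⊕ neg y ≡⟨ ⊕-identityˡ (neg y) ⟩
  neg y ∎
  where open ≡-Reasoning

neg-neg : ∀ {n} (x : Pt n) → neg (neg x) ≡ x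
neg-neg x = trans (trans (neg-def (neg x)) (cong ((- 1ℚ) •_) (neg-def x))) (trans (sym (•-assoc (- 1ℚ) (- 1ℚ) x)) (•-identity x))

⊕neg≡0⇒≡ : ∀ {n} (x y : Pt n) → x ⊕ neg y ≡ 0ᵥ → x ≡ y
⊕neg≡0⇒≡ x y e = trans (⊕≡0⇒≡neg x (neg y) e) (neg-neg y)

dot-⊕ʳ : ∀ {n} (c x y : Pt n) → dot c (x ⊕ y) ≡ dot c x + dot c y
dot-⊕ʳ [] [] [] = refl
dot-⊕ʳ (c ∷ cs) (x ∷ xs) (y ∷ ys) = trans (cong (c * (x + y) +_) (dot-⊕ʳ cs xs ys)) (lem c x y (dot cs xs) (dot cs ys))
  where
  lem : ∀ c x y p q → c * (x + y) + (p + q) ≡ (c * x + p) + (c * y + q)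
  lem = solve-∀ ℚ-ring

dot-•ʳ : ∀ {n} a (c x : Pt n) → dot c (a • x) ≡ a * dot c x
dot-•ʳ a [] [] = sym (ℚP.*-zeroʳ a)
dot-•ʳ a (c ∷ cs) (x ∷ xs) = trans (cong (c * (a * x) +_) (dot-•ʳ a cs xs)) (lem a c x (dot cs xs))
  where
  lem : ∀ a c x p → c * (a * x) + a * p ≡ a * (c * x + p)
  lem = solve-∀ ℚ-ring

dot-comm : ∀ {n} (x y : Pt n) → dot x y ≡ dot y x
dot-comm [] [] = refl
dot-comm (x ∷ xs) (y ∷ ys) = cong₂ _+_ (ℚP.*-comm x y) (dot-comm xs ys)

dot-⊕ˡ : ∀ {n} (x y c : Pt n) → dot (x ⊕ y) c ≡ dot x c + dot y c
dot-⊕ˡ x y c = trans (dot-comm (x ⊕ y) c) (trans (dot-⊕ʳ c x y) (cong₂ _+_ (dot-comm c x) (dot-comm c y)))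

dot-•ˡ : ∀ {n} a (x c : Pt n) → dot (a • x) c ≡ a * dot x c
dot-•ˡ a x c = trans (dot-comm (a • x) c) (trans (dot-•ʳ a c x) (cong (a *_) (dot-comm c x)))

dot-0ʳ : ∀ {n} (c : Pt n) → dot c 0ᵥ ≡ 0ℚ
dot-0ʳ [] = refl
dot-0ʳ (c ∷ cs) = trans (cong₂ _+_ (ℚP.*-zeroʳ c) (dot-0ʳ cs)) (ℚP.+-identityʳ 0ℚ)

dot-0ˡ : ∀ {n} (c : Pt n) → dot 0ᵥ c ≡ 0ℚ
dot-0ˡ c = trans (dot-comm 0ᵥ c) (dot-0ʳ c)

dot-negʳ : ∀ {n} (c x : Pt n) → dot c (neg x) ≡ - dot c x
dot-negʳ c x = trans (cong (dot c) (neg-def x)) (trans (dot-•ʳ (- 1ℚ) c x) (lem (dot c x)))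
  where
  lem : ∀ a → (- 1ℚ) * a ≡ - a
  lem = solve-∀ ℚ-ring

dot-negˡ : ∀ {n} (x c : Pt n) → dot (neg x) c ≡ - dot x c
dot-negˡ x c = trans (dot-comm (neg x) c) (trans (dot-negʳ c x) (cong -_ (dot-comm c x)))

-- Finite sums and linear combinations

sumF-cong : ∀ {k} {f g : Fin k → ℚ} → (∀ i → f i ≡ g i) → sumF f ≡ sumF g
sumF-cong {zero} h = refl
sumF-cong {suc k} h = cong₂ _+_ (h zero) (sumF-cong (h ∘ suc))

sumF-+ : ∀ {k} (f g : Fin k → ℚ) → sumF (λ i → f i + g i) ≡ sumF f + sumF g
sumF-+ {zero} f g = refl
sumF-+ {suc k} f g = trans (cong (f zero + g zero +_) (sumF-+ (f ∘ suc) (g ∘ suc)))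
  (+-interchange (f zero) (g zero) (sumF (f ∘ suc)) (sumF (g ∘ suc)))

sumF-* : ∀ {k} a (f : Fin k → ℚ) → sumF (λ i → a * f i) ≡ a * sumF f
sumF-* {zero} a f = sym (ℚP.*-zeroʳ a)
sumF-* {suc k} a f = trans (cong (a * f zero +_) (sumF-* a (f ∘ suc))) (sym (ℚP.*-distribˡ-+ a (f zero) _))

sumF-0 : ∀ {k} → sumF {k} (λ _ → 0ℚ) ≡ 0ℚ
sumF-0 {zero} = refl
sumF-0 {suc k} = trans (ℚP.+-identityˡ _) (sumF-0 {k})

sumF-nonneg : ∀ {k} {f : Fin k → ℚ} → (∀ i → 0ℚ ≤ f i) → 0ℚ ≤ sumF f
sumF-nonneg {zero} h = ℚP.≤-refl
sumF-nonneg {suc k} h = nonneg+nonneg (h zero) (sumF-nonneg (h ∘ suc))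

sumF-nonneg≡0 : ∀ {k} {f : Fin k → ℚ} → (∀ i → 0ℚ ≤ f i) → sumF f ≡ 0ℚ → ∀ i → f i ≡ 0ℚ
sumF-nonneg≡0 {suc k} h e i with nonneg+nonneg≡0 (h zero) (sumF-nonneg (h ∘ suc)) e
sumF-nonneg≡0 {suc k} h e zero | p , q = p
sumF-nonneg≡0 {suc k} h e (suc i) | p , q = sumF-nonneg≡0 (h ∘ suc) q i

single : ∀ {k} → Fin k → Fin k → ℚ
single zero zero = 1ℚ
single zero (suc j) = 0ℚ
single (suc i) zero = 0ℚ
single (suc i) (suc j) = single i j

single-nonneg : ∀ {k} (i j : Fin k) → 0ℚ ≤ single i j
single-nonneg zero zero = 0≤1
single-nonneg zero (suc j) = ℚP.≤-refl
single-nonneg (suc i) zero = ℚP.≤-refl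
single-nonneg (suc i) (suc j) = single-nonneg i j

single-≢ : ∀ {k} (i j : Fin k) → i ≢ j → single i j ≡ 0ℚ
single-≢ zero zero h = ⊥-elim (h refl)
single-≢ zero (suc j) h = refl
single-≢ (suc i) zero h = refl
single-≢ (suc i) (suc j) h = single-≢ i j (h ∘ cong suc)

sumF-single : ∀ {k} (i : Fin k) → sumF (single i) ≡ 1ℚ
sumF-single {suc k} zero = trans (cong (1ℚ +_) (sumF-0 {k})) (ℚP.+-identityʳ 1ℚ)
sumF-single (suc i) = trans (ℚP.+-identityˡ _) (sumF-single i)

combo-cong : ∀ {d k} {w w′ : Fin k → ℚ} {p p′ : Fin k → Pt d} →
  (∀ i → w i ≡ w′ i) → (∀ i → p i ≡ p′ i) → combo w p ≡ combo w′ p′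
combo-cong {k = zero} h h′ = refl
combo-cong {k = suc k} h h′ = cong₂ _⊕_ (cong₂ _•_ (h zero) (h′ zero)) (combo-cong (h ∘ suc) (h′ ∘ suc))

combo-0 : ∀ {d k} (p : Fin k → Pt d) → combo (λ _ → 0ℚ) p ≡ 0ᵥ
combo-0 {k = zero} p = refl
combo-0 {k = suc k} p = trans (cong₂ _⊕_ (•-zeroˡ (p zero)) (combo-0 (p ∘ suc))) (⊕-identityˡ 0ᵥ)

combo-+ : ∀ {d k} (w w′ : Fin k → ℚ) (p : Fin k → Pt d) → combo (λ i → w i + w′ i) p ≡ combo w p ⊕ combo w′ p
combo-+ {k = zero} w w′ p = sym (⊕-identityˡ 0ᵥ)
combo-+ {k = suc k} w w′ p = trans
  (cong₂ _⊕_ (•-distribʳ (w zero) (w′ zero) (p zero)) (combo-+ (w ∘ suc) (w′ ∘ suc) (p ∘ suc)))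
  (⊕-interchange (w zero • p zero) (w′ zero • p zero) _ _)

combo-* : ∀ {d k} a (w : Fin k → ℚ) (p : Fin k → Pt d) → combo (λ i → a * w i) p ≡ a • combo w p
combo-* {k = zero} a w p = sym (•-zeroʳ a)
combo-* {k = suc k} a w p = trans
  (cong₂ _⊕_ (•-assoc a (w zero) (p zero)) (combo-* a (w ∘ suc) (p ∘ suc)))
  (sym (•-distribˡ a (w zero • p zero) _))

combo-⊕ : ∀ {d k} (w : Fin k → ℚ) (p : Fin k → Pt d) (q : Pt d) →
  combo w (λ i → p i ⊕ q) ≡ combo w p ⊕ (sumF w • q)
combo-⊕ {k = zero} w p q = sym (trans (⊕-identityˡ _) (•-zeroˡ q))
combo-⊕ {k = suc k} w p q = trans
  (cong₂ _⊕_ (•-distribˡ (w zero) (p zero) q) (combo-⊕ (w ∘ suc) (p ∘ suc) q))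
  (trans (⊕-interchange (w zero • p zero) (w zero • q) _ _)
         (cong (((w zero • p zero) ⊕ combo (w ∘ suc) (p ∘ suc)) ⊕_) (sym (•-distribʳ (w zero) (sumF (w ∘ suc)) q))))

combo-single : ∀ {d k} (i : Fin k) (p : Fin k → Pt d) → combo (single i) p ≡ p i
combo-single zero p = trans (cong₂ _⊕_ (•-identity (p zero)) (combo-0 (p ∘ suc))) (⊕-identityʳ (p zero))
combo-single (suc i) p = trans (cong₂ _⊕_ (•-zeroˡ (p zero)) (combo-single i (p ∘ suc))) (⊕-identityˡ _)

dot-combo : ∀ {d k} (c : Pt d) (w : Fin k → ℚ) (p : Fin k → Pt d) →
  dot c (combo w p) ≡ sumF (λ i → w i * dot c (p i))
dot-combo {k = zero} c w p = dot-0ʳ c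
dot-combo {k = suc k} c w p = trans (dot-⊕ʳ c (w zero • p zero) _)
  (cong₂ _+_ (dot-•ʳ (w zero) c (p zero)) (dot-combo c (w ∘ suc) (p ∘ suc)))

hom : ∀ {d} → Pt d → Pt (suc d)
hom x = 1ℚ ∷ x

combo-hom : ∀ {d k} (w : Fin k → ℚ) (p : Fin k → Pt d) → combo w (λ i → hom (p i)) ≡ sumF w ∷ combo w p
combo-hom {k = zero} w p = refl
combo-hom {k = suc k} w p = trans (cong ((w zero • hom (p zero)) ⊕_) (combo-hom (w ∘ suc) (p ∘ suc)))
  (cong (λ a → (a + sumF (w ∘ suc)) ∷ ((w zero • p zero) ⊕ combo (w ∘ suc) (p ∘ suc))) (ℚP.*-identityʳ (w zero)))

-- Feasibility of homogeneous linear systems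

record Sat {n} (E S : List (Pt n)) (c : Pt n) : Set where
  constructor sat
  field
    on-E : ∀ {e} → e ∈ E → dot c e ≡ 0ℚ
    on-S : ∀ {s} → s ∈ S → 0ℚ < dot c s

open Sat

Feas : ∀ {n} → List (Pt n) → List (Pt n) → Set
Feas E S = ∃ (Sat E S)

-- The certificates of infeasibility: strictly positive combinations of at least one vector of `S`,
-- modulo the span of `E`. Zero is deliberately no base case, so that reaching `0ᵥ` contradicts
-- every solution.
data Cone {n} (E S : List (Pt n)) : Pt n → Set where
  base   : ∀ {s} → s ∈ S → Cone E S s
  add   : ∀ {x y} → Cone E S x → Cone E S y → Cone E S (x ⊕ y)
  scale : ∀ {a x} → 0ℚ < a → Cone E S x → Cone E S (a • x)
  shift : ∀ {x e} a → e ∈ E → Cone E S x → Cone E S (x ⊕ (a • e))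

Cone-pos : ∀ {n} {E S : List (Pt n)} {c x} → Sat E S c → Cone E S x → 0ℚ < dot c x
Cone-pos h (base s∈S) = on-S h s∈S
Cone-pos {c = c} h (add {x} {y} p q) =
  subst (0ℚ <_) (sym (dot-⊕ʳ c x y)) (pos+pos (Cone-pos h p) (Cone-pos h q))
Cone-pos {c = c} h (scale {a} {x} a>0 p) =
  subst (0ℚ <_) (sym (dot-•ʳ a c x)) (pos*pos a>0 (Cone-pos h p))
Cone-pos {c = c} h (shift {x} {e} a e∈E p) =
  subst (0ℚ <_) (sym dot≡) (Cone-pos h p)
  where
  open ≡-Reasoning
  dot≡ : dot c (x ⊕ (a • e)) ≡ dot c x
  dot≡ = begin
    dot c (x ⊕ (a • e)) ≡⟨ dot-⊕ʳ c x (a • e) ⟩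
    dot c x + dot c (a • e) ≡⟨ cong (dot c x +_) (trans (dot-•ʳ a c e) (cong (a *_) (on-E h e∈E))) ⟩
    dot c x + a * 0ℚ ≡⟨ cong (dot c x +_) (ℚP.*-zeroʳ a) ⟩
    dot c x + 0ℚ ≡⟨ ℚP.+-identityʳ _ ⟩
    dot c x ∎

Cone-0-infeasible : ∀ {n} {E S : List (Pt n)} → Cone E S 0ᵥ → ¬ Feas E S
Cone-0-infeasible p (c , h) = ℚP.<-irrefl (sym (dot-0ʳ c)) (Cone-pos h p)

-- Carries a certificate back from an eliminated system through a linear `f`. The image of an
-- equation need not be an equation of the target, so it is only asked that the target cone be
-- stable under shifts along it.
Cone-map : ∀ {n m} {E S : List (Pt n)} {E′ S′ : List (Pt m)} (f : Pt n → Pt m) →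
  (∀ x y → f (x ⊕ y) ≡ f x ⊕ f y) → (∀ a x → f (a • x) ≡ a • f x) →
  (∀ {s} → s ∈ S → Cone E′ S′ (f s)) →
  (∀ {e x} → e ∈ E → ∀ a → Cone E′ S′ x → Cone E′ S′ (x ⊕ (a • f e))) →
  ∀ {x} → Cone E S x → Cone E′ S′ (f x)
Cone-map f f-⊕ f-• onS onE (base s∈S) = onS s∈S
Cone-map {E′ = E′} {S′} f f-⊕ f-• onS onE (add {x} {y} p q) =
  subst (Cone E′ S′) (sym (f-⊕ x y)) (add (Cone-map f f-⊕ f-• onS onE p) (Cone-map f f-⊕ f-• onS onE q))
Cone-map {E′ = E′} {S′} f f-⊕ f-• onS onE (scale {a} {x} a>0 p) =
  subst (Cone E′ S′) (sym (f-• a x)) (scale a>0 (Cone-map f f-⊕ f-• onS onE p))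
Cone-map {E′ = E′} {S′} f f-⊕ f-• onS onE (shift {x} {e} a e∈E p) =
  subst (Cone E′ S′) (sym (trans (f-⊕ x (a • e)) (cong (f x ⊕_) (f-• a e))))
    (onE e∈E a (Cone-map f f-⊕ f-• onS onE p))

bound-above : ∀ (Ls : List ℚ) → ∃ λ c → ∀ {l} → l ∈ Ls → l < c
bound-above [] = 0ℚ , λ ()
bound-above (x ∷ Ls) with bound-above Ls
... | c , h with x ℚ.<? c
...   | yes x<c = c , λ { (here refl) → x<c ; (there m) → h m }
...   | no x≮c = x + 1ℚ , λ { (here refl) → x<x+1 ; (there m) → ℚP.<-trans (ℚP.<-≤-trans (h m) (ℚP.≮⇒≥ x≮c)) x<x+1 }
  where
  x<x+1 : x < x + 1ℚ
  x<x+1 = subst (_< x + 1ℚ) (ℚP.+-identityʳ x) (ℚP.+-monoʳ-< x 0<1)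

between-point : ∀ (Ls : List ℚ) u → (∀ {l} → l ∈ Ls → l < u) → ∃ λ c → (∀ {l} → l ∈ Ls → l < c) × c < u
between-point [] u h = u - 1ℚ , (λ ()) , subst (u - 1ℚ <_) (ℚP.+-identityʳ u) (ℚP.+-monoʳ-< u (pos-neg 0<1))
between-point (x ∷ Ls) u h with between-point Ls u (h ∘ there)
... | c , below , c<u with x ℚ.<? c
...   | yes x<c = c , (λ { (here refl) → x<c ; (there m) → below m }) , c<u
...   | no x≮c with ℚP.<-dense (h (here refl))
...     | m , x<m , m<u = m , (λ { (here refl) → x<m ; (there l∈) → ℚP.<-trans (ℚP.<-≤-trans (below l∈) (ℚP.≮⇒≥ x≮c)) x<m }) , m<u

between : ∀ (Ls Us : List ℚ) → (∀ {l u} → l ∈ Ls → u ∈ Us → l < u) →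
  ∃ λ c → (∀ {l} → l ∈ Ls → l < c) × (∀ {u} → u ∈ Us → c < u)
between Ls [] h = let c , p = bound-above Ls in c , p , λ ()
between Ls (u ∷ Us) h with between Ls Us (λ p q → h p (there q))
... | c , p , q with c ℚ.<? u
...   | yes c<u = c , p , λ { (here refl) → c<u ; (there m) → q m }
...   | no c≮u with between-point Ls u (λ p → h p (here refl))
...     | m , below , m<u = m , below , λ { (here refl) → m<u ; (there v∈) → ℚP.<-trans (ℚP.<-≤-trans m<u (ℚP.≮⇒≥ c≮u)) (q v∈) }

-- `ρ` is the projection along the pivot `e₀ ∷ e′` onto the vectors with head 0, and `lift` is its
-- transpose. Functionals on the image thus correspond to functionals vanishing on the pivot.
module Pivot {n} (e₀ : ℚ) (e′ : Pt n) (e₀≢0 : e₀ ≢ 0ℚ) where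

  r : ℚ
  r = proj₁ (recip e₀ e₀≢0)

  r*e₀ : r * e₀ ≡ 1ℚ
  r*e₀ = proj₂ (recip e₀ e₀≢0)

  ρ : Pt (suc n) → Pt n
  ρ (a ∷ x) = x ⊕ ((- (a * r)) • e′)

  embed-ρ : ∀ x → 0ℚ ∷ ρ x ≡ x ⊕ ((- (Vec.head x * r)) • (e₀ ∷ e′))
  embed-ρ (a ∷ x) = cong (_∷ ρ (a ∷ x)) (sym head≡0)
    where
    lem : ∀ a r e → a + - (a * r) * e ≡ a - a * (r * e)
    lem = solve-∀ ℚ-ring
    head≡0 : a + - (a * r) * e₀ ≡ 0ℚ
    head≡0 = trans (lem a r e₀) (trans (cong (λ z → a - a * z) r*e₀)
      (trans (cong (λ z → a - z) (ℚP.*-identityʳ a)) (ℚP.+-inverseʳ a)))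

  lift : Pt n → Pt (suc n)
  lift c = (- (r * dot c e′)) ∷ c

  dot-lift : ∀ c x → dot (lift c) x ≡ dot c (ρ x)
  dot-lift c (a ∷ x) = sym (trans (dot-⊕ʳ c x _) (trans (cong (dot c x +_) (dot-•ʳ (- (a * r)) c e′)) (lem (dot c x) a r (dot c e′))))
    where
    lem : ∀ p a r q → p + - (a * r) * q ≡ - (r * q) * a + p
    lem = solve-∀ ℚ-ring

-- Meant for heads `a > 0 > b`: then both coefficients are positive, the heads cancel, and the tail
-- of the combination remains.
eliminate : ∀ {n} → Pt (suc n) → Pt (suc n) → Pt n
eliminate (a ∷ x) (b ∷ y) = ((- b) • x) ⊕ (a • y)

-- Induction on the dimension. An equation with nonzero head allows a Gaussian elimination;
-- otherwise the head coordinate of the functional is restricted by inequalities only, and a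
-- Fourier-Motzkin step removes it. Each step carries back a solution or a certificate, so one
-- recursion yields both decidability and a Farkas-type alternative.
motzkin : ∀ n (E S : List (Pt n)) → Feas E S ⊎ Cone E S 0ᵥ
motzkin zero E [] = inj₁ ([] , sat (λ { {[]} _ → refl }) (λ ()))
motzkin zero E ([] ∷ S) = inj₂ (base (here refl))
motzkin (suc n) E S with Any.any? (λ e → ¬? (Vec.head e ℚ.≟ 0ℚ)) E
... | yes has-pivot = pivoting (proj₁ piv) (proj₁ (proj₂ piv)) (proj₂ (proj₂ piv))
  where
  piv = find has-pivot
  pivoting : ∀ e → e ∈ E → Vec.head e ≢ 0ℚ → Feas E S ⊎ Cone E S 0ᵥ
  pivoting (e₀ ∷ e′) e∈E e₀≢0 = ⊎-map onFeas onCone (motzkin n (List.map ρ E) (List.map ρ S))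
    where
    open Pivot e₀ e′ e₀≢0
    onFeas : Feas (List.map ρ E) (List.map ρ S) → Feas E S
    onFeas (c , sat eq st) = lift c , sat
      (λ {x} x∈ → trans (dot-lift c x) (eq (∈-map⁺ ρ x∈)))
      (λ {x} x∈ → subst (0ℚ <_) (sym (dot-lift c x)) (st (∈-map⁺ ρ x∈)))
    onCone : Cone (List.map ρ E) (List.map ρ S) 0ᵥ → Cone E S 0ᵥ
    onCone = Cone-map (0ℚ ∷_)
      (λ x y → cong (_∷ (x ⊕ y)) (sym (ℚP.+-identityʳ 0ℚ)))
      (λ a x → cong (_∷ (a • x)) (sym (ℚP.*-zeroʳ a)))
      (λ s∈ → let s , s∈S , s≡ = ∈-map⁻ ρ s∈ in
        subst (Cone E S) (sym (trans (cong (0ℚ ∷_) s≡) (embed-ρ s))) (shift (- (Vec.head s * r)) e∈E (base s∈S)))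
      -- `ρ f` is `f` plus a multiple of the pivot, so a shift along it amounts to two shifts along
      -- equations of `E`.
      (λ {_} {x} f∈ a p → let f , f∈E , f≡ = ∈-map⁻ ρ f∈ in
        subst (Cone E S) (sym (shift-twice x a f f≡)) (shift (a * - (Vec.head f * r)) e∈E (shift a f∈E p)))
      where
      open ≡-Reasoning
      shift-twice : ∀ x a f {y} → y ≡ ρ f → x ⊕ (a • (0ℚ ∷ y)) ≡ (x ⊕ (a • f)) ⊕ ((a * - (Vec.head f * r)) • (e₀ ∷ e′))
      shift-twice x a f {y} refl = begin
        x ⊕ (a • (0ℚ ∷ ρ f)) ≡⟨ cong (λ z → x ⊕ (a • z)) (embed-ρ f) ⟩
        x ⊕ (a • (f ⊕ (t • (e₀ ∷ e′)))) ≡⟨ cong (x ⊕_) (•-distribˡ a f _) ⟩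
        x ⊕ ((a • f) ⊕ (a • (t • (e₀ ∷ e′)))) ≡⟨ sym (⊕-assoc x (a • f) _) ⟩
        (x ⊕ (a • f)) ⊕ (a • (t • (e₀ ∷ e′))) ≡⟨ cong ((x ⊕ (a • f)) ⊕_) (sym (•-assoc a t _)) ⟩
        (x ⊕ (a • f)) ⊕ ((a * t) • (e₀ ∷ e′)) ∎
        where t = - (Vec.head f * r)
... | no no-pivot = ⊎-map onFeas onCone (motzkin n E′ S′)
  where
  head? : ∀ (R : ℚ → Set) → (∀ a → Dec (R a)) → ∀ (x : Pt (suc n)) → Dec (R (Vec.head x))
  head? R R? x = R? (Vec.head x)
  zer? = head? (_≡ 0ℚ) (ℚ._≟ 0ℚ)
  pos? = head? (0ℚ <_) (0ℚ ℚ.<?_)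
  neg? = head? (_< 0ℚ) (ℚ._<? 0ℚ)
  Z = List.filter zer? S
  P = List.filter pos? S
  N = List.filter neg? S
  E′ = List.map Vec.tail E
  S′ = List.map Vec.tail Z ++ List.cartesianProductWith eliminate P N

  head-E : ∀ {e} → e ∈ E → Vec.head e ≡ 0ℚ
  head-E {e} e∈E with Vec.head e ℚ.≟ 0ℚ
  ... | yes p = p
  ... | no p = ⊥-elim (no-pivot (lose e∈E p))

  onFeas : Feas E′ S′ → Feas E S
  onFeas (c , sat eq st) = (c₀ ∷ c) , sat
    (λ {e} e∈ → satE e∈ (head-E e∈))
    (λ {s} s∈ → satS s s∈)
    where
    -- The head coordinate must exceed -(c·p)/p₀ for heads p₀ > 0 and stay below it for heads p₀ < 0.
    root : Pt (suc n) → ℚ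
    root (a ∷ x) with a ℚ.≟ 0ℚ
    ... | yes _ = 0ℚ
    ... | no a≢0 = - (proj₁ (recip a a≢0) * dot c x)

    root-eq : ∀ a x → a ≢ 0ℚ → root (a ∷ x) * a + dot c x ≡ 0ℚ
    root-eq a x a≢0 with a ℚ.≟ 0ℚ
    ... | yes a≡0 = ⊥-elim (a≢0 a≡0)
    ... | no a≢0 = trans (lem (proj₁ (recip a a≢0)) a (dot c x))
      (trans (cong (λ z → dot c x - z * dot c x) (proj₂ (recip a a≢0)))
        (trans (cong (λ z → dot c x - z) (ℚP.*-identityˡ (dot c x))) (ℚP.+-inverseʳ (dot c x))))
      where
      lem : ∀ r a d → - (r * d) * a + d ≡ d - (r * a) * d
      lem = solve-∀ ℚ-ring

    Ls = List.map root P
    Us = List.map root N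

    -- Scaled by the positive number `a * - b`, the gap between the two roots is the value of `c` on
    -- the eliminated vector.
    separated : ∀ {l u} → l ∈ Ls → u ∈ Us → l < u
    separated l∈ u∈ with ∈-map⁻ root l∈ | ∈-map⁻ root u∈
    ... | (a ∷ x) , p∈ , refl | (b ∷ y) , n∈ , refl = 0<-⇒< (ℚP.*-cancelˡ-<-nonNeg ab {{nn}} scaled)
      where
      a>0 : 0ℚ < a
      a>0 = proj₂ (∈-filter⁻ pos? {xs = S} p∈)
      b<0 : b < 0ℚ
      b<0 = proj₂ (∈-filter⁻ neg? {xs = S} n∈)
      ab = a * - b
      ab>0 : 0ℚ < ab
      ab>0 = pos*pos a>0 (neg-pos b<0)
      nn = ℚP.pos⇒nonNeg ab {{ℚ.positive ab>0}}
      ra = root (a ∷ x)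
      rb = root (b ∷ y)
      lem : ∀ a b ra rb cx cy → a * - b * (rb - ra) ≡ (- b * cx + a * cy) - (- b * (ra * a + cx) + a * (rb * b + cy))
      lem = solve-∀ ℚ-ring
      value : ab * (rb - ra) ≡ dot c (eliminate (a ∷ x) (b ∷ y))
      value = begin
        ab * (rb - ra) ≡⟨ lem a b ra rb (dot c x) (dot c y) ⟩
        (- b * dot c x + a * dot c y) - (- b * (ra * a + dot c x) + a * (rb * b + dot c y))
          ≡⟨ cong₂ (λ z w → (- b * dot c x + a * dot c y) - (- b * z + a * w)) (root-eq a x (pos⇒≢0 a>0)) (root-eq b y (neg⇒≢0 b<0)) ⟩
        (- b * dot c x + a * dot c y) - (- b * 0ℚ + a * 0ℚ)
          ≡⟨ lem₂ a b (dot c x) (dot c y) ⟩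
        - b * dot c x + a * dot c y ≡⟨ sym (cong₂ _+_ (dot-•ʳ (- b) c x) (dot-•ʳ a c y)) ⟩
        dot c ((- b) • x) + dot c (a • y) ≡⟨ sym (dot-⊕ʳ c _ _) ⟩
        dot c (eliminate (a ∷ x) (b ∷ y)) ∎
        where
        open ≡-Reasoning
        lem₂ : ∀ a b p q → (- b * p + a * q) - (- b * 0ℚ + a * 0ℚ) ≡ - b * p + a * q
        lem₂ = solve-∀ ℚ-ring
      scaled : ab * 0ℚ < ab * (rb - ra)
      scaled = subst₂ _<_ (sym (ℚP.*-zeroʳ ab)) (sym value)
        (st (∈-++⁺ʳ (List.map Vec.tail Z) (∈-cartesianProductWith⁺ eliminate p∈ n∈)))

    bet = between Ls Us separated
    c₀ = proj₁ bet

    satE : ∀ {e} → e ∈ E → Vec.head e ≡ 0ℚ → dot (c₀ ∷ c) e ≡ 0ℚ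
    satE {a ∷ x} e∈ refl = trans (cong₂ _+_ (ℚP.*-zeroʳ c₀) (eq (∈-map⁺ Vec.tail e∈))) (ℚP.+-identityʳ 0ℚ)

    satS : ∀ s → s ∈ S → 0ℚ < dot (c₀ ∷ c) s
    satS (a ∷ x) s∈ with ℚP.<-cmp 0ℚ a
    ... | tri≈ _ refl _ = subst (0ℚ <_)
      (sym (trans (cong (_+ dot c x) (ℚP.*-zeroʳ c₀)) (ℚP.+-identityˡ _)))
      (st (∈-++⁺ˡ (∈-map⁺ Vec.tail (∈-filter⁺ zer? s∈ refl))))
    ... | tri< a>0 _ _ = subst (0ℚ <_) value (pos*pos (<⇒0<- (proj₁ (proj₂ bet) (∈-map⁺ root (∈-filter⁺ pos? s∈ a>0)))) a>0)
      where
      lem : ∀ c₀ r a d → (c₀ - r) * a ≡ (c₀ * a + d) - (r * a + d)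
      lem = solve-∀ ℚ-ring
      value : (c₀ - root (a ∷ x)) * a ≡ c₀ * a + dot c x
      value = trans (lem c₀ (root (a ∷ x)) a (dot c x)) (trans (cong (λ z → (c₀ * a + dot c x) - z) (root-eq a x (pos⇒≢0 a>0))) (ℚP.+-identityʳ _))
    ... | tri> _ _ a<0 = subst (0ℚ <_) value (pos*pos (<⇒0<- (proj₂ (proj₂ bet) (∈-map⁺ root (∈-filter⁺ neg? s∈ a<0)))) (neg-pos a<0))
      where
      lem : ∀ c₀ r a d → (r - c₀) * - a ≡ (c₀ * a + d) - (r * a + d)
      lem = solve-∀ ℚ-ring
      value : (root (a ∷ x) - c₀) * - a ≡ c₀ * a + dot c x
      value = trans (lem c₀ (root (a ∷ x)) a (dot c x)) (trans (cong (λ z → (c₀ * a + dot c x) - z) (root-eq a x (neg⇒≢0 a<0))) (ℚP.+-identityʳ _))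

  onCone : Cone E′ S′ 0ᵥ → Cone E S 0ᵥ
  onCone = Cone-map (0ℚ ∷_)
    (λ x y → cong (_∷ (x ⊕ y)) (sym (ℚP.+-identityʳ 0ℚ)))
    (λ a x → cong (_∷ (a • x)) (sym (ℚP.*-zeroʳ a)))
    onS
    (λ {_} {x} e∈ a p → onE e∈ a x p)
    where
    onS : ∀ {s} → s ∈ S′ → Cone E S (0ℚ ∷ s)
    onS s∈ with ∈-++⁻ (List.map Vec.tail Z) s∈
    ... | inj₁ s∈Z with ∈-map⁻ Vec.tail s∈Z
    ...   | (a ∷ x) , x∈Z , refl with ∈-filter⁻ zer? {xs = S} x∈Z
    ...     | x∈S , refl = base x∈S
    onS s∈ | inj₂ s∈PN with ∈-cartesianProductWith⁻ eliminate P N s∈PN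
    ...   | (a ∷ x) , (b ∷ y) , p∈ , n∈ , refl with ∈-filter⁻ pos? {xs = S} p∈ | ∈-filter⁻ neg? {xs = S} n∈
    ...     | p∈S , a>0 | n∈S , b<0 = subst (λ z → Cone E S (z ∷ eliminate (a ∷ x) (b ∷ y))) (lem a b)
                (add (scale (neg-pos b<0) (base p∈S)) (scale a>0 (base n∈S)))
      where
      lem : ∀ a b → - b * a + a * b ≡ 0ℚ
      lem = solve-∀ ℚ-ring
    onE : ∀ {e} → e ∈ E′ → ∀ a x → Cone E S x → Cone E S (x ⊕ (a • (0ℚ ∷ e)))
    onE e∈ a x p with ∈-map⁻ Vec.tail e∈
    ... | (b ∷ y) , y∈E , refl with head-E y∈E
    ...   | refl = shift a y∈E p

Feas? : ∀ {n} (E S : List (Pt n)) → Dec (Feas E S)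
Feas? {n} E S with motzkin n E S
... | inj₁ f = yes f
... | inj₂ c = no (Cone-0-infeasible c)

infeasible⇒Cone : ∀ {n} {E S : List (Pt n)} → ¬ Feas E S → Cone E S 0ᵥ
infeasible⇒Cone {n} {E} {S} ¬f with motzkin n E S
... | inj₁ f = ⊥-elim (¬f f)
... | inj₂ c = c

-- Euler characteristics of relatively open cones

archimedean : ∀ a b → 0ℚ < b → ∃ λ t → 0ℚ < t × 0ℚ < t * b + a
archimedean a b b>0 with 0ℚ ℚ.<? b + a
... | yes p = 1ℚ , 0<1 , subst (λ z → 0ℚ < z + a) (sym (ℚP.*-identityˡ b)) p
... | no p with pos-recip b>0
...   | r , r>0 , rb = (1ℚ - r * a) , t>0 , subst (0ℚ <_) (sym value) b>0
  where
  a≤0 : a < 0ℚ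
  a≤0 = ℚP.≰⇒> (λ a≥0 → p (pos+nonneg b>0 a≥0))
  lem₁ : ∀ r a → 1ℚ + r * - a ≡ 1ℚ - r * a
  lem₁ = solve-∀ ℚ-ring
  t>0 : 0ℚ < 1ℚ - r * a
  t>0 = subst (0ℚ <_) (lem₁ r a) (pos+pos 0<1 (pos*pos r>0 (neg-pos a≤0)))
  lem₂ : ∀ r a b → (1ℚ - r * a) * b + a ≡ b + (a - (r * b) * a)
  lem₂ = solve-∀ ℚ-ring
  lem₃ : ∀ a b → b + (a - 1ℚ * a) ≡ b
  lem₃ = solve-∀ ℚ-ring
  value : (1ℚ - r * a) * b + a ≡ b
  value = trans (lem₂ r a b) (trans (cong (λ z → b + (a - z * a)) rb) (lem₃ a b))

dot-line : ∀ {n} t (c e x : Pt n) → dot ((t • c) ⊕ e) x ≡ t * dot c x + dot e x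
dot-line t c e x = trans (dot-⊕ˡ (t • c) e x) (cong (_+ dot e x) (dot-•ˡ t c x))

dominate : ∀ {n} (S : List (Pt n)) (c e : Pt n) → (∀ {s} → s ∈ S → 0ℚ < dot c s) →
  ∃ λ t → 0ℚ < t × (∀ {s} → s ∈ S → 0ℚ < t * dot c s + dot e s)
dominate [] c e h = 1ℚ , 0<1 , λ ()
dominate (s ∷ S) c e h with dominate S c e (h ∘ there) | archimedean (dot e s) (dot c s) (h (here refl))
... | t , t>0 , ht | u , u>0 , hu = t + u , pos+pos t>0 u>0 , λ
  { (here refl) → subst (0ℚ <_) (lem₁ t u (dot c s) (dot e s)) (pos+pos (pos*pos t>0 (h (here refl))) hu)
  ; (there m) → step m }
  where
  lem₁ : ∀ t u c e → t * c + (u * c + e) ≡ (t + u) * c + e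
  lem₁ = solve-∀ ℚ-ring
  lem₂ : ∀ t u c e → (t * c + e) + u * c ≡ (t + u) * c + e
  lem₂ = solve-∀ ℚ-ring
  step : ∀ {s′} → s′ ∈ S → 0ℚ < (t + u) * dot c s′ + dot e s′
  step {s′} m = subst (0ℚ <_) (lem₂ t u (dot c s′) (dot e s′)) (pos+pos (ht m) (pos*pos u>0 (h (there m))))

-- A solution stays one when moved slightly in a direction that vanishes on `E`; by homogeneity,
-- enlarging `c` replaces making `e` small.
perturb : ∀ {n} {E S : List (Pt n)} {c e} → Sat E S c → (∀ {x} → x ∈ E → dot e x ≡ 0ℚ) →
  ∃ λ t → 0ℚ < t × Sat E S ((t • c) ⊕ e)
perturb {E = E} {S} {c} {e} h e⊥E with dominate S c e (on-S h)
... | t , t>0 , ht = t , t>0 , sat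
  (λ {x} x∈ → trans (dot-line t c e x) (trans (cong₂ _+_ (trans (cong (t *_) (on-E h x∈)) (ℚP.*-zeroʳ t)) (e⊥E x∈)) (ℚP.+-identityʳ 0ℚ)))
  (λ {x} x∈ → subst (0ℚ <_) (sym (dot-line t c e x)) (ht x∈))

Sat-drop : ∀ {n} {E S : List (Pt n)} {c v} → Sat E (v ∷ S) c → Sat E S c
Sat-drop h = sat (on-E h) (on-S h ∘ there)

Sat-dropE : ∀ {n} {E S : List (Pt n)} {c v} → Sat (v ∷ E) S c → Sat E S c
Sat-dropE h = sat (on-E h ∘ there) (on-S h)

Sat-cons : ∀ {n} {E S : List (Pt n)} {c v} → 0ℚ < dot c v → Sat E S c → Sat E (v ∷ S) c
Sat-cons p h = sat (on-E h) λ { (here refl) → p ; (there m) → on-S h m }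

Sat-consE : ∀ {n} {E S : List (Pt n)} {c v} → dot c v ≡ 0ℚ → Sat E S c → Sat (v ∷ E) S c
Sat-consE p h = sat (λ { (here refl) → p ; (there m) → on-E h m }) (on-S h)

Sat-add : ∀ {n} {E S : List (Pt n)} {c d a b} → 0ℚ < a → 0ℚ < b → Sat E S c → Sat E S d → Sat E S ((a • c) ⊕ (b • d))
Sat-add {c = c} {d} {a} {b} a>0 b>0 h h′ = sat
  (λ {x} m → trans (value x) (trans (cong₂ _+_ (trans (cong (a *_) (on-E h m)) (ℚP.*-zeroʳ a)) (trans (cong (b *_) (on-E h′ m)) (ℚP.*-zeroʳ b))) (ℚP.+-identityʳ 0ℚ)))
  (λ {x} m → subst (0ℚ <_) (sym (value x)) (pos+pos (pos*pos a>0 (on-S h m)) (pos*pos b>0 (on-S h′ m))))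
  where
  value : ∀ x → dot ((a • c) ⊕ (b • d)) x ≡ a * dot c x + b * dot d x
  value x = trans (dot-line a c (b • d) x) (cong (a * dot c x +_) (dot-•ˡ b d x))

ind : ∀ {A : Set} → Dec A → ℤ
ind (yes _) = ℤ.1ℤ
ind (no _) = ℤ.0ℤ

ind-yes : ∀ {A : Set} (d : Dec A) → A → ind d ≡ ℤ.1ℤ
ind-yes (yes _) a = refl
ind-yes (no ¬a) a = ⊥-elim (¬a a)

ind-no : ∀ {A : Set} (d : Dec A) → ¬ A → ind d ≡ ℤ.0ℤ
ind-no (yes a) ¬a = ⊥-elim (¬a a)
ind-no (no _) ¬a = refl

ind-cong : ∀ {A B : Set} (d : Dec A) (d′ : Dec B) → (A → B) → (B → A) → ind d ≡ ind d′
ind-cong (yes a) d′ f g = sym (ind-yes d′ (f a))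
ind-cong (no ¬a) d′ f g = sym (ind-no d′ (¬a ∘ g))

negateIf : ∀ {A : Set} → Dec A → ℤ → ℤ
negateIf (yes _) z = ℤ.- z
negateIf (no _) z = z

-- (-1)^(rank E): prepending v raises the rank exactly when some functional vanishing on E does not vanish on v.
par : ∀ {n} → List (Pt n) → ℤ
par [] = ℤ.1ℤ
par (v ∷ E) = negateIf (Feas? E (v ∷ [])) (par E)

-- Up to the sign (-1)^n, the Euler characteristic (with compact supports) of the relatively open cone defined by E and S.
χ : ∀ {n} → List (Pt n) → List (Pt n) → ℤ
χ E S = par E ℤ.* ind (Feas? E S)

χ-yes : ∀ {n} {E S : List (Pt n)} → Feas E S → χ E S ≡ par E
χ-yes {E = E} {S} f = trans (cong (par E ℤ.*_) (ind-yes (Feas? E S) f)) (ℤP.*-identityʳ (par E))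

χ-no : ∀ {n} {E S : List (Pt n)} → ¬ Feas E S → χ E S ≡ ℤ.0ℤ
χ-no {E = E} {S} f = trans (cong (par E ℤ.*_) (ind-no (Feas? E S) f)) (ℤP.*-zeroʳ (par E))

χ-cong : ∀ {n} {E S S′ : List (Pt n)} → (Feas E S → Feas E S′) → (Feas E S′ → Feas E S) → χ E S ≡ χ E S′
χ-cong {E = E} {S} {S′} f g = cong (par E ℤ.*_) (ind-cong (Feas? E S) (Feas? E S′) f g)

0<dot-neg : ∀ {n} (c v : Pt n) → dot c v < 0ℚ → 0ℚ < dot c (neg v)
0<dot-neg c v p = subst (0ℚ <_) (sym (dot-negʳ c v)) (neg-pos p)

0<dot-neg⁻ : ∀ {n} (c v : Pt n) → 0ℚ < dot c (neg v) → dot c v < 0ℚ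
0<dot-neg⁻ c v p = neg-pos⁻ (subst (0ℚ <_) (dot-negʳ c v) p)

-- Let the cone be nonempty. If every functional vanishing on `E` also vanishes on `v`, the cone
-- equals its slice `v = 0` and the parity is unchanged. Otherwise the slice has the opposite sign:
-- when it is nonempty so are both open sides, giving `- p + (p + p)`, and when it is empty
-- convexity leaves exactly one side.
χ-additive : ∀ {n} (E S : List (Pt n)) (v : Pt n) →
  χ (v ∷ E) S ℤ.+ (χ E (v ∷ S) ℤ.+ χ E (neg v ∷ S)) ≡ χ E S
χ-additive E S v with Feas? E S
... | no ¬f = begin
    χ (v ∷ E) S ℤ.+ (χ E (v ∷ S) ℤ.+ χ E (neg v ∷ S))
      ≡⟨ cong₂ ℤ._+_ (χ-no {E = v ∷ E} {S} (λ (c , h) → ¬f (c , Sat-dropE h)))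
           (cong₂ ℤ._+_ (χ-no {E = E} {v ∷ S} (λ (c , h) → ¬f (c , Sat-drop h))) (χ-no {E = E} {neg v ∷ S} (λ (c , h) → ¬f (c , Sat-drop h)))) ⟩
    ℤ.0ℤ ≡⟨ sym (ℤP.*-zeroʳ (par E)) ⟩
    par E ℤ.* ℤ.0ℤ ∎
  where open ≡-Reasoning
... | yes (c , h) = trans (cases (Feas? E (v ∷ []))) (sym (ℤP.*-identityʳ (par E)))
  where
  open ≡-Reasoning
  P = par E

  cancel : ∀ p → ℤ.- p ℤ.+ (p ℤ.+ p) ≡ p
  cancel p = trans (sym (ℤP.+-assoc (ℤ.- p) p p)) (trans (cong (ℤ._+ p) (ℤP.+-inverseˡ p)) (ℤP.+-identityˡ p))

  crossing : Feas E (v ∷ S) → Feas E (neg v ∷ S) → Feas (v ∷ E) S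
  crossing (a , ha) (b , hb) = ((- bv) • a) ⊕ (av • b) ,
    Sat-consE zero-at-v (Sat-add (neg-pos bv<0) av>0 (Sat-drop ha) (Sat-drop hb))
    where
    av = dot a v
    bv = dot b v
    av>0 : 0ℚ < av
    av>0 = on-S ha (here refl)
    bv<0 : bv < 0ℚ
    bv<0 = 0<dot-neg⁻ b v (on-S hb (here refl))
    lem : ∀ a b → - b * a + a * b ≡ 0ℚ
    lem = solve-∀ ℚ-ring
    zero-at-v : dot (((- bv) • a) ⊕ (av • b)) v ≡ 0ℚ
    zero-at-v = trans (dot-line (- bv) a (av • b) v) (trans (cong (- bv * av +_) (dot-•ˡ av b v)) (lem av bv))

  cases : Dec (Feas E (v ∷ [])) → χ (v ∷ E) S ℤ.+ (χ E (v ∷ S) ℤ.+ χ E (neg v ∷ S)) ≡ P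
  cases (no ¬flip) = begin
    χ (v ∷ E) S ℤ.+ (χ E (v ∷ S) ℤ.+ χ E (neg v ∷ S))
      ≡⟨ cong₂ ℤ._+_ (trans (χ-yes {E = v ∷ E} {S} (c , Sat-consE cv≡0 h)) par≡)
           (cong₂ ℤ._+_ (χ-no {E = E} {v ∷ S} (λ (a , ha) → ¬flip (a , sat (on-E ha) λ { (here refl) → on-S ha (here refl) })))
                        (χ-no {E = E} {neg v ∷ S} λ (a , ha) → not-neg a (on-E ha) (on-S ha (here refl)))) ⟩
    P ℤ.+ ℤ.0ℤ ≡⟨ ℤP.+-identityʳ P ⟩
    P ∎
    where
    not-pos : ∀ a → (∀ {x} → x ∈ E → dot a x ≡ 0ℚ) → ¬ 0ℚ < dot a v
    not-pos a a⊥ p = ¬flip (a , sat a⊥ λ { (here refl) → p })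
    not-neg : ∀ a → (∀ {x} → x ∈ E → dot a x ≡ 0ℚ) → ¬ 0ℚ < dot a (neg v)
    not-neg a a⊥ p = not-pos (neg a) (λ {x} m → trans (dot-negˡ a x) (cong -_ (a⊥ m)))
      (subst (0ℚ <_) (trans (dot-negʳ a v) (sym (dot-negˡ a v))) p)
    cv≡0 : dot c v ≡ 0ℚ
    cv≡0 with ℚP.<-cmp 0ℚ (dot c v)
    ... | tri< p _ _ = ⊥-elim (not-pos c (on-E h) p)
    ... | tri≈ _ p _ = sym p
    ... | tri> _ _ p = ⊥-elim (not-neg c (on-E h) (0<dot-neg c v p))
    par≡ : par (v ∷ E) ≡ P
    par≡ with Feas? E (v ∷ [])
    ... | yes f = ⊥-elim (¬flip f)
    ... | no _ = refl
  cases (yes (e , he)) with Feas? (v ∷ E) S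
  ... | yes (c₀ , h₀) = begin
    par (v ∷ E) ℤ.* ℤ.1ℤ ℤ.+ (χ E (v ∷ S) ℤ.+ χ E (neg v ∷ S))
      ≡⟨ cong₂ ℤ._+_ (trans (ℤP.*-identityʳ (par (v ∷ E))) par≡) (cong₂ ℤ._+_ (χ-yes {E = E} {v ∷ S} above) (χ-yes {E = E} {neg v ∷ S} below)) ⟩
    ℤ.- P ℤ.+ (P ℤ.+ P) ≡⟨ cancel P ⟩
    P ∎
    where
    par≡ : par (v ∷ E) ≡ ℤ.- P
    par≡ with Feas? E (v ∷ [])
    ... | yes _ = refl
    ... | no ¬f = ⊥-elim (¬f (e , he))
    -- `c₀` vanishes at `v`, so however much it is scaled, the sign at `v` is that of the
    -- perturbation.
    at-v : ∀ t d → dot ((t • c₀) ⊕ d) v ≡ dot d v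
    at-v t d = trans (dot-line t c₀ d v) (trans (cong (λ z → t * z + dot d v) (on-E h₀ (here refl)))
      (trans (cong (_+ dot d v) (ℚP.*-zeroʳ t)) (ℚP.+-identityˡ (dot d v))))
    above : Feas E (v ∷ S)
    above with perturb (Sat-dropE h₀) (on-E he)
    ... | t , _ , ht = _ , Sat-cons (subst (0ℚ <_) (sym (at-v t e)) (on-S he (here refl))) ht
    below : Feas E (neg v ∷ S)
    below = let t , _ , ht = perturb {e = neg e} (Sat-dropE h₀) neg-e⊥E in (t • c₀) ⊕ neg e , Sat-cons (at-neg-v t) ht
      where
      neg-e⊥E : ∀ {x} → x ∈ E → dot (neg e) x ≡ 0ℚ
      neg-e⊥E {x} m = trans (dot-negˡ e x) (cong -_ (on-E he m))
      dot-neg-e-v : dot (neg e) v < 0ℚ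
      dot-neg-e-v = subst (_< 0ℚ) (sym (dot-negˡ e v)) (pos-neg (on-S he (here refl)))
      at-neg-v : ∀ t → 0ℚ < dot ((t • c₀) ⊕ neg e) (neg v)
      at-neg-v t = 0<dot-neg ((t • c₀) ⊕ neg e) v (subst (_< 0ℚ) (sym (at-v t (neg e))) dot-neg-e-v)
  ... | no ¬f = trans (cong₂ ℤ._+_ (ℤP.*-zeroʳ (par (v ∷ E))) refl) (trans (ℤP.+-identityˡ _) one-side)
    where
    one-side : χ E (v ∷ S) ℤ.+ χ E (neg v ∷ S) ≡ P
    one-side with ℚP.<-cmp 0ℚ (dot c v)
    ... | tri≈ _ p _ = ⊥-elim (¬f (c , Sat-consE (sym p) h))
    ... | tri< p _ _ = trans (cong₂ ℤ._+_ (χ-yes {E = E} {v ∷ S} (c , Sat-cons p h)) (χ-no {E = E} {neg v ∷ S} (λ g → ¬f (crossing (c , Sat-cons p h) g)))) (ℤP.+-identityʳ P)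
    ... | tri> _ _ p = trans (cong₂ ℤ._+_ (χ-no {E = E} {v ∷ S} (λ g → ¬f (crossing g (c , Sat-cons p′ h)))) (χ-yes {E = E} {neg v ∷ S} (c , Sat-cons p′ h))) (ℤP.+-identityˡ P)
      where p′ = 0<dot-neg c v p

-- Sums over lists and integration over open cones

sumL : ∀ {A : Set} → (A → ℤ) → List A → ℤ
sumL f [] = ℤ.0ℤ
sumL f (x ∷ xs) = f x ℤ.+ sumL f xs

sumL-cong : ∀ {A : Set} {f g : A → ℤ} (xs : List A) → (∀ {x} → x ∈ xs → f x ≡ g x) → sumL f xs ≡ sumL g xs
sumL-cong [] h = refl
sumL-cong (x ∷ xs) h = cong₂ ℤ._+_ (h (here refl)) (sumL-cong xs (h ∘ there))

sumL-0 : ∀ {A : Set} {f : A → ℤ} (xs : List A) → (∀ {x} → x ∈ xs → f x ≡ ℤ.0ℤ) → sumL f xs ≡ ℤ.0ℤ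
sumL-0 [] h = refl
sumL-0 (x ∷ xs) h = cong₂ ℤ._+_ (h (here refl)) (sumL-0 xs (h ∘ there))

ℤ-interchange : ∀ a b c d → (a ℤ.+ b) ℤ.+ (c ℤ.+ d) ≡ (a ℤ.+ c) ℤ.+ (b ℤ.+ d)
ℤ-interchange = ℤ-solve-∀

sumL-+ : ∀ {A : Set} (f g : A → ℤ) (xs : List A) → sumL (λ x → f x ℤ.+ g x) xs ≡ sumL f xs ℤ.+ sumL g xs
sumL-+ f g [] = refl
sumL-+ f g (x ∷ xs) = trans (cong (λ z → f x ℤ.+ g x ℤ.+ z) (sumL-+ f g xs)) (ℤ-interchange (f x) (g x) (sumL f xs) (sumL g xs))

sumL-* : ∀ {A : Set} a (f : A → ℤ) (xs : List A) → sumL (λ x → a ℤ.* f x) xs ≡ a ℤ.* sumL f xs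
sumL-* a f [] = sym (ℤP.*-zeroʳ a)
sumL-* a f (x ∷ xs) = trans (cong (λ z → a ℤ.* f x ℤ.+ z) (sumL-* a f xs)) (sym (ℤP.*-distribˡ-+ a (f x) _))

sumL-neg : ∀ {A : Set} (f : A → ℤ) (xs : List A) → sumL (λ x → ℤ.- f x) xs ≡ ℤ.- sumL f xs
sumL-neg f [] = refl
sumL-neg f (x ∷ xs) = trans (cong (λ z → ℤ.- f x ℤ.+ z) (sumL-neg f xs)) (sym (ℤP.neg-distrib-+ (f x) _))

sumL-++ : ∀ {A : Set} (f : A → ℤ) (xs ys : List A) → sumL f (xs ++ ys) ≡ sumL f xs ℤ.+ sumL f ys
sumL-++ f [] ys = sym (ℤP.+-identityˡ _)
sumL-++ f (x ∷ xs) ys = trans (cong (λ z → f x ℤ.+ z) (sumL-++ f xs ys)) (sym (ℤP.+-assoc (f x) _ _))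

sumL-map : ∀ {A B : Set} (f : B → ℤ) (g : A → B) (xs : List A) → sumL f (List.map g xs) ≡ sumL (f ∘ g) xs
sumL-map f g [] = refl
sumL-map f g (x ∷ xs) = cong (λ z → f (g x) ℤ.+ z) (sumL-map f g xs)

Positive : ∀ {n} → Pt n → List (Pt n) → Set
Positive c A = All (λ s → 0ℚ < dot c s) A

pos? : ∀ {n} (c : Pt n) A → Dec (Positive c A)
pos? c = All.all? (λ s → 0ℚ ℚ.<? dot c s)

Sat-++ : ∀ {n} {E S A : List (Pt n)} {c} → Sat E S c → Positive c A → Sat E (S ++ A) c
Sat-++ {S = S} h p = sat (on-E h) λ m → case ∈-++⁻ S m of λ where
  (inj₁ m₁) → on-S h m₁
  (inj₂ m₂) → All.lookup p m₂

Sat-++ˡ : ∀ {n} {E S A : List (Pt n)} {c} → Sat E (S ++ A) c → Sat E S c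
Sat-++ˡ h = sat (on-E h) (on-S h ∘ ∈-++⁺ˡ)

Sat-++ʳ : ∀ {n} {E A : List (Pt n)} {c} S → Sat E (S ++ A) c → Sat E A c
Sat-++ʳ S h = sat (on-E h) (on-S h ∘ ∈-++⁺ʳ S)

-- The space of functionals is cut into cells by the vectors of W, one at a time; on a final cell every A
-- in J has constant truth value. All the cones are open, so their Euler characteristics only differ from
-- the indicators of nonemptiness by a common sign.
integrate-cells : ∀ {n} (J : List (ℤ × List (Pt n))) →
  (∀ c → sumL (λ (w , A) → w ℤ.* ind (pos? c A)) J ≡ ℤ.0ℤ) →
  ∀ W E S → (∀ {w A} → (w , A) ∈ J → ∀ {a} → a ∈ A → a ∈ W ⊎ a ∈ E ⊎ a ∈ S ⊎ neg a ∈ S) →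
  sumL (λ (w , A) → w ℤ.* χ E (S ++ A)) J ≡ ℤ.0ℤ
integrate-cells J h [] E S determined with Feas? E S
... | no ¬f = sumL-0 J λ {(w , A)} _ → trans
      (cong (w ℤ.*_) (χ-no {E = E} {S ++ A} (λ (c , hc) → ¬f (c , Sat-++ˡ hc))))
      (ℤP.*-zeroʳ w)
... | yes (c , hc) = begin
    sumL (λ (w , A) → w ℤ.* χ E (S ++ A)) J
      ≡⟨ sumL-cong J (λ {(w , A)} m → trans (cong (λ z → w ℤ.* (par E ℤ.* z)) (ind≡ m)) (swap w (par E) (ind (pos? c A)))) ⟩
    sumL (λ (w , A) → par E ℤ.* (w ℤ.* ind (pos? c A))) J
      ≡⟨ sumL-* (par E) (λ (w , A) → w ℤ.* ind (pos? c A)) J ⟩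
    par E ℤ.* sumL (λ (w , A) → w ℤ.* ind (pos? c A)) J
      ≡⟨ cong (par E ℤ.*_) (h c) ⟩
    par E ℤ.* ℤ.0ℤ ≡⟨ ℤP.*-zeroʳ (par E) ⟩
    ℤ.0ℤ ∎
  where
  open ≡-Reasoning
  swap : ∀ a b c → a ℤ.* (b ℤ.* c) ≡ b ℤ.* (a ℤ.* c)
  swap = ℤ-solve-∀
  ind≡ : ∀ {w A} → (w , A) ∈ J → ind (Feas? E (S ++ A)) ≡ ind (pos? c A)
  ind≡ {w} {A} m = ind-cong (Feas? E (S ++ A)) (pos? c A) to (λ p → c , Sat-++ hc p)
    where
    -- `d` lies in the same cell as `c`, and there every vector of `A` has a settled sign;
    -- positivity at `d` rules out all but the positive one.
    to : Feas E (S ++ A) → Positive c A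
    to (d , hd) = All.tabulate λ {a} a∈A → decide a∈A (determined m a∈A)
      where
      decide : ∀ {a} → a ∈ A → a ∈ [] ⊎ a ∈ E ⊎ a ∈ S ⊎ neg a ∈ S → 0ℚ < dot c a
      decide {a} a∈A (inj₂ (inj₁ a∈E)) = ⊥-elim (pos⇒≢0 (on-S (Sat-++ʳ S hd) a∈A) (on-E hd a∈E))
      decide {a} a∈A (inj₂ (inj₂ (inj₁ a∈S))) = on-S hc a∈S
      decide {a} a∈A (inj₂ (inj₂ (inj₂ na∈S))) = ⊥-elim (ℚP.<-asym (on-S (Sat-++ʳ S hd) a∈A) (0<dot-neg⁻ d a (on-S (Sat-++ˡ hd) na∈S)))
integrate-cells J h (v ∷ W) E S determined = begin
    sumL (λ (w , A) → w ℤ.* χ E (S ++ A)) J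
      ≡⟨ sumL-cong J (λ {(w , A)} _ → trans (cong (w ℤ.*_) (sym (χ-additive E (S ++ A) v)))
           (distrib w (χ (v ∷ E) (S ++ A)) (χ E (v ∷ S ++ A)) (χ E (neg v ∷ S ++ A)))) ⟩
    sumL (λ j → f₀ j ℤ.+ (f₁ j ℤ.+ f₂ j)) J
      ≡⟨ trans (sumL-+ f₀ (λ j → f₁ j ℤ.+ f₂ j) J) (cong (λ z → sumL f₀ J ℤ.+ z) (sumL-+ f₁ f₂ J)) ⟩
    sumL f₀ J ℤ.+ (sumL f₁ J ℤ.+ sumL f₂ J)
      ≡⟨ cong₂ ℤ._+_ (integrate-cells J h W (v ∷ E) S (λ m a∈ → settle there (λ z → z) (λ e → inj₁ (here e)) (determined m a∈)))
          (cong₂ ℤ._+_ (integrate-cells J h W E (v ∷ S) (λ m a∈ → settle (λ z → z) there (λ e → inj₂ (inj₁ (here e))) (determined m a∈)))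
                       (integrate-cells J h W E (neg v ∷ S) (λ m a∈ → settle (λ z → z) there (λ e → inj₂ (inj₂ (here (cong neg e)))) (determined m a∈)))) ⟩
    ℤ.0ℤ ∎
  where
  open ≡-Reasoning
  f₀ f₁ f₂ : ℤ × List _ → ℤ
  f₀ (w , A) = w ℤ.* χ (v ∷ E) (S ++ A)
  f₁ (w , A) = w ℤ.* χ E (v ∷ S ++ A)
  f₂ (w , A) = w ℤ.* χ E (neg v ∷ S ++ A)
  distrib : ∀ w a b c → w ℤ.* (a ℤ.+ (b ℤ.+ c)) ≡ w ℤ.* a ℤ.+ (w ℤ.* b ℤ.+ w ℤ.* c)
  distrib = ℤ-solve-∀
  settle : ∀ {E′ S′ a} → (a ∈ E → a ∈ E′) → (∀ {b} → b ∈ S → b ∈ S′) → (a ≡ v → a ∈ E′ ⊎ a ∈ S′ ⊎ neg a ∈ S′) →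
    a ∈ v ∷ W ⊎ a ∈ E ⊎ a ∈ S ⊎ neg a ∈ S → a ∈ W ⊎ a ∈ E′ ⊎ a ∈ S′ ⊎ neg a ∈ S′
  settle E⊆ S⊆ at-v (inj₁ (here a≡v)) = inj₂ (at-v a≡v)
  settle E⊆ S⊆ at-v (inj₁ (there m)) = inj₁ m
  settle E⊆ S⊆ at-v (inj₂ r) = inj₂ (⊎-map E⊆ (⊎-map S⊆ S⊆) r)

-- The cutting hyperplanes are all the vectors occurring in `J`, and the initial cell is the whole
-- space, whose parity is 1.
integrate : ∀ {n} (J : List (ℤ × List (Pt n))) →
  (∀ c → sumL (λ (w , A) → w ℤ.* ind (pos? c A)) J ≡ ℤ.0ℤ) →
  sumL (λ (w , A) → w ℤ.* ind (Feas? [] A)) J ≡ ℤ.0ℤ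
integrate J h = trans
  (sumL-cong J (λ {(w , A)} _ → cong (w ℤ.*_) (sym (ℤP.*-identityˡ (ind (Feas? [] A))))))
  (integrate-cells J h (List.concatMap proj₂ J) [] [] (λ m a∈ → inj₁ (∈-concatMap⁺ proj₂ (lose m a∈))))

-- Splits of the generators and signed sums over them

splits : ∀ {A : Set} → List A → List (List A × List A)
splits [] = ([] , []) ∷ []
splits (v ∷ V) = List.map (λ (E , S) → v ∷ E , S) (splits V) ++ List.map (λ (E , S) → E , v ∷ S) (splits V)

sum-splits-∷ : ∀ {A : Set} (f : List A × List A → ℤ) v V →
  sumL f (splits (v ∷ V)) ≡ sumL (λ (E , S) → f (v ∷ E , S)) (splits V) ℤ.+ sumL (λ (E , S) → f (E , v ∷ S)) (splits V)
sum-splits-∷ f v V = trans (sumL-++ f (List.map (λ (E , S) → v ∷ E , S) (splits V)) _)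
  (cong₂ ℤ._+_ (sumL-map f (λ (E , S) → v ∷ E , S) (splits V)) (sumL-map f (λ (E , S) → E , v ∷ S) (splits V)))

sgn : ∀ {A : Set} → List A → ℤ
sgn [] = ℤ.1ℤ
sgn (_ ∷ E) = ℤ.- sgn E

NonPositive : ∀ {n} → Pt n → List (Pt n) → Set
NonPositive c A = All (λ s → ¬ 0ℚ < dot c s) A

nonpos? : ∀ {n} (c : Pt n) A → Dec (NonPositive c A)
nonpos? c = All.all? (λ s → ¬? (0ℚ ℚ.<? dot c s))

pos-∷-yes : ∀ {n} (c v : Pt n) → 0ℚ < dot c v → ∀ E → ind (pos? c (v ∷ E)) ≡ ind (pos? c E)
pos-∷-yes c v p E = ind-cong (pos? c (v ∷ E)) (pos? c E) All.tail (p ∷_)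

pos-∷-no : ∀ {n} (c v : Pt n) → ¬ 0ℚ < dot c v → ∀ E → ind (pos? c (v ∷ E)) ≡ ℤ.0ℤ
pos-∷-no c v ¬p E = ind-no (pos? c (v ∷ E)) (¬p ∘ All.head)

pos-++ : ∀ {n} (c : Pt n) A B → ind (pos? c (A ++ B)) ≡ ind (pos? c A) ℤ.* ind (pos? c B)
pos-++ c A B with pos? c A | pos? c B
... | yes p | yes q = ind-yes (pos? c (A ++ B)) (AllP.++⁺ p q)
... | yes p | no ¬q = ind-no (pos? c (A ++ B)) (¬q ∘ AllP.++⁻ʳ A)
... | no ¬p | _ = ind-no (pos? c (A ++ B)) (¬p ∘ AllP.++⁻ˡ A)

-- The sum is the expansion of the product of the factors `1 - [0 < c·v]` over `V`.
alternating-pointwise : ∀ {n} (c : Pt n) V →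
  sumL (λ (E , S) → sgn E ℤ.* ind (pos? c E)) (splits V) ≡ ind (nonpos? c V)
alternating-pointwise c [] = refl
alternating-pointwise c (v ∷ V) = trans (sum-splits-∷ (λ (E , S) → sgn E ℤ.* ind (pos? c E)) v V) (cases (0ℚ ℚ.<? dot c v))
  where
  rest = sumL (λ (E , S) → sgn E ℤ.* ind (pos? c E)) (splits V)
  first = sumL (λ (E , S) → ℤ.- sgn E ℤ.* ind (pos? c (v ∷ E))) (splits V)
  cases : Dec (0ℚ < dot c v) → first ℤ.+ rest ≡ ind (nonpos? c (v ∷ V))
  cases (yes p) = trans (cong (ℤ._+ rest) (trans
      (sumL-cong (splits V) (λ {(E , S)} _ → trans (cong (ℤ.- sgn E ℤ.*_) (pos-∷-yes c v p E)) (sym (ℤP.neg-distribˡ-* (sgn E) _))))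
      (sumL-neg (λ (E , S) → sgn E ℤ.* ind (pos? c E)) (splits V))))
    (trans (ℤP.+-inverseˡ rest) (sym (ind-no (nonpos? c (v ∷ V)) (λ h → All.head h p))))
  cases (no ¬p) = trans (cong (ℤ._+ rest)
      (sumL-0 (splits V) (λ {(E , S)} _ → trans (cong (ℤ.- sgn E ℤ.*_) (pos-∷-no c v ¬p E)) (ℤP.*-zeroʳ (ℤ.- sgn E)))))
    (trans (ℤP.+-identityˡ rest) (trans (alternating-pointwise c V) (ind-cong (nonpos? c V) (nonpos? c (v ∷ V)) (¬p ∷_) All.tail)))

-- The cones with `E` on the positive side of `c` fit together to the set of `y` that are `≥ 0`
-- where `c` is positive on `V`, and `> 0` on the rest of `V` and on `S₀`. If `c` is positive
-- somewhere on `V`, a line in direction `c` meets this set, if at all, in a half-open piece, closed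
-- towards `- c` and open towards `c`, so the Euler characteristic is 0. Otherwise only `E = []`
-- contributes.
faces-pointwise′ : ∀ {n} (c : Pt n) V S₀ → NonPositive c S₀ →
  sumL (λ (E , S) → χ E (S₀ ++ S) ℤ.* ind (pos? c E)) (splits V) ≡ ind (nonpos? c V) ℤ.* ind (Feas? [] (S₀ ++ V))
faces-pointwise′ c [] S₀ h = trans (ℤP.+-identityʳ _) (trans (ℤP.*-identityʳ (χ [] (S₀ ++ []))) refl)
faces-pointwise′ c (v ∷ V) S₀ h = trans (sum-splits-∷ (λ (E , S) → χ E (S₀ ++ S) ℤ.* ind (pos? c E)) v V) (cases (0ℚ ℚ.<? dot c v))
  where
  open ≡-Reasoning
  first second : List _ × List _ → ℤ
  first (E , S) = χ (v ∷ E) (S₀ ++ S) ℤ.* ind (pos? c (v ∷ E))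
  second (E , S) = χ E (S₀ ++ v ∷ S) ℤ.* ind (pos? c E)

  reorder : ∀ E B → χ E (S₀ ++ v ∷ B) ≡ χ E ((v ∷ S₀) ++ B)
  reorder E B = χ-cong {E = E} {S₀ ++ v ∷ B} {(v ∷ S₀) ++ B}
    (λ (d , hd) → d , sat (on-E hd) (on-S hd ∘ to))
    (λ (d , hd) → d , sat (on-E hd) (on-S hd ∘ from))
    where
    to : ∀ {x} → x ∈ v ∷ S₀ ++ B → x ∈ S₀ ++ v ∷ B
    to (here refl) = ∈-++⁺ʳ S₀ (here refl)
    to (there m) = case ∈-++⁻ S₀ m of λ where
      (inj₁ m₁) → ∈-++⁺ˡ m₁
      (inj₂ m₂) → ∈-++⁺ʳ S₀ (there m₂)
    from : ∀ {x} → x ∈ S₀ ++ v ∷ B → x ∈ v ∷ S₀ ++ B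
    from m = case ∈-++⁻ S₀ m of λ where
      (inj₁ m₁) → there (∈-++⁺ˡ m₁)
      (inj₂ (here refl)) → here refl
      (inj₂ (there m₂)) → there (∈-++⁺ʳ S₀ m₂)

  cases : Dec (0ℚ < dot c v) → sumL first (splits V) ℤ.+ sumL second (splits V) ≡ ind (nonpos? c (v ∷ V)) ℤ.* ind (Feas? [] (S₀ ++ v ∷ V))
  cases (no ¬p) = begin
    sumL first (splits V) ℤ.+ sumL second (splits V)
      ≡⟨ cong₂ ℤ._+_
           (sumL-0 (splits V) (λ {(E , S)} _ → trans (cong (χ (v ∷ E) (S₀ ++ S) ℤ.*_) (pos-∷-no c v ¬p E)) (ℤP.*-zeroʳ (χ (v ∷ E) (S₀ ++ S)))))
           (sumL-cong (splits V) (λ {(E , S)} _ → cong (ℤ._* ind (pos? c E)) (reorder E S))) ⟩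
    ℤ.0ℤ ℤ.+ sumL (λ (E , S) → χ E ((v ∷ S₀) ++ S) ℤ.* ind (pos? c E)) (splits V)
      ≡⟨ trans (ℤP.+-identityˡ _) (faces-pointwise′ c V (v ∷ S₀) (¬p ∷ h)) ⟩
    ind (nonpos? c V) ℤ.* ind (Feas? [] (v ∷ S₀ ++ V))
      ≡⟨ cong₂ ℤ._*_ (ind-cong (nonpos? c V) (nonpos? c (v ∷ V)) (¬p ∷_) All.tail)
           (trans (sym (ℤP.*-identityˡ _)) (trans (sym (reorder [] V)) (ℤP.*-identityˡ _))) ⟩
    ind (nonpos? c (v ∷ V)) ℤ.* ind (Feas? [] (S₀ ++ v ∷ V)) ∎
  -- Additivity trades the two terms with `v` in `E` or in `S` for the term without a condition on
  -- `v` minus the one with `v` negative. As `c` is not positive on `neg v`, both sums fall under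
  -- the induction hypothesis.
  cases (yes p) = begin
    sumL first (splits V) ℤ.+ sumL second (splits V)
      ≡⟨ sym (sumL-+ first second (splits V)) ⟩
    sumL (λ j → first j ℤ.+ second j) (splits V)
      ≡⟨ sumL-cong (splits V) (λ {(E , S)} _ → step E S) ⟩
    sumL (λ j → third j ℤ.+ ℤ.- fourth j) (splits V)
      ≡⟨ trans (sumL-+ third (ℤ.-_ ∘ fourth) (splits V)) (cong (λ z → sumL third (splits V) ℤ.+ z) (sumL-neg fourth (splits V))) ⟩
    sumL third (splits V) ℤ.+ ℤ.- sumL fourth (splits V)
      ≡⟨ cong₂ (λ a b → a ℤ.+ ℤ.- b) (faces-pointwise′ c V S₀ h) (faces-pointwise′ c V (neg v ∷ S₀) (¬neg ∷ h)) ⟩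
    ind (nonpos? c V) ℤ.* ind (Feas? [] (S₀ ++ V)) ℤ.+ ℤ.- (ind (nonpos? c V) ℤ.* ind (Feas? [] (neg v ∷ S₀ ++ V)))
      ≡⟨ collapse (nonpos? c V) ⟩
    ℤ.0ℤ
      ≡⟨ cong (ℤ._* ind (Feas? [] (S₀ ++ v ∷ V))) (sym (ind-no (nonpos? c (v ∷ V)) (λ hv → All.head hv p))) ⟩
    ind (nonpos? c (v ∷ V)) ℤ.* ind (Feas? [] (S₀ ++ v ∷ V)) ∎
    where
    third fourth : List _ × List _ → ℤ
    third (E , S) = χ E (S₀ ++ S) ℤ.* ind (pos? c E)
    fourth (E , S) = χ E ((neg v ∷ S₀) ++ S) ℤ.* ind (pos? c E)
    ¬neg : ¬ 0ℚ < dot c (neg v)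
    ¬neg q = ℚP.<-asym p (0<dot-neg⁻ c v q)
    regroup : ∀ a b d i → a ℤ.* i ℤ.+ b ℤ.* i ≡ (a ℤ.+ (b ℤ.+ d)) ℤ.* i ℤ.+ ℤ.- (d ℤ.* i)
    regroup = ℤ-solve-∀
    step : ∀ E S → first (E , S) ℤ.+ second (E , S) ≡ third (E , S) ℤ.+ ℤ.- fourth (E , S)
    step E S = begin
      χ (v ∷ E) (S₀ ++ S) ℤ.* ind (pos? c (v ∷ E)) ℤ.+ χ E (S₀ ++ v ∷ S) ℤ.* i
        ≡⟨ cong₂ ℤ._+_ (cong (χ (v ∷ E) (S₀ ++ S) ℤ.*_) (pos-∷-yes c v p E)) (cong (ℤ._* i) (reorder E S)) ⟩
      χ (v ∷ E) (S₀ ++ S) ℤ.* i ℤ.+ χ E (v ∷ S₀ ++ S) ℤ.* i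
        ≡⟨ regroup (χ (v ∷ E) (S₀ ++ S)) (χ E (v ∷ S₀ ++ S)) (χ E (neg v ∷ S₀ ++ S)) i ⟩
      (χ (v ∷ E) (S₀ ++ S) ℤ.+ (χ E (v ∷ S₀ ++ S) ℤ.+ χ E (neg v ∷ S₀ ++ S))) ℤ.* i ℤ.+ ℤ.- fourth (E , S)
        ≡⟨ cong (λ z → z ℤ.* i ℤ.+ ℤ.- fourth (E , S)) (χ-additive E (S₀ ++ S) v) ⟩
      third (E , S) ℤ.+ ℤ.- fourth (E , S) ∎
      where i = ind (pos? c E)
    -- Subtracting a large multiple of c preserves the constraints of S₀ ++ V and makes v negative.
    collapse : (d : Dec (NonPositive c V)) → ind d ℤ.* ind (Feas? [] (S₀ ++ V)) ℤ.+ ℤ.- (ind d ℤ.* ind (Feas? [] (neg v ∷ S₀ ++ V))) ≡ ℤ.0ℤ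
    collapse (no _) = refl
    collapse (yes hV) = trans (cong (λ z → ℤ.1ℤ ℤ.* z ℤ.+ ℤ.- (ℤ.1ℤ ℤ.* ind (Feas? [] (neg v ∷ S₀ ++ V))))
        (ind-cong (Feas? [] (S₀ ++ V)) (Feas? [] (neg v ∷ S₀ ++ V)) to (λ (d , hd) → d , Sat-drop hd)))
      (ℤP.+-inverseʳ (ℤ.1ℤ ℤ.* ind (Feas? [] (neg v ∷ S₀ ++ V))))
      where
      to : Feas [] (S₀ ++ V) → Feas [] (neg v ∷ S₀ ++ V)
      to (d , hd) with archimedean (- dot d v) (dot c v) p
      ... | t , t>0 , ht = (t • neg c) ⊕ d , Sat-cons (0<dot-neg ((t • neg c) ⊕ d) v at-v) (sat (λ ()) elsewhere)
        where
        value : ∀ x → dot ((t • neg c) ⊕ d) x ≡ t * - dot c x + dot d x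
        value x = trans (dot-line t (neg c) d x) (cong (λ z → t * z + dot d x) (dot-negˡ c x))
        lem : ∀ t a b → - (t * a + - b) ≡ t * - a + b
        lem = solve-∀ ℚ-ring
        at-v : dot ((t • neg c) ⊕ d) v < 0ℚ
        at-v = subst (_< 0ℚ) (trans (lem t (dot c v) (dot d v)) (sym (value v))) (pos-neg ht)
        elsewhere : ∀ {x} → x ∈ S₀ ++ V → 0ℚ < dot ((t • neg c) ⊕ d) x
        elsewhere {x} m = subst (0ℚ <_) (sym (value x)) (nonneg+pos (nonneg*nonneg (ℚP.<⇒≤ t>0) (nonpos-neg (ℚP.≮⇒≥ (All.lookup (AllP.++⁺ h hV) m)))) (on-S hd m))

faces-pointwise : ∀ {n} (c : Pt n) V → Feas [] V →
  sumL (λ (E , S) → χ E S ℤ.* ind (pos? c E)) (splits V) ≡ ind (nonpos? c V)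
faces-pointwise c V f = trans (faces-pointwise′ c V [] [])
  (trans (cong (ind (nonpos? c V) ℤ.*_) (ind-yes (Feas? [] V) f)) (ℤP.*-identityʳ _))

factor-pos : ∀ {n} (c : Pt n) C (g : List (Pt n) × List (Pt n) → ℤ) J →
  sumL (λ j → g j ℤ.* ind (pos? c (proj₁ j ++ C))) J ≡ ind (pos? c C) ℤ.* sumL (λ j → g j ℤ.* ind (pos? c (proj₁ j))) J
factor-pos c C g J = trans
  (sumL-cong J (λ {j} _ → trans (cong (g j ℤ.*_) (pos-++ c (proj₁ j) C)) (rotate (g j) (ind (pos? c (proj₁ j))) (ind (pos? c C)))))
  (sumL-* (ind (pos? c C)) (λ j → g j ℤ.* ind (pos? c (proj₁ j))) J)
  where
  rotate : ∀ a b c → a ℤ.* (b ℤ.* c) ≡ c ℤ.* (a ℤ.* b)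
  rotate = ℤ-solve-∀

-- Two functionals are involved. The one defining the face is already absorbed in the constant
-- weight `χ E S`; the other, `c`, has to be positive on `E` and `C`. For each `c` both sums equal
-- `[c ≤ 0 on V] [c > 0 on C]`, and `integrate` turns positivity at `c` into feasibility.
faces≡alternating : ∀ {n} (V C : List (Pt n)) → Feas [] V →
  sumL (λ (E , S) → χ E S ℤ.* ind (Feas? [] (E ++ C))) (splits V) ≡ sumL (λ (E , S) → sgn E ℤ.* ind (Feas? [] (E ++ C))) (splits V)
faces≡alternating V C f = ℤP.i-j≡0⇒i≡j _ _ (trans (sym combine) (integrate J pointwise))
  where
  open ≡-Reasoning
  J₁ = List.map (λ (E , S) → χ E S , E ++ C) (splits V)
  J₂ = List.map (λ (E , S) → ℤ.- sgn E , E ++ C) (splits V)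
  J = J₁ ++ J₂
  difference : (i : List _ → ℤ) → sumL (λ (w , A) → w ℤ.* i A) J ≡
    sumL (λ (E , S) → χ E S ℤ.* i (E ++ C)) (splits V) ℤ.- sumL (λ (E , S) → sgn E ℤ.* i (E ++ C)) (splits V)
  difference i = trans (sumL-++ (λ (w , A) → w ℤ.* i A) J₁ J₂) (cong₂ ℤ._+_
    (sumL-map (λ (w , A) → w ℤ.* i A) _ (splits V))
    (trans (sumL-map (λ (w , A) → w ℤ.* i A) _ (splits V))
      (trans (sumL-cong (splits V) (λ {(E , S)} _ → sym (ℤP.neg-distribˡ-* (sgn E) _))) (sumL-neg (λ (E , S) → sgn E ℤ.* i (E ++ C)) (splits V)))))
  combine = difference (λ A → ind (Feas? [] A))
  pointwise : ∀ c → sumL (λ (w , A) → w ℤ.* ind (pos? c A)) J ≡ ℤ.0ℤ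
  pointwise c = trans (difference (λ A → ind (pos? c A)))
    (ℤP.i≡j⇒i-j≡0 (trans (factor-pos c C (λ (E , S) → χ E S) (splits V)) (trans (cong (ind (pos? c C) ℤ.*_) (trans (faces-pointwise c V f) (sym (alternating-pointwise c V))))
      (sym (factor-pos c C (λ (E , S) → sgn E) (splits V))))))

-- Polytopes and separation

homGen : ∀ {d} (P : LatticePolytope d) → Fin (k P) → Pt (suc d)
homGen P i = hom (embed (gen P i))

homGens : ∀ {d} → LatticePolytope d → List (Pt (suc d))
homGens P = List.tabulate (homGen P)

homGens-Feas : ∀ {d} (P : LatticePolytope d) → Feas [] (homGens P)
homGens-Feas P = (1ℚ ∷ 0ᵥ) , sat (λ ()) λ m → let i , v≡ = ∈-tabulate⁻ m in
  subst (λ v → 0ℚ < dot (1ℚ ∷ 0ᵥ) v) (sym v≡)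
    (subst (0ℚ <_) (sym (trans (cong (1ℚ * 1ℚ +_) (dot-0ˡ (embed (gen P i)))) (ℚP.+-identityʳ (1ℚ * 1ℚ)))) 0<1)

gen∈P : ∀ {d} (P : LatticePolytope d) i → embed (gen P i) ∈P P
gen∈P P i = single i , single-nonneg i , sumF-single i , combo-single i (λ j → embed (gen P j))

combo-homGen : ∀ {d} (P : LatticePolytope d) w → combo w (homGen P) ≡ sumF w ∷ combo w (λ i → embed (gen P i))
combo-homGen P w = combo-hom w (λ i → embed (gen P i))

dot-hom : ∀ {d} (P : LatticePolytope d) y {x} w → sumF w ≡ 1ℚ → combo w (λ i → embed (gen P i)) ≡ x →
  dot y (hom x) ≡ sumF (λ i → w i * dot y (homGen P i))
dot-hom P y w Σw≡1 refl = trans (cong (dot y) (trans (cong (_∷ combo w (λ i → embed (gen P i))) (sym Σw≡1)) (sym (combo-homGen P w)))) (dot-combo y w (homGen P))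

dot-nonneg : ∀ {d} (P : LatticePolytope d) y → (∀ i → 0ℚ ≤ dot y (homGen P i)) → ∀ {x} → x ∈P P → 0ℚ ≤ dot y (hom x)
dot-nonneg P y h (w , w≥0 , Σw , e) = subst (0ℚ ≤_) (sym (dot-hom P y w Σw e)) (sumF-nonneg (λ i → nonneg*nonneg (w≥0 i) (h i)))

dot-zero : ∀ {d} (P : LatticePolytope d) y {x} w → sumF w ≡ 1ℚ → combo w (λ i → embed (gen P i)) ≡ x →
  (∀ i → dot y (homGen P i) ≡ 0ℚ ⊎ w i ≡ 0ℚ) → dot y (hom x) ≡ 0ℚ
dot-zero P y w Σw e h = trans (dot-hom P y w Σw e) (trans (sumF-cong term≡0) (sumF-0 {k P}))
  where
  term≡0 : ∀ i → w i * dot y (homGen P i) ≡ 0ℚ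
  term≡0 i with h i
  ... | inj₁ z = trans (cong (w i *_) z) (ℚP.*-zeroʳ (w i))
  ... | inj₂ z = trans (cong (_* dot y (homGen P i)) z) (ℚP.*-zeroˡ (dot y (homGen P i)))

positive-on-support : ∀ {d} (P : LatticePolytope d) y {x} w → (∀ i → 0ℚ ≤ w i) → sumF w ≡ 1ℚ →
  combo w (λ i → embed (gen P i)) ≡ x → (∀ i → 0ℚ < dot y (homGen P i) ⊎ w i ≡ 0ℚ) → 0ℚ < dot y (hom x)
positive-on-support P y {x} w w≥0 Σw e h = decide (nonneg-cases (subst (0ℚ ≤_) (sym dot≡) (sumF-nonneg term≥0)))
  where
  dot≡ = dot-hom P y w Σw e
  term≥0 : ∀ i → 0ℚ ≤ w i * dot y (homGen P i)
  term≥0 i with h i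
  ... | inj₁ p = nonneg*nonneg (w≥0 i) (ℚP.<⇒≤ p)
  ... | inj₂ q = ℚP.≤-reflexive (sym (trans (cong (_* dot y (homGen P i)) q) (ℚP.*-zeroˡ (dot y (homGen P i)))))
  w≡0 : dot y (hom x) ≡ 0ℚ → ∀ i → w i ≡ 0ℚ
  w≡0 z i with h i
  ... | inj₂ q = q
  ... | inj₁ p = *-cancel-0 (dot y (homGen P i)) (w i) (pos⇒≢0 p)
                   (trans (ℚP.*-comm (dot y (homGen P i)) (w i)) (sumF-nonneg≡0 term≥0 (trans (sym dot≡) z) i))
  decide : dot y (hom x) ≡ 0ℚ ⊎ 0ℚ < dot y (hom x) → 0ℚ < dot y (hom x)
  decide (inj₁ z) = ⊥-elim (ℚP.1≢0 (trans (sym Σw) (trans (sumF-cong (w≡0 z)) (sumF-0 {k P}))))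
  decide (inj₂ p) = p

dot-pos : ∀ {d} (P : LatticePolytope d) y → (∀ i → 0ℚ < dot y (homGen P i)) → ∀ {x} → x ∈P P → 0ℚ < dot y (hom x)
dot-pos P y h (w , w≥0 , Σw , e) = positive-on-support P y w w≥0 Σw e (inj₁ ∘ h)

InHull : ∀ {d} (P : LatticePolytope d) → List (Pt (suc d)) → Pt d → Set
InHull P E x = ∃ λ w → (∀ i → 0ℚ ≤ w i) × sumF w ≡ 1ℚ × (∀ i → homGen P i ∈ E ⊎ w i ≡ 0ℚ) × combo w (λ i → embed (gen P i)) ≡ x

InHull⇒∈P : ∀ {d} {P : LatticePolytope d} {E x} → InHull P E x → x ∈P P
InHull⇒∈P (w , w≥0 , Σw , _ , e) = w , w≥0 , Σw , e

∈P⇒InHull : ∀ {d} {P : LatticePolytope d} {x} → x ∈P P → InHull P (homGens P) x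
∈P⇒InHull (w , w≥0 , Σw , e) = w , w≥0 , Σw , (λ i → inj₁ (∈-tabulate⁺ i)) , e

HomCone : ∀ {d} (P : LatticePolytope d) → List (Pt (suc d)) → Pt (suc d) → Set
HomCone P E z = ∃ λ w → (∀ i → 0ℚ ≤ w i) × (∀ i → homGen P i ∈ E ⊎ w i ≡ 0ℚ) × combo w (homGen P) ≡ z

HomCone-0 : ∀ {d} (P : LatticePolytope d) E → HomCone P E 0ᵥ
HomCone-0 P E = (λ _ → 0ℚ) , (λ _ → ℚP.≤-refl) , (λ _ → inj₂ refl) , combo-0 (homGen P)

HomCone-gen : ∀ {d} (P : LatticePolytope d) {E} i → homGen P i ∈ E → HomCone P E (homGen P i)
HomCone-gen P {E} i m = single i , single-nonneg i , support , combo-single i (homGen P)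
  where
  support : ∀ j → homGen P j ∈ E ⊎ single i j ≡ 0ℚ
  support j with i ≟F j
  ... | yes refl = inj₁ m
  ... | no i≢j = inj₂ (single-≢ i j i≢j)

HomCone-⊕ : ∀ {d} (P : LatticePolytope d) {E x y} → HomCone P E x → HomCone P E y → HomCone P E (x ⊕ y)
HomCone-⊕ P (w , w≥0 , sw , e) (u , u≥0 , su , f) = (λ i → w i + u i) , (λ i → nonneg+nonneg (w≥0 i) (u≥0 i)) ,
  (λ i → case (sw i , su i) of λ where
    (inj₁ m , _) → inj₁ m
    (inj₂ _ , inj₁ m) → inj₁ m
    (inj₂ p , inj₂ q) → inj₂ (trans (cong₂ _+_ p q) (ℚP.+-identityʳ 0ℚ))) ,
  trans (combo-+ w u (homGen P)) (cong₂ _⊕_ e f)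

HomCone-• : ∀ {d} (P : LatticePolytope d) {E x a} → 0ℚ ≤ a → HomCone P E x → HomCone P E (a • x)
HomCone-• P {a = a} a≥0 (w , w≥0 , sw , e) = (λ i → a * w i) , (λ i → nonneg*nonneg a≥0 (w≥0 i)) ,
  (λ i → case sw i of λ where
    (inj₁ m) → inj₁ m
    (inj₂ p) → inj₂ (trans (cong (a *_) p) (ℚP.*-zeroʳ a))) ,
  trans (combo-* a w (homGen P)) (cong (a •_) e)

HomCone-head : ∀ {d} (P : LatticePolytope d) {E z} → HomCone P E z → 0ℚ ≤ Vec.head z
HomCone-head P (w , w≥0 , _ , e) = subst (0ℚ ≤_) (cong Vec.head (trans (sym (combo-homGen P w)) e)) (sumF-nonneg w≥0)

HomCone-normalize : ∀ {d} (P : LatticePolytope d) {E s z r} → r * s ≡ 1ℚ → 0ℚ ≤ r → HomCone P E (s ∷ z) → InHull P E (r • z)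
HomCone-normalize P {E} {s} {z} {r} rs r≥0 c with HomCone-• P {E} {s ∷ z} {r} r≥0 c
... | w , w≥0 , sw , e = w , w≥0 , trans (cong Vec.head e′) rs , sw , cong Vec.tail e′
  where e′ = trans (sym (combo-homGen P w)) e

InHull⇒HomCone : ∀ {d} (P : LatticePolytope d) {E x} → InHull P E x → HomCone P E (hom x)
InHull⇒HomCone P (w , w≥0 , Σw , sw , e) = w , w≥0 , sw , trans (combo-homGen P w) (cong₂ _∷_ Σw e)

head-⊕ : ∀ {n} (x y : Pt (suc n)) → Vec.head (x ⊕ y) ≡ Vec.head x + Vec.head y
head-⊕ (x ∷ _) (y ∷ _) = refl

head-• : ∀ {n} a (x : Pt (suc n)) → Vec.head (a • x) ≡ a * Vec.head x
head-• a (x ∷ _) = refl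

neg-⊕ : ∀ {n} (x y : Pt n) → neg (x ⊕ y) ≡ neg x ⊕ neg y
neg-⊕ x y = trans (neg-def (x ⊕ y)) (trans (•-distribˡ (- 1ℚ) x y) (sym (cong₂ _⊕_ (neg-def x) (neg-def y))))

neg-• : ∀ {n} a (x : Pt n) → neg (a • x) ≡ a • neg x
neg-• a x = trans (neg-def (a • x)) (trans (sym (•-assoc (- 1ℚ) a x)) (trans (cong (_• x) (ℚP.*-comm (- 1ℚ) a)) (trans (•-assoc a (- 1ℚ) x) (cong (a •_) (sym (neg-def x))))))

neg-0 : ∀ {n} → neg (0ᵥ {n}) ≡ 0ᵥ
neg-0 = trans (neg-def 0ᵥ) (•-zeroʳ (- 1ℚ))

-- Feasibility of E ++ avoid Q means: some affine hyperplane strictly separates the hull of E from Q.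
avoid : ∀ {d} → LatticePolytope d → List (Pt (suc d))
avoid Q = List.map neg (homGens Q)

meets⇒¬Feas : ∀ {d} (P Q : LatticePolytope d) {E x} → InHull P E x → x ∈P Q → ¬ Feas [] (E ++ avoid Q)
meets⇒¬Feas P Q {E} {x} (w , w≥0 , Σw , sw , e) x∈Q (y , hy) = ℚP.<-asym y>0 (0<dot-neg⁻ y (hom x) neg-y>0)
  where
  y>0 : 0ℚ < dot y (hom x)
  y>0 = positive-on-support P y w w≥0 Σw e λ i → case sw i of λ where
    (inj₁ m) → inj₁ (on-S hy (∈-++⁺ˡ m))
    (inj₂ q) → inj₂ q
  transfer : ∀ v → dot (neg y) v ≡ dot y (neg v)
  transfer v = trans (dot-negˡ y v) (sym (dot-negʳ y v))
  neg-y>0 : 0ℚ < dot y (neg (hom x))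
  neg-y>0 = subst (0ℚ <_) (transfer (hom x)) (dot-pos Q (neg y)
    (λ i → subst (0ℚ <_) (sym (transfer (homGen Q i))) (on-S hy (∈-++⁺ʳ E (∈-map⁺ neg (∈-tabulate⁺ i))))) x∈Q)

-- A certificate of infeasibility reads `a - b = 0` with `a` in the cone over `E` and `b` in the
-- cone over `Q`. Keeping track that the heads have a positive sum shows that `a = b` is not the
-- apex, so it can be normalized to a common point.
¬Feas⇒meets : ∀ {d} (P Q : LatticePolytope d) {E} → (∀ {v} → v ∈ E → v ∈ homGens P) → ¬ Feas [] (E ++ avoid Q) →
  ∃ λ x → InHull P E x × x ∈P Q
¬Feas⇒meets {d} P Q {E} E⊆P ¬f with decompose (infeasible⇒Cone ¬f)
  where
  Decomposed : Pt (suc d) → Set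
  Decomposed x = ∃₂ λ a b → HomCone P E a × HomCone Q (homGens Q) b × x ≡ a ⊕ neg b × 0ℚ < Vec.head a + Vec.head b
  decompose : ∀ {x} → Cone [] (E ++ avoid Q) x → Decomposed x
  decompose (base m) with ∈-++⁻ E m
  ... | inj₁ m₁ with ∈-tabulate⁻ (E⊆P m₁)
  ...   | i , refl = homGen P i , 0ᵥ , HomCone-gen P i m₁ , HomCone-0 Q (homGens Q) ,
                     sym (trans (cong (homGen P i ⊕_) neg-0) (⊕-identityʳ (homGen P i))) , subst (0ℚ <_) (sym (ℚP.+-identityʳ 1ℚ)) 0<1
  decompose (base m) | inj₂ m₂ with ∈-map⁻ neg m₂
  ... | v , v∈ , refl with ∈-tabulate⁻ v∈
  ...   | i , refl = 0ᵥ , homGen Q i , HomCone-0 P E , HomCone-gen Q i v∈ , sym (⊕-identityˡ (neg (homGen Q i))) , subst (0ℚ <_) (sym (ℚP.+-identityˡ 1ℚ)) 0<1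
  decompose (add {x} {y} p q) with decompose p | decompose q
  ... | a , b , ha , hb , refl , pos | a′ , b′ , ha′ , hb′ , refl , pos′ =
    a ⊕ a′ , b ⊕ b′ , HomCone-⊕ P ha ha′ , HomCone-⊕ Q hb hb′ ,
    trans (⊕-interchange a (neg b) a′ (neg b′)) (cong ((a ⊕ a′) ⊕_) (sym (neg-⊕ b b′))) ,
    subst (0ℚ <_) (trans (+-interchange (Vec.head a) (Vec.head b) (Vec.head a′) (Vec.head b′)) (sym (cong₂ _+_ (head-⊕ a a′) (head-⊕ b b′)))) (pos+pos pos pos′)
  decompose (scale {t} t>0 p) with decompose p
  ... | a , b , ha , hb , refl , pos = t • a , t • b , HomCone-• P (ℚP.<⇒≤ t>0) ha , HomCone-• Q (ℚP.<⇒≤ t>0) hb ,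
    trans (•-distribˡ t a (neg b)) (cong ((t • a) ⊕_) (sym (neg-• t b))) ,
    subst (0ℚ <_) (trans (ℚP.*-distribˡ-+ t (Vec.head a) (Vec.head b)) (sym (cong₂ _+_ (head-• t a) (head-• t b)))) (pos*pos t>0 pos)
... | s ∷ z , b , ha , hb , eq , pos with sym (⊕neg≡0⇒≡ (s ∷ z) b (sym eq))
... | refl = r • z , HomCone-normalize P (proj₂ (proj₂ inv)) (ℚP.<⇒≤ (proj₁ (proj₂ inv))) ha ,
             InHull⇒∈P {P = Q} (HomCone-normalize Q (proj₂ (proj₂ inv)) (ℚP.<⇒≤ (proj₁ (proj₂ inv))) hb)
  where
  s>0 : 0ℚ < s
  s>0 with nonneg-cases (HomCone-head P ha)
  ... | inj₁ s≡0 = ⊥-elim (ℚP.<-irrefl (sym (trans (cong₂ _+_ s≡0 s≡0) (ℚP.+-identityʳ 0ℚ))) pos)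
  ... | inj₂ p = p
  inv = pos-recip s>0
  r = proj₁ inv

-- The valuation property of the alternating sum

HomCone⇒InHull : ∀ {d} (P : LatticePolytope d) {E x} → HomCone P E (hom x) → InHull P E x
HomCone⇒InHull P {E} {x} h = subst (InHull P E) (•-identity x) (HomCone-normalize P (ℚP.*-identityˡ 1ℚ) 0≤1 h)

∈P-convex : ∀ {d} (P : LatticePolytope d) {x y a b} → x ∈P P → y ∈P P → 0ℚ ≤ a → 0ℚ ≤ b → a + b ≡ 1ℚ → ((a • x) ⊕ (b • y)) ∈P P
∈P-convex P {x} {y} {a} {b} x∈ y∈ a≥0 b≥0 a+b≡1 = InHull⇒∈P {P = P} (HomCone⇒InHull P (subst (HomCone P (homGens P)) hom≡
  (HomCone-⊕ P (HomCone-• P a≥0 (InHull⇒HomCone P (∈P⇒InHull {P = P} x∈))) (HomCone-• P b≥0 (InHull⇒HomCone P (∈P⇒InHull {P = P} y∈))))))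
  where
  hom≡ : (a • hom x) ⊕ (b • hom y) ≡ hom ((a • x) ⊕ (b • y))
  hom≡ = cong (_∷ ((a • x) ⊕ (b • y))) (trans (cong₂ _+_ (ℚP.*-identityʳ a) (ℚP.*-identityʳ b)) a+b≡1)

dot-++ : ∀ {m n} (y : Pt m) (y′ : Pt n) a b → dot (y Vec.++ y′) (a Vec.++ b) ≡ dot y a + dot y′ b
dot-++ [] y′ [] b = sym (ℚP.+-identityˡ (dot y′ b))
dot-++ (c ∷ y) y′ (x ∷ a) b = trans (cong (c * x +_) (dot-++ y y′ a b)) (sym (ℚP.+-assoc (c * x) (dot y a) (dot y′ b)))

⊕-++ : ∀ {m n} (a a′ : Pt m) (b b′ : Pt n) → (a Vec.++ b) ⊕ (a′ Vec.++ b′) ≡ (a ⊕ a′) Vec.++ (b ⊕ b′)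
⊕-++ [] [] b b′ = refl
⊕-++ (x ∷ a) (x′ ∷ a′) b b′ = cong (x + x′ ∷_) (⊕-++ a a′ b b′)

•-++ : ∀ {m n} t (a : Pt m) (b : Pt n) → t • (a Vec.++ b) ≡ (t • a) Vec.++ (t • b)
•-++ t [] b = refl
•-++ t (x ∷ a) b = cong (t * x ∷_) (•-++ t a b)

0-++ : ∀ m {n} → 0ᵥ {m ℕ.+ n} ≡ 0ᵥ {m} Vec.++ 0ᵥ {n}
0-++ zero = refl
0-++ (suc m) = cong (0ℚ ∷_) (0-++ m)

-- Motzkin's alternative in the space of pairs (y₁ , y₂).
common-point : ∀ {d} (P₁ P₂ R : LatticePolytope d) →
  (∃ λ x → x ∈P P₁ × x ∈P P₂ × x ∈P R) ⊎
  (∃₂ λ y₁ y₂ → (∀ i → 0ℚ < dot y₁ (homGen P₁ i)) × (∀ i → 0ℚ < dot y₂ (homGen P₂ i)) × (∀ i → 0ℚ < dot (neg (y₁ ⊕ y₂)) (homGen R i)))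
common-point {d} P₁ P₂ R with motzkin (suc d ℕ.+ suc d) [] S
  module CommonPoint where
  D = suc d
  S₁ = List.map (λ v → v Vec.++ 0ᵥ {D}) (homGens P₁)
  S₂ = List.map (λ v → 0ᵥ {D} Vec.++ v) (homGens P₂)
  S₃ = List.map (λ v → neg v Vec.++ neg v) (homGens R)
  S = S₁ ++ (S₂ ++ S₃)
... | inj₁ (y , hy) with Vec.splitAt (suc d) y
...   | y₁ , y₂ , refl = inj₂ (y₁ , y₂ ,
        (λ i → subst (0ℚ <_) (trans (dot-++ y₁ y₂ (homGen P₁ i) 0ᵥ) (trans (cong (dot y₁ (homGen P₁ i) +_) (dot-0ʳ y₂)) (ℚP.+-identityʳ (dot y₁ (homGen P₁ i)))))
          (on-S hy (∈-++⁺ˡ (∈-map⁺ _ (∈-tabulate⁺ i))))) ,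
        (λ i → subst (0ℚ <_) (trans (dot-++ y₁ y₂ 0ᵥ (homGen P₂ i)) (trans (cong (_+ dot y₂ (homGen P₂ i)) (dot-0ʳ y₁)) (ℚP.+-identityˡ (dot y₂ (homGen P₂ i)))))
          (on-S hy (∈-++⁺ʳ S₁ (∈-++⁺ˡ (∈-map⁺ _ (∈-tabulate⁺ i)))))) ,
        (λ i → subst (0ℚ <_) (on-R (homGen R i))
          (on-S hy (∈-++⁺ʳ S₁ (∈-++⁺ʳ S₂ (∈-map⁺ _ (∈-tabulate⁺ i)))))))
  where
  open CommonPoint P₁ P₂ R
  on-R : ∀ v → dot (y₁ Vec.++ y₂) (neg v Vec.++ neg v) ≡ dot (neg (y₁ ⊕ y₂)) v
  on-R v = trans (dot-++ y₁ y₂ (neg v) (neg v)) (trans (sym (dot-⊕ˡ y₁ y₂ (neg v))) (trans (dot-negʳ (y₁ ⊕ y₂) v) (sym (dot-negˡ (y₁ ⊕ y₂) v))))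
common-point {d} P₁ P₂ R | inj₂ cone with decompose cone
  where
  open CommonPoint P₁ P₂ R
  Decomposed : Pt (D ℕ.+ D) → Set
  Decomposed x = ∃ λ a → ∃ λ b → ∃ λ z → HomCone P₁ (homGens P₁) a × HomCone P₂ (homGens P₂) b × HomCone R (homGens R) z ×
    x ≡ (a ⊕ neg z) Vec.++ (b ⊕ neg z) × 0ℚ < Vec.head a + Vec.head b + Vec.head z
  decompose : ∀ {x} → Cone [] S x → Decomposed x
  decompose (base m) with ∈-++⁻ S₁ m
  ... | inj₁ m₁ with ∈-map⁻ (λ v → v Vec.++ 0ᵥ {D}) m₁
  ...   | v , v∈ , refl with ∈-tabulate⁻ v∈
  ...     | i , refl = homGen P₁ i , 0ᵥ , 0ᵥ , HomCone-gen P₁ i v∈ , HomCone-0 P₂ (homGens P₂) , HomCone-0 R (homGens R) ,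
              sym (cong₂ Vec._++_ (trans (cong (homGen P₁ i ⊕_) neg-0) (⊕-identityʳ (homGen P₁ i))) (trans (cong (0ᵥ ⊕_) neg-0) (⊕-identityʳ 0ᵥ))) , 0<1
  decompose (base m) | inj₂ m′ with ∈-++⁻ S₂ m′
  ... | inj₁ m₂ with ∈-map⁻ (λ v → 0ᵥ {D} Vec.++ v) m₂
  ...   | v , v∈ , refl with ∈-tabulate⁻ v∈
  ...     | i , refl = 0ᵥ , homGen P₂ i , 0ᵥ , HomCone-0 P₁ (homGens P₁) , HomCone-gen P₂ i v∈ , HomCone-0 R (homGens R) ,
              sym (cong₂ Vec._++_ (trans (cong (0ᵥ ⊕_) neg-0) (⊕-identityʳ 0ᵥ)) (trans (cong (homGen P₂ i ⊕_) neg-0) (⊕-identityʳ (homGen P₂ i)))) , 0<1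
  decompose (base m) | inj₂ m′ | inj₂ m₃ with ∈-map⁻ (λ v → neg v Vec.++ neg v) m₃
  ... | v , v∈ , refl with ∈-tabulate⁻ v∈
  ...   | i , refl = 0ᵥ , 0ᵥ , homGen R i , HomCone-0 P₁ (homGens P₁) , HomCone-0 P₂ (homGens P₂) , HomCone-gen R i v∈ ,
            sym (cong₂ Vec._++_ (⊕-identityˡ (neg (homGen R i))) (⊕-identityˡ (neg (homGen R i)))) , 0<1
  decompose (add p q) with decompose p | decompose q
  ... | a , b , z , ha , hb , hz , refl , pos | a′ , b′ , z′ , ha′ , hb′ , hz′ , refl , pos′ =
    a ⊕ a′ , b ⊕ b′ , z ⊕ z′ , HomCone-⊕ P₁ ha ha′ , HomCone-⊕ P₂ hb hb′ , HomCone-⊕ R hz hz′ ,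
    trans (⊕-++ (a ⊕ neg z) (a′ ⊕ neg z′) (b ⊕ neg z) (b′ ⊕ neg z′)) (cong₂ Vec._++_ (regroup a a′) (regroup b b′)) ,
    subst (0ℚ <_) (trans (interchange (Vec.head a) (Vec.head b) (Vec.head z) (Vec.head a′) (Vec.head b′) (Vec.head z′))
      (sym (cong₂ _+_ (cong₂ _+_ (head-⊕ a a′) (head-⊕ b b′)) (head-⊕ z z′)))) (pos+pos pos pos′)
    where
    regroup : ∀ c c′ → (c ⊕ neg z) ⊕ (c′ ⊕ neg z′) ≡ (c ⊕ c′) ⊕ neg (z ⊕ z′)
    regroup c c′ = trans (⊕-interchange c (neg z) c′ (neg z′)) (cong ((c ⊕ c′) ⊕_) (sym (neg-⊕ z z′)))
    interchange : ∀ a b c d e f → (a + b + c) + (d + e + f) ≡ (a + d) + (b + e) + (c + f)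
    interchange = solve-∀ ℚ-ring
  decompose (scale {t} t>0 p) with decompose p
  ... | a , b , z , ha , hb , hz , refl , pos =
    t • a , t • b , t • z , HomCone-• P₁ t≥0 ha , HomCone-• P₂ t≥0 hb , HomCone-• R t≥0 hz ,
    trans (•-++ t (a ⊕ neg z) (b ⊕ neg z)) (cong₂ Vec._++_ (regroup a) (regroup b)) ,
    subst (0ℚ <_) (trans (distrib t (Vec.head a) (Vec.head b) (Vec.head z)) (sym (cong₂ _+_ (cong₂ _+_ (head-• t a) (head-• t b)) (head-• t z)))) (pos*pos t>0 pos)
    where
    t≥0 = ℚP.<⇒≤ t>0
    regroup : ∀ c → t • (c ⊕ neg z) ≡ (t • c) ⊕ neg (t • z)
    regroup c = trans (•-distribˡ t c (neg z)) (cong ((t • c) ⊕_) (sym (neg-• t z)))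
    distrib : ∀ t a b c → t * (a + b + c) ≡ t * a + t * b + t * c
    distrib = solve-∀ ℚ-ring
... | a , b , s ∷ z , ha , hb , hz , eq , pos with VecP.++-injective 0ᵥ (a ⊕ neg (s ∷ z)) (trans (sym (0-++ (suc d))) eq)
... | eq₁ , eq₂ with ⊕neg≡0⇒≡ a (s ∷ z) (sym eq₁) | ⊕neg≡0⇒≡ b (s ∷ z) (sym eq₂)
... | refl | refl = inj₁ (r • z , InHull⇒∈P {P = P₁} (HomCone-normalize P₁ rs r≥0 ha) , InHull⇒∈P {P = P₂} (HomCone-normalize P₂ rs r≥0 hb) ,
                          InHull⇒∈P {P = R} (HomCone-normalize R rs r≥0 hz))
  where
  s>0 : 0ℚ < s
  s>0 with nonneg-cases (HomCone-head P₁ ha)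
  ... | inj₁ refl = ⊥-elim (ℚP.<-irrefl refl pos)
  ... | inj₂ p = p
  inv = pos-recip s>0
  r = proj₁ inv
  r≥0 = ℚP.<⇒≤ (proj₁ (proj₂ inv))
  rs = proj₂ (proj₂ inv)

segment : ∀ {d} → LPt d → LPt d → LatticePolytope d
segment g h = record { k = 2 ; gen = λ { zero → g ; (suc _) → h } }

-- Otherwise y₁ vanishes at a point of the segment; it lies in U, but not in P₁ since y₁ > 0 there, and not in P₂
-- since y₂ < -y₁ = 0.
segment-meets-intersection : ∀ {d} (P₁ P₂ U : LatticePolytope d) →
  (∀ x → x ∈P P₁ ⊎ x ∈P P₂ → x ∈P U) → (∀ x → x ∈P U → x ∈P P₁ ⊎ x ∈P P₂) →
  ∀ i j → ∃ λ x → x ∈P P₁ × x ∈P P₂ × x ∈P segment (gen P₁ i) (gen P₂ j)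
segment-meets-intersection P₁ P₂ U into outof i j with common-point P₁ P₂ (segment (gen P₁ i) (gen P₂ j))
... | inj₁ p = p
... | inj₂ (y₁ , y₂ , y₁>0 , y₂>0 , sum<0) = ⊥-elim (case outof x x∈U of λ where
    (inj₁ x∈P₁) → ℚP.<-irrefl (sym y₁x≡0) (dot-pos P₁ y₁ y₁>0 x∈P₁)
    (inj₂ x∈P₂) → ℚP.<-asym (dot-pos P₂ y₂ y₂>0 x∈P₂) y₂x<0)
  where
  R = segment (gen P₁ i) (gen P₂ j)
  g h : Pt _
  g = embed (gen P₁ i)
  h = embed (gen P₂ j)
  α = dot y₁ (hom g)
  β = - dot y₁ (hom h)
  negative-on-R : ∀ {x} → x ∈P R → dot y₁ (hom x) + dot y₂ (hom x) < 0ℚ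
  negative-on-R {x} m = neg-pos⁻ (subst (0ℚ <_) (trans (dot-negˡ (y₁ ⊕ y₂) (hom x)) (cong -_ (dot-⊕ˡ y₁ y₂ (hom x)))) (dot-pos R (neg (y₁ ⊕ y₂)) sum<0 m))
  β>0 : 0ℚ < β
  β>0 = subst (0ℚ <_) (lem (dot y₁ (hom h)) (dot y₂ (hom h))) (pos+pos (neg-pos (negative-on-R (gen∈P R (suc zero)))) (y₂>0 j))
    where
    lem : ∀ a b → - (a + b) + b ≡ - a
    lem = solve-∀ ℚ-ring
  -- `y₁` takes the values `α > 0` at `g` and `- β < 0` at `h`, so it vanishes at the point with
  -- weights `β / (α + β)` and `α / (α + β)`.
  inv = pos-recip (pos+pos (y₁>0 i) β>0)
  r = proj₁ inv
  r≥0 = ℚP.<⇒≤ (proj₁ (proj₂ inv))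
  a = r * β
  b = r * α
  a≥0 = nonneg*nonneg r≥0 (ℚP.<⇒≤ β>0)
  b≥0 = nonneg*nonneg r≥0 (ℚP.<⇒≤ (y₁>0 i))
  a+b≡1 : a + b ≡ 1ℚ
  a+b≡1 = trans (lem r α β) (proj₂ (proj₂ inv))
    where
    lem : ∀ r x y → r * y + r * x ≡ r * (x + y)
    lem = solve-∀ ℚ-ring
  x = (a • g) ⊕ (b • h)
  x∈U = ∈P-convex U {g} {h} (into g (inj₁ (gen∈P P₁ i))) (into h (inj₂ (gen∈P P₂ j))) a≥0 b≥0 a+b≡1
  hom-x : hom x ≡ (a • hom g) ⊕ (b • hom h)
  hom-x = cong (_∷ x) (trans (sym a+b≡1) (sym (cong₂ _+_ (ℚP.*-identityʳ a) (ℚP.*-identityʳ b))))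
  y₁x≡0 : dot y₁ (hom x) ≡ 0ℚ
  y₁x≡0 = trans (cong (dot y₁) hom-x) (trans (dot-⊕ʳ y₁ (a • hom g) (b • hom h))
    (trans (cong₂ _+_ (dot-•ʳ a y₁ (hom g)) (dot-•ʳ b y₁ (hom h))) (lem r (dot y₁ (hom g)) (dot y₁ (hom h)))))
    where
    lem : ∀ r p q → r * (- q) * p + r * p * q ≡ 0ℚ
    lem = solve-∀ ℚ-ring
  y₂x<0 : dot y₂ (hom x) < 0ℚ
  y₂x<0 = subst (_< 0ℚ) (trans (cong (_+ dot y₂ (hom x)) y₁x≡0) (ℚP.+-identityˡ (dot y₂ (hom x))))
    (negative-on-R (∈P-convex R {g} {h} (gen∈P R zero) (gen∈P R (suc zero)) a≥0 b≥0 a+b≡1))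

NonPositiveOn : ∀ {d} → Pt (suc d) → LatticePolytope d → Set
NonPositiveOn c P = ∀ x → x ∈P P → ¬ 0ℚ < dot c (hom x)

NonPositive⇒On : ∀ {d} (c : Pt (suc d)) (P : LatticePolytope d) → NonPositive c (homGens P) → NonPositiveOn c P
NonPositive⇒On c P h x x∈P p = ℚP.<-irrefl refl (ℚP.<-≤-trans p (subst (_≤ 0ℚ) (neg-involutive (dot c (hom x))) (ℚP.neg-antimono-≤ neg≥0)))
  where
  neg≥0 : 0ℚ ≤ - dot c (hom x)
  neg≥0 = subst (0ℚ ≤_) (dot-negˡ c (hom x)) (dot-nonneg P (neg c) (λ i → subst (0ℚ ≤_) (sym (dot-negˡ c (homGen P i)))
    (nonpos-neg (ℚP.≮⇒≥ (All.lookup h (∈-tabulate⁺ i))))) x∈P)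

On⇒NonPositive : ∀ {d} (c : Pt (suc d)) (P : LatticePolytope d) → NonPositiveOn c P → NonPositive c (homGens P)
On⇒NonPositive c P h = AllP.tabulate⁺ (λ i → h (embed (gen P i)) (gen∈P P i))

¬NonPositive⇒gen : ∀ {d} (c : Pt (suc d)) (P : LatticePolytope d) → ¬ NonPositive c (homGens P) → ∃ λ i → 0ℚ < dot c (homGen P i)
¬NonPositive⇒gen c P ¬h with any?F (λ i → 0ℚ ℚ.<? dot c (homGen P i))
... | yes p = p
... | no ¬p = ⊥-elim (¬h (AllP.tabulate⁺ (λ i q → ¬p (i , q))))

alternatingSum : ∀ {d} → LatticePolytope d → LatticePolytope d → ℤ
alternatingSum Q P = sumL (λ (E , S) → sgn E ℤ.* ind (Feas? [] (E ++ avoid Q))) (splits (homGens P))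

module _ {d} (P₁ P₂ U I : LatticePolytope d)
  (union : (λ x → x ∈P P₁ ⊎ x ∈P P₂) ≐ ⟦ U ⟧) (inter : (λ x → x ∈P P₁ × x ∈P P₂) ≐ ⟦ I ⟧) where

  -- Three of the cases are immediate from the union and the intersection as sets. If `c` is
  -- positive somewhere on both `P₁` and `P₂`, pick a generator of each where it is; the segment
  -- between them meets `P₁ ∩ P₂` because the union is convex, so `c` is positive somewhere on the
  -- intersection.
  nonpos-valuation : ∀ c → ind (nonpos? c (homGens U)) ℤ.+ ind (nonpos? c (homGens I)) ≡
    ind (nonpos? c (homGens P₁)) ℤ.+ ind (nonpos? c (homGens P₂))
  nonpos-valuation c = cases (nonpos? c (homGens P₁)) (nonpos? c (homGens P₂))
    where
    U? = nonpos? c (homGens U)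
    I? = nonpos? c (homGens I)
    restrict : ∀ {R R′} → (∀ x → x ∈P R → x ∈P R′) → NonPositive c (homGens R′) → NonPositive c (homGens R)
    restrict {R} {R′} sub h = On⇒NonPositive c R λ x m → NonPositive⇒On c R′ h x (sub x m)
    U⇒₁ : NonPositive c (homGens U) → NonPositive c (homGens P₁)
    U⇒₁ = restrict {P₁} {U} λ x m → proj₁ (union x) (inj₁ m)
    U⇒₂ : NonPositive c (homGens U) → NonPositive c (homGens P₂)
    U⇒₂ = restrict {P₂} {U} λ x m → proj₁ (union x) (inj₂ m)
    ₁⇒I : NonPositive c (homGens P₁) → NonPositive c (homGens I)
    ₁⇒I = restrict {I} {P₁} λ x m → proj₁ (proj₂ (inter x) m)
    ₂⇒I : NonPositive c (homGens P₂) → NonPositive c (homGens I)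
    ₂⇒I = restrict {I} {P₂} λ x m → proj₂ (proj₂ (inter x) m)
    ₁₂⇒U : NonPositive c (homGens P₁) → NonPositive c (homGens P₂) → NonPositive c (homGens U)
    ₁₂⇒U h₁ h₂ = On⇒NonPositive c U λ x m → case proj₂ (union x) m of λ where
      (inj₁ m₁) → NonPositive⇒On c P₁ h₁ x m₁
      (inj₂ m₂) → NonPositive⇒On c P₂ h₂ x m₂
    not-I : ¬ NonPositive c (homGens P₁) → ¬ NonPositive c (homGens P₂) → ¬ NonPositive c (homGens I)
    not-I ¬h₁ ¬h₂ h =
      let i , ci>0 = ¬NonPositive⇒gen c P₁ ¬h₁
          j , cj>0 = ¬NonPositive⇒gen c P₂ ¬h₂
          x , x∈P₁ , x∈P₂ , x∈R = segment-meets-intersection P₁ P₂ U (λ x → proj₁ (union x)) (λ x → proj₂ (union x)) i j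
      in NonPositive⇒On c I h x (proj₁ (inter x) (x∈P₁ , x∈P₂))
           (dot-pos (segment (gen P₁ i) (gen P₂ j)) c (λ { zero → ci>0 ; (suc zero) → cj>0 }) x∈R)
    cases : (d₁ : Dec (NonPositive c (homGens P₁))) (d₂ : Dec (NonPositive c (homGens P₂))) → ind U? ℤ.+ ind I? ≡ ind d₁ ℤ.+ ind d₂
    cases (yes h₁) (yes h₂) = cong₂ ℤ._+_ (ind-yes U? (₁₂⇒U h₁ h₂)) (ind-yes I? (₁⇒I h₁))
    cases (yes h₁) (no ¬h₂) = cong₂ ℤ._+_ (ind-no U? (¬h₂ ∘ U⇒₂)) (ind-yes I? (₁⇒I h₁))
    cases (no ¬h₁) (yes h₂) = cong₂ ℤ._+_ (ind-no U? (¬h₁ ∘ U⇒₁)) (ind-yes I? (₂⇒I h₂))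
    cases (no ¬h₁) (no ¬h₂) = cong₂ ℤ._+_ (ind-no U? (¬h₁ ∘ U⇒₁)) (ind-no I? (not-I ¬h₁ ¬h₂))

  -- At a fixed `c` each of the four sums is `[c ≤ 0 on P]` times the indicator of positivity on
  -- `avoid Q`, and the latter factor is common to all of them.
  alternatingSum-valuation : ∀ Q → alternatingSum Q U ℤ.+ alternatingSum Q I ≡ alternatingSum Q P₁ ℤ.+ alternatingSum Q P₂
  alternatingSum-valuation Q = ℤP.i-j≡0⇒i≡j _ _ (trans (sym (total (λ A → ind (Feas? [] A)))) (integrate J pointwise))
    where
    open ≡-Reasoning
    C = avoid Q
    block : (ℤ → ℤ) → LatticePolytope d → List (ℤ × List (Pt (suc d)))
    block f P = List.map (λ (E , S) → f (sgn E) , E ++ C) (splits (homGens P))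
    J = block (λ z → z) U ++ (block (λ z → z) I ++ (block ℤ.-_ P₁ ++ block ℤ.-_ P₂))
    part : (List (Pt (suc d)) → ℤ) → LatticePolytope d → ℤ
    part i P = sumL (λ (E , S) → sgn E ℤ.* i (E ++ C)) (splits (homGens P))
    plus : ∀ i P → sumL (λ (w , A) → w ℤ.* i A) (block (λ z → z) P) ≡ part i P
    plus i P = sumL-map (λ (w , A) → w ℤ.* i A) _ (splits (homGens P))
    minus : ∀ i P → sumL (λ (w , A) → w ℤ.* i A) (block ℤ.-_ P) ≡ ℤ.- part i P
    minus i P = trans (sumL-map (λ (w , A) → w ℤ.* i A) _ (splits (homGens P)))
      (trans (sumL-cong (splits (homGens P)) (λ {(E , S)} _ → sym (ℤP.neg-distribˡ-* (sgn E) _))) (sumL-neg (λ (E , S) → sgn E ℤ.* i (E ++ C)) (splits (homGens P))))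
    total : ∀ i → sumL (λ (w , A) → w ℤ.* i A) J ≡ (part i U ℤ.+ part i I) ℤ.- (part i P₁ ℤ.+ part i P₂)
    total i = begin
      sumL f J
        ≡⟨ trans (sumL-++ f (block (λ z → z) U) _) (cong₂ ℤ._+_ (plus i U)
             (trans (sumL-++ f (block (λ z → z) I) _) (cong₂ ℤ._+_ (plus i I)
               (trans (sumL-++ f (block ℤ.-_ P₁) _) (cong₂ ℤ._+_ (minus i P₁) (minus i P₂)))))) ⟩
      part i U ℤ.+ (part i I ℤ.+ (ℤ.- part i P₁ ℤ.+ ℤ.- part i P₂))
        ≡⟨ lem (part i U) (part i I) (part i P₁) (part i P₂) ⟩
      (part i U ℤ.+ part i I) ℤ.- (part i P₁ ℤ.+ part i P₂) ∎
      where
      f = λ ((w , A) : ℤ × List (Pt (suc d))) → w ℤ.* i A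
      lem : ∀ a b c e → a ℤ.+ (b ℤ.+ (ℤ.- c ℤ.+ ℤ.- e)) ≡ (a ℤ.+ b) ℤ.- (c ℤ.+ e)
      lem = ℤ-solve-∀
    pointwise : ∀ c → sumL (λ (w , A) → w ℤ.* ind (pos? c A)) J ≡ ℤ.0ℤ
    pointwise c = trans (total (λ A → ind (pos? c A))) (ℤP.i≡j⇒i-j≡0 (begin
      part i U ℤ.+ part i I ≡⟨ cong₂ ℤ._+_ (at U) (at I) ⟩
      p ℤ.* ν U ℤ.+ p ℤ.* ν I ≡⟨ sym (ℤP.*-distribˡ-+ p (ν U) (ν I)) ⟩
      p ℤ.* (ν U ℤ.+ ν I) ≡⟨ cong (p ℤ.*_) (nonpos-valuation c) ⟩
      p ℤ.* (ν P₁ ℤ.+ ν P₂) ≡⟨ ℤP.*-distribˡ-+ p (ν P₁) (ν P₂) ⟩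
      p ℤ.* ν P₁ ℤ.+ p ℤ.* ν P₂ ≡⟨ sym (cong₂ ℤ._+_ (at P₁) (at P₂)) ⟩
      part i P₁ ℤ.+ part i P₂ ∎))
      where
      i = λ A → ind (pos? c A)
      p = ind (pos? c C)
      ν : LatticePolytope d → ℤ
      ν P = ind (nonpos? c (homGens P))
      at : ∀ P → part i P ≡ p ℤ.* ν P
      at P = trans (factor-pos c C (λ (E , S) → sgn E) (splits (homGens P))) (cong (p ℤ.*_) (alternating-pointwise c (homGens P)))

-- Dimension

combo-congˡ : ∀ {d k} {w w′ : Fin k → ℚ} (p : Fin k → Pt d) → (∀ i → w i ≡ w′ i) → combo w p ≡ combo w′ p
combo-congˡ p h = combo-cong h (λ _ → refl)

combo-congʳ : ∀ {d k} (w : Fin k → ℚ) {p p′ : Fin k → Pt d} → (∀ i → p i ≡ p′ i) → combo w p ≡ combo w p′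
combo-congʳ w h = combo-cong {w = w} (λ _ → refl) h

signDim-suc : ∀ n → signDim (suc n) ≡ ℤ.- signDim n
signDim-suc zero = refl
signDim-suc (suc zero) = refl
signDim-suc (suc (suc n)) = signDim-suc n

LinIndep : ∀ {n m} → (Fin m → Pt n) → Set
LinIndep p = ∀ a → combo a p ≡ 0ᵥ → ∀ i → a i ≡ 0ℚ

InSpan : ∀ {n m} → (Fin m → Pt n) → Pt n → Set
InSpan p v = ∃ λ a → combo a p ≡ v

consF : ∀ {A : Set} {m} → A → (Fin m → A) → Fin (suc m) → A
consF v p zero = v
consF v p (suc i) = p i

-- The certificate is a relation `t v + (combination of E) = 0` with `t > 0`, which can be solved
-- for `v`.
Cone⇒InSpan : ∀ {n m} {E : List (Pt n)} {v} (p : Fin m → Pt n) → (∀ {e} → e ∈ E → InSpan p e) →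
  Cone E (v ∷ []) 0ᵥ → InSpan p v
Cone⇒InSpan {n} {m} {E} {v} p spans cone with decompose cone
  where
  Decomposed : Pt n → Set
  Decomposed x = ∃₂ λ t a → 0ℚ < t × x ≡ (t • v) ⊕ combo a p
  decompose : ∀ {x} → Cone E (v ∷ []) x → Decomposed x
  decompose (base (here refl)) = 1ℚ , (λ _ → 0ℚ) , 0<1 , sym (trans (cong₂ _⊕_ (•-identity v) (combo-0 p)) (⊕-identityʳ v))
  decompose (add c d) with decompose c | decompose d
  ... | t , a , t>0 , refl | u , b , u>0 , refl = t + u , (λ i → a i + b i) , pos+pos t>0 u>0 ,
    trans (⊕-interchange (t • v) (combo a p) (u • v) (combo b p)) (sym (cong₂ _⊕_ (•-distribʳ t u v) (combo-+ a b p)))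
  decompose (scale {s} s>0 c) with decompose c
  ... | t , a , t>0 , refl = s * t , (λ i → s * a i) , pos*pos s>0 t>0 ,
    trans (•-distribˡ s (t • v) (combo a p)) (sym (cong₂ _⊕_ (•-assoc s t v) (combo-* s a p)))
  decompose (shift {x} {e} s e∈E c) with decompose c | spans e∈E
  ... | t , a , t>0 , refl | b , refl = t , (λ i → a i + s * b i) , t>0 ,
    trans (⊕-assoc (t • v) (combo a p) (s • combo b p)) (cong ((t • v) ⊕_)
      (sym (trans (combo-+ a (λ i → s * b i) p) (cong (combo a p ⊕_) (combo-* s b p)))))
... | t , a , t>0 , eq with pos-recip t>0
...   | r , r>0 , rt = (λ i → - r * a i) , (begin
    combo (λ i → - r * a i) p ≡⟨ combo-* (- r) a p ⟩
    (- r) • combo a p ≡⟨ cong ((- r) •_) (⊕≡0⇒≡neg (combo a p) (t • v) (trans (⊕-comm (combo a p) (t • v)) (sym eq))) ⟩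
    (- r) • neg (t • v) ≡⟨ cong ((- r) •_) (trans (neg-def (t • v)) (sym (•-assoc (- 1ℚ) t v))) ⟩
    (- r) • ((- 1ℚ * t) • v) ≡⟨ sym (•-assoc (- r) (- 1ℚ * t) v) ⟩
    (- r * (- 1ℚ * t)) • v ≡⟨ cong (_• v) (trans (lem r t) rt) ⟩
    1ℚ • v ≡⟨ •-identity v ⟩
    v ∎)
  where
  open ≡-Reasoning
  lem : ∀ r t → - r * (- 1ℚ * t) ≡ r * t
  lem = solve-∀ ℚ-ring

-- A greedy choice governed by the same feasibility test as `par`, so size and parity change
-- together. The minus sign appears because `signDim` is -1 at rank 0.
basis : ∀ {n} (E : List (Pt n)) → ∃ λ m → ∃ λ (p : Fin m → Pt n) →
  (∀ i → p i ∈ E) × LinIndep p × (∀ {v} → v ∈ E → InSpan p v) × signDim m ≡ ℤ.- par E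
basis [] = zero , (λ ()) , (λ ()) , (λ _ _ ()) , (λ ()) , refl
basis (v ∷ E) with basis E | Feas? E (v ∷ [])
... | m , p , p∈ , indep , spans , sign | no ¬f = m , p , there ∘ p∈ , indep ,
  (λ { (here refl) → Cone⇒InSpan p spans (infeasible⇒Cone ¬f) ; (there i) → spans i }) , sign
... | m , p , p∈ , indep , spans , sign | yes (y , hy) = suc m , consF v p , (λ { zero → here refl ; (suc i) → there (p∈ i) }) ,
  indep′ ,
  (λ { (here refl) → single zero , combo-single zero (consF v p)
     ; (there i) → let a , e = spans i in consF 0ℚ a , trans (cong₂ _⊕_ (•-zeroˡ v) e) (⊕-identityˡ _) }) ,
  trans (signDim-suc m) (cong ℤ.-_ sign)
  where
  indep′ : LinIndep (consF v p)
  indep′ a e = λ { zero → a₀≡0 ; (suc i) → indep (a ∘ suc) tail≡0 i }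
    where
    rest = combo (a ∘ suc) p
    y·rest : dot y rest ≡ 0ℚ
    y·rest = trans (dot-combo y (a ∘ suc) p) (trans (sumF-cong (λ i → trans (cong (a (suc i) *_) (on-E hy (p∈ i))) (ℚP.*-zeroʳ (a (suc i))))) (sumF-0 {m}))
    a₀≡0 : a zero ≡ 0ℚ
    a₀≡0 = *-cancel-0 (dot y v) (a zero) (pos⇒≢0 (on-S hy (here refl))) (begin
      dot y v * a zero ≡⟨ ℚP.*-comm (dot y v) (a zero) ⟩
      a zero * dot y v ≡⟨ sym (ℚP.+-identityʳ (a zero * dot y v)) ⟩
      a zero * dot y v + 0ℚ ≡⟨ sym (cong₂ _+_ (dot-•ʳ (a zero) y v) y·rest) ⟩
      dot y (a zero • v) + dot y rest ≡⟨ sym (dot-⊕ʳ y (a zero • v) rest) ⟩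
      dot y ((a zero • v) ⊕ rest) ≡⟨ cong (dot y) e ⟩
      dot y 0ᵥ ≡⟨ dot-0ʳ y ⟩
      0ℚ ∎)
      where open ≡-Reasoning
    tail≡0 : rest ≡ 0ᵥ
    tail≡0 = trans (sym (⊕-identityˡ rest)) (trans (cong (_⊕ rest) (sym (trans (cong (_• v) a₀≡0) (•-zeroˡ v)))) e)

-- Gaussian elimination on the rows. If row 0 vanishes it is a relation by itself; otherwise it
-- clears its pivot column from the other rows, and its own coefficient `a₀` is dictated by that
-- column.
dependent : ∀ n (M : Fin (suc n) → Fin n → ℚ) →
  ∃ λ (a : Fin (suc n) → ℚ) → (∃ λ i → a i ≢ 0ℚ) × (∀ j → sumF (λ i → a i * M i j) ≡ 0ℚ)
dependent zero M = (λ _ → 1ℚ) , (zero , ℚP.1≢0) , λ ()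
dependent (suc n) M with any?F (λ j → ¬? (M zero j ℚ.≟ 0ℚ))
... | no all-zero = consF 1ℚ (λ _ → 0ℚ) , (zero , ℚP.1≢0) , λ j → trans
      (cong₂ _+_ (trans (ℚP.*-identityˡ (M zero j)) (row≡0 j)) (trans (sumF-cong (λ i → ℚP.*-zeroˡ (M (suc i) j))) (sumF-0 {suc n})))
      (ℚP.+-identityʳ 0ℚ)
  where
  row≡0 : ∀ j → M zero j ≡ 0ℚ
  row≡0 j with M zero j ℚ.≟ 0ℚ
  ... | yes p = p
  ... | no p = ⊥-elim (all-zero (j , p))
... | yes (j₀ , pivot≢0) with recip (M zero j₀) pivot≢0
...   | r , rp with dependent n (λ i j → M (suc i) (punchIn j₀ j) - (M (suc i) j₀ * r) * M zero (punchIn j₀ j))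
...     | a , (i₀ , ai₀≢0) , a-kills = consF a₀ a , (suc i₀ , ai₀≢0) , kills
  where
  open ≡-Reasoning
  a₀ = - sumF (λ i → a i * (M (suc i) j₀ * r))
  reduce : ∀ j → a₀ * M zero j + sumF (λ i → a i * M (suc i) j) ≡ sumF (λ i → a i * (M (suc i) j - (M (suc i) j₀ * r) * M zero j))
  reduce j = begin
    a₀ * q + sumF f ≡⟨ lem₁ s q (sumF f) ⟩
    sumF f + (- q) * s ≡⟨ cong (sumF f +_) (sym (sumF-* (- q) (λ i → a i * (M (suc i) j₀ * r)))) ⟩
    sumF f + sumF (λ i → (- q) * (a i * (M (suc i) j₀ * r))) ≡⟨ sym (sumF-+ f (λ i → (- q) * (a i * (M (suc i) j₀ * r)))) ⟩
    sumF (λ i → f i + (- q) * (a i * (M (suc i) j₀ * r))) ≡⟨ sumF-cong (λ i → lem₂ (a i) (M (suc i) j) (M (suc i) j₀ * r) q) ⟩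
    sumF (λ i → a i * (M (suc i) j - (M (suc i) j₀ * r) * q)) ∎
    where
    q = M zero j
    f = λ i → a i * M (suc i) j
    s = sumF (λ i → a i * (M (suc i) j₀ * r))
    lem₁ : ∀ s q t → - s * q + t ≡ t + - q * s
    lem₁ = solve-∀ ℚ-ring
    lem₂ : ∀ a m c q → a * m + - q * (a * c) ≡ a * (m - c * q)
    lem₂ = solve-∀ ℚ-ring
  at-pivot : ∀ i → a i * (M (suc i) j₀ - (M (suc i) j₀ * r) * M zero j₀) ≡ 0ℚ
  at-pivot i = trans (lem (a i) (M (suc i) j₀) r (M zero j₀)) (trans (cong (λ z → a i * (M (suc i) j₀ - M (suc i) j₀ * z)) rp) (lem′ (a i) (M (suc i) j₀)))
    where
    lem : ∀ a m r p → a * (m - (m * r) * p) ≡ a * (m - m * (r * p))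
    lem = solve-∀ ℚ-ring
    lem′ : ∀ a m → a * (m - m * 1ℚ) ≡ 0ℚ
    lem′ = solve-∀ ℚ-ring
  kills : ∀ j → a₀ * M zero j + sumF (λ i → a i * M (suc i) j) ≡ 0ℚ
  kills j with j₀ ≟F j
  ... | yes refl = trans (reduce j₀) (trans (sumF-cong at-pivot) (sumF-0 {suc n}))
  ... | no j₀≢j = trans (reduce j) (subst (λ j → sumF (λ i → a i * (M (suc i) j - (M (suc i) j₀ * r) * M zero j)) ≡ 0ℚ)
                    (punchIn-punchOut j₀≢j) (a-kills (punchOut j₀≢j)))

combo-combo : ∀ {d m k} (a : Fin m → ℚ) (M : Fin m → Fin k → ℚ) (p : Fin k → Pt d) →
  combo a (λ i → combo (M i) p) ≡ combo (λ j → sumF (λ i → a i * M i j)) p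
combo-combo {m = zero} a M p = sym (combo-0 p)
combo-combo {m = suc m} a M p = trans
  (cong₂ _⊕_ (sym (combo-* (a zero) (M zero) p)) (combo-combo (a ∘ suc) (M ∘ suc) p))
  (sym (combo-+ (λ j → a zero * M zero j) (λ j → sumF (λ i → a (suc i) * M (suc i) j)) p))

steinitz : ∀ {n m} (p : Fin m → Pt n) (q : Fin (suc m) → Pt n) → (∀ i → InSpan p (q i)) → ¬ LinIndep q
steinitz {m = m} p q spans indep with dependent m (λ i → proj₁ (spans i))
... | a , (i , ai≢0) , kills = ai≢0 (indep a (trans (combo-congʳ a (λ i → sym (proj₂ (spans i))))
      (trans (combo-combo a (λ i → proj₁ (spans i)) p) (trans (combo-congˡ p kills) (combo-0 p)))) i)

InSpan-combo : ∀ {n m l} (p : Fin m → Pt n) (w : Fin l → ℚ) (q : Fin l → Pt n) → (∀ i → InSpan p (q i) ⊎ w i ≡ 0ℚ) → InSpan p (combo w q)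
InSpan-combo {l = zero} p w q h = (λ _ → 0ℚ) , combo-0 p
InSpan-combo {l = suc l} p w q h with InSpan-combo p (w ∘ suc) (q ∘ suc) (h ∘ suc) | h zero
... | a , e | inj₁ (b , f) = (λ j → w zero * b j + a j) , trans (combo-+ (λ j → w zero * b j) a p)
      (cong₂ _⊕_ (trans (combo-* (w zero) b p) (cong (w zero •_) f)) e)
... | a , e | inj₂ w₀≡0 = a , trans e (sym (trans (cong (_⊕ combo (w ∘ suc) (q ∘ suc)) (trans (cong (_• q zero) w₀≡0) (•-zeroˡ (q zero)))) (⊕-identityˡ _)))

AffIndep⇒LinIndep-hom : ∀ {d m} (q : Fin m → Pt d) → AffIndep q → LinIndep (λ i → hom (q i))
AffIndep⇒LinIndep-hom q aff a e = aff a (cong Vec.head e′) (cong Vec.tail e′)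
  where e′ = trans (sym (combo-hom a q)) e

LinIndep-hom⇒AffIndep : ∀ {d m} (q : Fin m → Pt d) → LinIndep (λ i → hom (q i)) → AffIndep q
LinIndep-hom⇒AffIndep q indep a s e = indep a (trans (combo-hom a q) (cong₂ _∷_ s e))

-- Homogenization turns affine independence into linear independence, so dimension plus one is the
-- rank of `E`.
hull-dimension : ∀ {d} (P : LatticePolytope d) E → (∀ {v} → v ∈ E → v ∈ homGens P) →
  ∃ λ n → DimPlusOne (InHull P E) n × signDim n ≡ ℤ.- par E
hull-dimension {d} P E E⊆P with basis E
... | m , p , p∈ , indep , spans , sign = m , ((q , q∈ , aff) , maximal) , sign
  where
  index : ∀ i → ∃ λ j → p i ≡ homGen P j
  index i = ∈-tabulate⁻ (E⊆P (p∈ i))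
  q : Fin m → Pt d
  q i = embed (gen P (proj₁ (index i)))
  p≡hom-q : ∀ i → p i ≡ hom (q i)
  p≡hom-q i = proj₂ (index i)
  q∈ : ∀ i → InHull P E (q i)
  q∈ i = HomCone⇒InHull P (HomCone-gen P (proj₁ (index i)) (subst (_∈ E) (p≡hom-q i) (p∈ i)))
  aff : AffIndep q
  aff = LinIndep-hom⇒AffIndep q (λ a e → indep a (trans (combo-congʳ a p≡hom-q) e))
  maximal : ∀ (r : Fin (suc m) → Pt d) → (∀ i → InHull P E (r i)) → ¬ AffIndep r
  maximal r r∈ aff-r = steinitz p (λ i → hom (r i)) in-span (AffIndep⇒LinIndep-hom r aff-r)
    where
    in-span : ∀ i → InSpan p (hom (r i))
    in-span i with InHull⇒HomCone P (r∈ i)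
    ... | w , _ , sw , e = subst (InSpan p) e (InSpan-combo p w (homGen P) (λ j → case sw j of λ where
          (inj₁ m) → inj₁ (spans m)
          (inj₂ z) → inj₂ z))

-- The faces of a polytope that avoid Q

splits-⊆ : ∀ {A : Set} (V : List A) {E S} → (E , S) ∈ splits V → (∀ {v} → v ∈ E → v ∈ V) × (∀ {v} → v ∈ S → v ∈ V) × (∀ {v} → v ∈ V → v ∈ E ⊎ v ∈ S)
splits-⊆ [] (here refl) = (λ ()) , (λ ()) , λ ()
splits-⊆ (u ∷ V) m with ∈-++⁻ (List.map (λ (E , S) → u ∷ E , S) (splits V)) m
... | inj₁ m₁ with ∈-map⁻ (λ (E , S) → u ∷ E , S) m₁
...   | (E , S) , j , refl with splits-⊆ V j
...     | E⊆ , S⊆ , cover = (λ { (here refl) → here refl ; (there i) → there (E⊆ i) }) , there ∘ S⊆ ,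
            λ { (here refl) → inj₁ (here refl) ; (there i) → ⊎-map there (λ x → x) (cover i) }
splits-⊆ (u ∷ V) m | inj₂ m₂ with ∈-map⁻ (λ (E , S) → E , u ∷ S) m₂
... | (E , S) , j , refl with splits-⊆ V j
...   | E⊆ , S⊆ , cover = there ∘ E⊆ , (λ { (here refl) → here refl ; (there i) → there (S⊆ i) }) ,
          λ { (here refl) → inj₂ (here refl) ; (there i) → ⊎-map (λ x → x) there (cover i) }

-- A positive form of difference: two distinct splits place the entry at some position on opposite
-- sides, and this vector later tells their hulls apart.
Apart : ∀ {A : Set} → List A × List A → List A × List A → Set
Apart (E , S) (E′ , S′) = ∃ λ v → (v ∈ E × v ∈ S′) ⊎ (v ∈ S × v ∈ E′)

splits-apart : ∀ {A : Set} (V : List A) → AllPairs Apart (splits V)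
splits-apart [] = [] ∷ []
splits-apart (u ∷ V) = AllPairsP.++⁺
  (AllPairsP.map⁺ (AllPairs.map (λ { (v , inj₁ (p , q)) → v , inj₁ (there p , q) ; (v , inj₂ (p , q)) → v , inj₂ (p , there q) }) (splits-apart V)))
  (AllPairsP.map⁺ (AllPairs.map (λ { (v , inj₁ (p , q)) → v , inj₁ (p , there q) ; (v , inj₂ (p , q)) → v , inj₂ (there p , q) }) (splits-apart V)))
  (AllP.map⁺ (All.universal (λ _ → AllP.map⁺ (All.universal (λ _ → u , inj₁ (here refl , here refl)) (splits V))) (splits V)))

zero-split : ∀ {n} (y : Pt n) V → (∀ {v} → v ∈ V → 0ℚ ≤ dot y v) → ∃₂ λ E S → (E , S) ∈ splits V × Sat E S y
zero-split y [] h = [] , [] , here refl , sat (λ ()) (λ ())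
zero-split y (u ∷ V) h with zero-split y V (h ∘ there) | nonneg-cases (h (here refl))
... | E , S , m , hy | inj₁ z = u ∷ E , S , ∈-++⁺ˡ (∈-map⁺ (λ (E , S) → u ∷ E , S) m) , Sat-consE z hy
... | E , S , m , hy | inj₂ p = E , u ∷ S , ∈-++⁺ʳ (List.map (λ (E , S) → u ∷ E , S) (splits V)) (∈-map⁺ (λ (E , S) → E , u ∷ S) m) , Sat-cons {c = y} {v = u} p hy

≐-sym : ∀ {d} {S T : PtSet d} → S ≐ T → T ≐ S
≐-sym e x = proj₂ (e x) , proj₁ (e x)

≐-trans : ∀ {d} {S T U : PtSet d} → S ≐ T → T ≐ U → S ≐ U
≐-trans e f x = proj₁ (f x) ∘ proj₁ (e x) , proj₂ (e x) ∘ proj₂ (f x)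

DimPlusOne-≐ : ∀ {d} {S T : PtSet d} {n} → S ≐ T → DimPlusOne S n → DimPlusOne T n
DimPlusOne-≐ e ((p , p∈ , aff) , max) = (p , (λ i → proj₁ (e (p i)) (p∈ i)) , aff) , λ q q∈ → max q (λ i → proj₂ (e (q i)) (q∈ i))

-- The inequality c·x ≤ b as the functional (b , -c) on homogeneous coordinates.
slack : ∀ {d} → Pt d → ℚ → Pt (suc d)
slack c b = b ∷ neg c

dot-slack : ∀ {d} (c x : Pt d) b → dot (slack c b) (hom x) ≡ b - dot c x
dot-slack c x b = cong₂ _+_ (ℚP.*-identityʳ b) (dot-negˡ c x)

slack-neg : ∀ {d} b (γ : Pt d) → slack (neg γ) b ≡ b ∷ γ
slack-neg b γ = cong (b ∷_) (neg-neg γ)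

Sat⇒nonneg : ∀ {d} (P : LatticePolytope d) {E S y} → (E , S) ∈ splits (homGens P) → Sat E S y → ∀ i → 0ℚ ≤ dot y (homGen P i)
Sat⇒nonneg P split hy i with proj₂ (proj₂ (splits-⊆ (homGens P) split)) (∈-tabulate⁺ i)
... | inj₁ m = ℚP.≤-reflexive (sym (on-E hy m))
... | inj₂ m = ℚP.<⇒≤ (on-S hy m)

-- At a point of the face the slack is zero and is a sum of nonnegative terms, so no weight can sit
-- on a generator in `S`, where the slack is positive.
FaceSet-hull : ∀ {d} (P : LatticePolytope d) {E S} → (E , S) ∈ splits (homGens P) → ∀ c b → Sat E S (slack c b) →
  FaceSet P c b ≐ InHull P E
FaceSet-hull P {E} {S} split c b hy x = to , from
  where
  y = slack c b
  to : FaceSet P c b x → InHull P E x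
  to ((w , w≥0 , Σw , e) , cx≡b) = w , w≥0 , Σw , support , e
    where
    classify : ∀ i → homGen P i ∈ E ⊎ homGen P i ∈ S
    classify i = proj₂ (proj₂ (splits-⊆ (homGens P) split)) (∈-tabulate⁺ i)
    y·x≡0 : sumF (λ i → w i * dot y (homGen P i)) ≡ 0ℚ
    y·x≡0 = trans (sym (dot-hom P y w Σw e)) (trans (dot-slack c x b) (trans (cong (λ z → b - z) cx≡b) (ℚP.+-inverseʳ b)))
    support : ∀ i → homGen P i ∈ E ⊎ w i ≡ 0ℚ
    support i with classify i
    ... | inj₁ m = inj₁ m
    ... | inj₂ m = inj₂ (*-cancel-0 (dot y (homGen P i)) (w i) (pos⇒≢0 (on-S hy m))
            (trans (ℚP.*-comm (dot y (homGen P i)) (w i)) (sumF-nonneg≡0 (λ i → nonneg*nonneg (w≥0 i) (Sat⇒nonneg P split hy i)) y·x≡0 i)))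
  from : InHull P E x → FaceSet P c b x
  from h@(w , w≥0 , Σw , sw , e) = InHull⇒∈P {P = P} h , sym (minus≡0 (trans (sym (dot-slack c x b)) (dot-zero P y w Σw e (λ i → ⊎-map (on-E hy) (λ z → z) (sw i)))))
    where
    minus≡0 : ∀ {a b} → a - b ≡ 0ℚ → a ≡ b
    minus≡0 {a} {b} e = trans (sym (a-b+b≡a a b)) (trans (cong (_+ b) e) (ℚP.+-identityˡ b))

Sat⇒Supporting : ∀ {d} (P : LatticePolytope d) {E S} → (E , S) ∈ splits (homGens P) → ∀ c b → Sat E S (slack c b) → Supporting P c b
Sat⇒Supporting P split c b hy x x∈P = 0≤-⇒≤ (subst (0ℚ ≤_) (dot-slack c x b) (dot-nonneg P (slack c b) (Sat⇒nonneg P split hy) x∈P))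

-- If `v` is on the zero side of one split and on the positive side of the other, its point lies in
-- the first hull only: the functional of the second split vanishes on the second hull but is
-- positive at `v`.
hull-apart : ∀ {d} (P : LatticePolytope d) {j j′} → j ∈ splits (homGens P) → j′ ∈ splits (homGens P) → Apart j j′ →
  Feas (proj₁ j) (proj₂ j) → Feas (proj₁ j′) (proj₂ j′) → ¬ InHull P (proj₁ j) ≐ InHull P (proj₁ j′)
hull-apart P {j} {j′} m m′ (v , side) f f′ e = case side of λ where
    (inj₁ (v∈E , v∈S′)) → no-transfer m f′ v∈E v∈S′ (λ x → proj₁ (e x))
    (inj₂ (v∈S , v∈E′)) → no-transfer m′ f v∈E′ v∈S (λ x → proj₂ (e x))
  where
  no-transfer : ∀ {E S E′ S′} → (E , S) ∈ splits (homGens P) → Feas E′ S′ → v ∈ E → v ∈ S′ → ¬ (∀ x → InHull P E x → InHull P E′ x)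
  no-transfer {E} {S} {E′} m (y , hy) v∈E v∈S′ sub with ∈-tabulate⁻ (proj₁ (splits-⊆ (homGens P) m) v∈E)
  ... | i , refl with sub (embed (gen P i)) (HomCone⇒InHull P (HomCone-gen P i v∈E))
  ...   | w , w≥0 , Σw , sw , eq = pos⇒≢0 (on-S hy v∈S′) (dot-zero P y w Σw eq (λ i → ⊎-map (on-E hy) (λ z → z) (sw i)))

module Faces {d} (P Q : LatticePolytope d) where

  V = homGens P

  Good : FaceEntry d → Set
  Good (c , b , n) = InComplement Q P c b × DimPlusOne (FaceSet P c b) n

  Live : List (Pt (suc d)) × List (Pt (suc d)) → Set
  Live (E , S) = Feas E S × Feas [] (E ++ avoid Q)

  -- For a live split this is `(-1)^dim` of the face, since `par E` is `(-1)^(dim + 1)`.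
  weight : List (Pt (suc d)) × List (Pt (suc d)) → ℤ
  weight (E , S) = ℤ.- (χ E S ℤ.* ind (Feas? [] (E ++ avoid Q)))

  -- Stated for a partial list `J` of splits to permit induction. `origin` remembers the split
  -- behind every entry; this is how a new face is seen to differ from the earlier ones.
  record FaceList (J : List (List (Pt (suc d)) × List (Pt (suc d)))) : Set where
    field
      faces    : List (FaceEntry d)
      good     : All Good faces
      distinct : AllPairs (λ e e′ → ¬ (entrySet P e ≐ entrySet P e′)) faces
      covers   : ∀ {j} → j ∈ J → Live j → Any (λ e → InHull P (proj₁ j) ≐ entrySet P e) faces
      origin   : All (λ e → ∃ λ j → j ∈ J × Live j × entrySet P e ≐ InHull P (proj₁ j)) faces
      signs    : sumSigns faces ≡ sumL weight J
  open FaceList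

  entry : ∀ {E S} → (E , S) ∈ splits V → Live (E , S) → ∃ λ e → Good e × entrySet P e ≐ InHull P E × (∀ L → sumSigns (e ∷ L) ≡ ℤ.- par E ℤ.+ sumSigns L)
  entry {E} {S} m ((β ∷ γ , hy) , sep) with hull-dimension P E (proj₁ (splits-⊆ V m))
  ... | n , dim , sign = (c , β , n) ,
        ((Sat⇒Supporting P m c β hy′ , λ x face x∈Q → meets⇒¬Feas P Q (proj₁ (hull x) face) x∈Q sep) , DimPlusOne-≐ {S = InHull P E} {FaceSet P c β} (≐-sym {S = FaceSet P c β} {InHull P E} hull) dim) ,
        hull , λ L → cong (λ z → z ℤ.+ sumSigns L) sign
    where
    c = neg γ
    hy′ : Sat E S (slack c β)
    hy′ = subst (Sat E S) (sym (slack-neg β γ)) hy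
    hull : FaceSet P c β ≐ InHull P E
    hull = FaceSet-hull P m c β hy′

  dead : ∀ {E S} → ¬ Live (E , S) → weight (E , S) ≡ ℤ.0ℤ
  dead {E} {S} ¬live = cong ℤ.-_ (cases (Feas? E S))
    where
    separated? = Feas? [] (E ++ avoid Q)
    cases : Dec (Feas E S) → χ E S ℤ.* ind separated? ≡ ℤ.0ℤ
    cases (no ¬f) = cong (ℤ._* ind separated?) (χ-no {E = E} {S} ¬f)
    cases (yes f) = trans (cong (χ E S ℤ.*_) (ind-no separated? (λ g → ¬live (f , g)))) (ℤP.*-zeroʳ (χ E S))

  live : ∀ {E S} → Live (E , S) → weight (E , S) ≡ ℤ.- par E
  live {E} {S} (f , g) = cong ℤ.-_ (trans (cong₂ ℤ._*_ (χ-yes {E = E} {S} f) (ind-yes (Feas? [] (E ++ avoid Q)) g)) (ℤP.*-identityʳ (par E)))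

  Live? : ∀ j → Dec (Live j)
  Live? (E , S) = Feas? E S ×-dec Feas? [] (E ++ avoid Q)

  faceList : ∀ J → (∀ {j} → j ∈ J → j ∈ splits V) → AllPairs Apart J → FaceList J
  faceList [] _ _ = record { faces = [] ; good = [] ; distinct = [] ; covers = λ () ; origin = [] ; signs = refl }
  faceList (j ∷ J) J⊆ (apart ∷ rest) with faceList J (J⊆ ∘ there) rest | Live? j
  ... | F | no ¬l = record
    { faces = faces F ; good = good F ; distinct = distinct F
    ; covers = λ { (here refl) l → ⊥-elim (¬l l) ; (there m) l → covers F m l }
    ; origin = All.map (λ (i , m , r) → i , there m , r) (origin F)
    ; signs = trans (signs F) (trans (sym (ℤP.+-identityˡ _)) (cong (λ z → z ℤ.+ sumL weight J) (sym (dead ¬l)))) }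
  ... | F | yes l with entry (J⊆ (here refl)) l
  ...   | e , e-good , e-hull , e-sign = record
    { faces = e ∷ faces F ; good = e-good ∷ good F
    ; distinct = All.map (λ {e′} (i , m , l′ , e′-hull) e≐e′ → hull-apart P (J⊆ (here refl)) (J⊆ (there m)) (All.lookup apart m) (proj₁ l) (proj₁ l′)
          (≐-trans (≐-sym e-hull) (≐-trans e≐e′ e′-hull))) (origin F) ∷ distinct F
    ; covers = λ { (here refl) _ → here (≐-sym e-hull) ; (there m) l → there (covers F m l) }
    ; origin = (j , here refl , l , e-hull) ∷ All.map (λ (i , m , r) → i , there m , r) (origin F)
    ; signs = trans (e-sign (faces F)) (cong₂ ℤ._+_ (sym (live l)) (signs F)) }

  all-faces : FaceList (splits V)
  all-faces = faceList (splits V) (λ m → m) (splits-apart V)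

  -- The slack of a valid inequality is nonnegative on the generators, and its zeros among them form
  -- the `E` of a feasible split. If the hull of `E` could not be separated from `Q` it would meet
  -- `Q`, so the split is live.
  exhaustive : ∀ c b → InComplement Q P c b → Any (λ e → FaceSet P c b ≐ entrySet P e) (faces all-faces)
  exhaustive c b (supporting , disjoint) with zero-split (slack c b) V slack≥0
    where
    slack≥0 : ∀ {v} → v ∈ V → 0ℚ ≤ dot (slack c b) v
    slack≥0 m with ∈-tabulate⁻ m
    ... | i , refl = subst (0ℚ ≤_) (sym (dot-slack c (embed (gen P i)) b)) (≤⇒0≤- (supporting (embed (gen P i)) (gen∈P P i)))
  ... | E , S , m , hy = Any.map (λ {e} → ≐-trans hull) (covers all-faces m ((slack c b , hy) , separated))
    where
    hull : FaceSet P c b ≐ InHull P E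
    hull = FaceSet-hull P m c b hy
    separated : Feas [] (E ++ avoid Q)
    separated with Feas? [] (E ++ avoid Q)
    ... | yes f = f
    ... | no ¬f with ¬Feas⇒meets P Q (proj₁ (splits-⊆ V m)) ¬f
    ...   | x , x∈E , x∈Q = ⊥-elim (disjoint x (proj₂ (hull x) x∈E) x∈Q)

  redEuler : RedEuler Q P (ℤ.- alternatingSum Q P)
  redEuler = faces all-faces , All.map (λ g → g) (good all-faces) , distinct all-faces , exhaustive ,
    sym (trans (signs all-faces) (trans (sumL-neg (λ (E , S) → χ E S ℤ.* ind (Feas? [] (E ++ avoid Q))) (splits V))
      (cong ℤ.-_ (faces≡alternating V (avoid Q) (homGens-Feas P)))))


-- Uniqueness of the reduced Euler characteristic

AffIndep-tail : ∀ {d m} (p : Fin (suc m) → Pt d) → AffIndep p → AffIndep (p ∘ suc)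
AffIndep-tail p aff a s e i = aff (consF 0ℚ a) (trans (ℚP.+-identityˡ (sumF a)) s)
  (trans (cong₂ _⊕_ (•-zeroˡ (p zero)) e) (⊕-identityˡ 0ᵥ)) (suc i)

AffIndep-restrict : ∀ {d n m} {S : PtSet d} → n ℕ.≤′ m → (p : Fin m → Pt d) → (∀ i → S (p i)) → AffIndep p →
  ∃ λ (q : Fin n → Pt d) → (∀ i → S (q i)) × AffIndep q
AffIndep-restrict (ℕ.≤′-reflexive refl) p p∈ aff = p , p∈ , aff
AffIndep-restrict {S = S} (ℕ.≤′-step n≤m) p p∈ aff = AffIndep-restrict {S = S} n≤m (p ∘ suc) (p∈ ∘ suc) (AffIndep-tail p aff)

DimPlusOne-unique : ∀ {d} {S : PtSet d} {n m} → DimPlusOne S n → DimPlusOne S m → n ≡ m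
DimPlusOne-unique {S = S} {n} {m} (p , p-max) (q , q-max) with ℕP.<-cmp n m
... | tri≈ _ e _ = e
... | tri< n<m _ _ = let (r , r∈ , aff) = AffIndep-restrict {S = S} (ℕP.≤⇒≤′ n<m) (proj₁ q) (proj₁ (proj₂ q)) (proj₂ (proj₂ q)) in ⊥-elim (p-max r r∈ aff)
... | tri> _ _ m<n = let (r , r∈ , aff) = AffIndep-restrict {S = S} (ℕP.≤⇒≤′ m<n) (proj₁ p) (proj₁ (proj₂ p)) (proj₂ (proj₂ p)) in ⊥-elim (q-max r r∈ aff)

-- In the application the relation is equality of faces as sets, which is not decided. Partners are
-- therefore read off the covering proofs and removed one at a time.
module Transversal {A : Set} (_~_ : A → A → Set) (~-sym : ∀ {x y} → x ~ y → y ~ x) (~-trans : ∀ {x y z} → x ~ y → y ~ z → x ~ z) (f : A → ℤ) where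

  Distinct : List A → Set
  Distinct = AllPairs (λ x y → ¬ x ~ y)

  record Extraction (x : A) (L : List A) : Set where
    field
      rep      : A
      rep∈     : rep ∈ L
      x~rep    : x ~ rep
      rest     : List A
      sum      : sumL f L ≡ f rep ℤ.+ sumL f rest
      distinct : Distinct rest
      apart    : ∀ {y} → y ∈ rest → ¬ y ~ rep
      rest⊆    : ∀ {y} → y ∈ rest → y ∈ L
      split    : ∀ {y} → Any (y ~_) L → y ~ rep ⊎ Any (y ~_) rest
  open Extraction

  extract : ∀ {x L} → Any (x ~_) L → Distinct L → Extraction x L
  extract {L = y ∷ L} (here x~y) (ap ∷ ds) = record
    { rep = y ; rep∈ = here refl ; x~rep = x~y ; rest = L ; sum = refl ; distinct = ds
    ; apart = λ m z~y → All.lookup ap m (~-sym z~y) ; rest⊆ = there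
    ; split = λ { (here p) → inj₁ p ; (there p) → inj₂ p } }
  extract {L = y ∷ L} (there p) (ap ∷ ds) with extract p ds
  ... | E = record
    { rep = rep E ; rep∈ = there (rep∈ E) ; x~rep = x~rep E ; rest = y ∷ rest E
    ; sum = trans (cong (λ z → f y ℤ.+ z) (sum E)) (swap (f y) (f (rep E)) (sumL f (rest E)))
    ; distinct = All.tabulate (λ m → All.lookup ap (rest⊆ E m)) ∷ distinct E
    ; apart = λ { (here refl) y~r → All.lookup ap (rep∈ E) y~r ; (there m) → apart E m }
    ; rest⊆ = λ { (here refl) → here refl ; (there m) → there (rest⊆ E m) }
    ; split = λ { (here q) → inj₂ (here q) ; (there q) → ⊎-map (λ z → z) there (split E q) } }
    where
    swap : ∀ a b c → a ℤ.+ (b ℤ.+ c) ≡ b ℤ.+ (a ℤ.+ c)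
    swap = ℤ-solve-∀

  sums-agree : ∀ L L′ → Distinct L → Distinct L′ →
    (∀ {x} → x ∈ L → Any (x ~_) L′) → (∀ {x} → x ∈ L′ → Any (x ~_) L) →
    (∀ {x y} → x ∈ L → y ∈ L′ → x ~ y → f x ≡ f y) → sumL f L ≡ sumL f L′
  sums-agree [] [] _ _ _ _ _ = refl
  sums-agree [] (y ∷ L′) _ _ _ back _ with back (here refl)
  ... | ()
  sums-agree (x ∷ L) L′ (ap ∷ ds) ds′ forth back respects with extract (forth (here refl)) ds′
  ... | E = trans (cong₂ ℤ._+_ (respects (here refl) (rep∈ E) (x~rep E))
      (sums-agree L (rest E) ds (distinct E) forth′ back′ (λ m m′ → respects (there m) (rest⊆ E m′)))) (sym (sum E))
    where
    forth′ : ∀ {y} → y ∈ L → Any (y ~_) (rest E)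
    forth′ m with split E (forth (there m))
    ... | inj₁ y~r = ⊥-elim (All.lookup ap m (~-trans (x~rep E) (~-sym y~r)))
    ... | inj₂ p = p
    back′ : ∀ {y} → y ∈ rest E → Any (y ~_) L
    back′ m with back (rest⊆ E m)
    ... | here y~x = ⊥-elim (apart E m (~-trans y~x (x~rep E)))
    ... | there p = p

sumSigns≡sumL : ∀ {d} (L : List (FaceEntry d)) → sumSigns L ≡ sumL (λ (_ , _ , n) → signDim n) L
sumSigns≡sumL [] = refl
sumSigns≡sumL ((_ , _ , n) ∷ L) = cong (λ z → signDim n ℤ.+ z) (sumSigns≡sumL L)

RedEuler-unique : ∀ {d} (Q P : LatticePolytope d) {z z′} → RedEuler Q P z → RedEuler Q P z′ → z ≡ z′
RedEuler-unique Q P (L , good , distinct , covers , refl) (L′ , good′ , distinct′ , covers′ , refl) =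
  trans (sumSigns≡sumL L) (trans (sums-agree L L′ distinct distinct′
    (λ {(c , b , _)} m → covers′ c b (proj₁ (All.lookup good m)))
    (λ {(c , b , _)} m → covers c b (proj₁ (All.lookup good′ m)))
    (λ {(c , b , _)} {(c′ , b′ , _)} m m′ e → cong signDim (DimPlusOne-unique {S = FaceSet P c′ b′} (DimPlusOne-≐ e (proj₂ (All.lookup good m))) (proj₂ (All.lookup good′ m′)))))
  (sym (sumSigns≡sumL L′)))
  where
  open Transversal (λ e e′ → entrySet P e ≐ entrySet P e′) ≐-sym ≐-trans (λ (_ , _ , n) → signDim n)

RedEuler-value : ∀ {d} (Q P : LatticePolytope d) {z} → RedEuler Q P z → z ≡ ℤ.- alternatingSum Q P
RedEuler-value Q P r = RedEuler-unique Q P r (Faces.redEuler P Q)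

isValuation : ∀ {d} (Q : LatticePolytope d) → IsValuation (λ P z → RedEuler Q P z)
isValuation Q = (λ P → ℤ.- alternatingSum Q P , Faces.redEuler P Q) , (λ P z z′ → RedEuler-unique Q P) , additive
  where
  additive : ∀ P₁ P₂ U I → ((λ x → (x ∈P P₁) ⊎ (x ∈P P₂)) ≐ ⟦ U ⟧) → ((λ x → (x ∈P P₁) × (x ∈P P₂)) ≐ ⟦ I ⟧) →
    ∀ a b u i → RedEuler Q P₁ a → RedEuler Q P₂ b → RedEuler Q U u → RedEuler Q I i → u ℤ.+ i ≡ a ℤ.+ b
  additive P₁ P₂ U I un int a b u i ra rb ru ri = begin
    u ℤ.+ i ≡⟨ cong₂ ℤ._+_ (RedEuler-value Q U ru) (RedEuler-value Q I ri) ⟩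
    ℤ.- alternatingSum Q U ℤ.+ ℤ.- alternatingSum Q I ≡⟨ sym (ℤP.neg-distrib-+ (alternatingSum Q U) (alternatingSum Q I)) ⟩
    ℤ.- (alternatingSum Q U ℤ.+ alternatingSum Q I) ≡⟨ cong ℤ.-_ (alternatingSum-valuation P₁ P₂ U I un int Q) ⟩
    ℤ.- (alternatingSum Q P₁ ℤ.+ alternatingSum Q P₂) ≡⟨ ℤP.neg-distrib-+ (alternatingSum Q P₁) (alternatingSum Q P₂) ⟩
    ℤ.- alternatingSum Q P₁ ℤ.+ ℤ.- alternatingSum Q P₂ ≡⟨ sym (cong₂ ℤ._+_ (RedEuler-value Q P₁ ra) (RedEuler-value Q P₂ rb)) ⟩
    a ℤ.+ b ∎
    where open ≡-Reasoning

-- Polynomial functions and alternating sums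

ℤtoℚ-+ : ∀ a b → ℤtoℚ (a ℤ.+ b) ≡ ℤtoℚ a + ℤtoℚ b
ℤtoℚ-+ a b = ℚP.toℚᵘ-injective (begin
  ℚ.toℚᵘ (ℤtoℚ (a ℤ.+ b)) ≈⟨ ℚP.toℚᵘ-fromℚᵘ (ℚᵘ.mkℚᵘ (a ℤ.+ b) 0) ⟩
  ℚᵘ.mkℚᵘ (a ℤ.+ b) 0 ≈⟨ ℚᵘ.*≡* (lem a b) ⟩
  ℚᵘ.mkℚᵘ a 0 ℚᵘ.+ ℚᵘ.mkℚᵘ b 0 ≈⟨ ℚᵘP.+-cong (ℚᵘP.≃-sym (ℚP.toℚᵘ-fromℚᵘ (ℚᵘ.mkℚᵘ a 0))) (ℚᵘP.≃-sym (ℚP.toℚᵘ-fromℚᵘ (ℚᵘ.mkℚᵘ b 0))) ⟩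
  ℚ.toℚᵘ (ℤtoℚ a) ℚᵘ.+ ℚ.toℚᵘ (ℤtoℚ b) ≈⟨ ℚᵘP.≃-sym (ℚP.toℚᵘ-homo-+ (ℤtoℚ a) (ℤtoℚ b)) ⟩
  ℚ.toℚᵘ (ℤtoℚ a + ℤtoℚ b) ∎)
  where
  open ℚᵘP.≃-Reasoning
  lem : ∀ a b → (a ℤ.+ b) ℤ.* (ℤ.+ 1 ℤ.* ℤ.+ 1) ≡ (a ℤ.* ℤ.+ 1 ℤ.+ b ℤ.* ℤ.+ 1) ℤ.* ℤ.+ 1
  lem = ℤ-solve-∀

ℤtoℚ-neg : ∀ a → ℤtoℚ (ℤ.- a) ≡ - ℤtoℚ a
ℤtoℚ-neg a = begin
  ℤtoℚ (ℤ.- a) ≡⟨ sym (a+b-a≡b (ℤtoℚ a) (ℤtoℚ (ℤ.- a))) ⟩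
  (ℤtoℚ a + ℤtoℚ (ℤ.- a)) - ℤtoℚ a ≡⟨ cong (_- ℤtoℚ a) (trans (sym (ℤtoℚ-+ a (ℤ.- a))) (cong ℤtoℚ (ℤP.+-inverseʳ a))) ⟩
  0ℚ - ℤtoℚ a ≡⟨ ℚP.+-identityˡ (- ℤtoℚ a) ⟩
  - ℤtoℚ a ∎
  where open ≡-Reasoning

ℤtoℚ-minus : ∀ a b → ℤtoℚ (a ℤ.- b) ≡ ℤtoℚ a - ℤtoℚ b
ℤtoℚ-minus a b = trans (ℤtoℚ-+ a (ℤ.- b)) (cong (ℤtoℚ a +_) (ℤtoℚ-neg b))

ℕtoℚ-+ : ∀ m n → ℕtoℚ (m ℕ.+ n) ≡ ℕtoℚ m + ℕtoℚ n
ℕtoℚ-+ m n = ℤtoℚ-+ (ℤ.+ m) (ℤ.+ n)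

ℕtoℚ-nonneg : ∀ n → 0ℚ ≤ ℕtoℚ n
ℕtoℚ-nonneg zero = ℚP.≤-refl
ℕtoℚ-nonneg (suc n) = subst (0ℚ ≤_) (sym (ℕtoℚ-+ 1 n)) (nonneg+nonneg 0≤1 (ℕtoℚ-nonneg n))

ℕtoℚ-suc-pos : ∀ n → 0ℚ < ℕtoℚ (suc n)
ℕtoℚ-suc-pos n = subst (0ℚ <_) (sym (ℕtoℚ-+ 1 n)) (pos+nonneg 0<1 (ℕtoℚ-nonneg n))

ℕtoℚ-mono-< : ∀ {m n} → m ℕ.< n → ℕtoℚ m < ℕtoℚ n
ℕtoℚ-mono-< {m} {n} m<n with ℕP.m≤n⇒∃[o]m+o≡n m<n
... | o , refl = 0<-⇒< (subst (0ℚ <_) (sym difference) (ℕtoℚ-suc-pos o))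
  where
  difference : ℕtoℚ (suc m ℕ.+ o) - ℕtoℚ m ≡ ℕtoℚ (suc o)
  difference = trans (cong (λ n → ℕtoℚ n - ℕtoℚ m) (sym (ℕP.+-suc m o))) (trans (cong (_- ℕtoℚ m) (ℕtoℚ-+ m (suc o))) (a+b-a≡b (ℕtoℚ m) (ℕtoℚ (suc o))))

∇ : (ℚ → ℚ) → ℚ → ℚ
∇ g x = g x - g (x - 1ℚ)

-- g is a polynomial function of degree < n.
Poly : ℕ → (ℚ → ℚ) → Set
Poly zero g = ∀ x → g x ≡ 0ℚ
Poly (suc n) g = Poly n (∇ g)

Poly-cong : ∀ n {g h} → (∀ x → g x ≡ h x) → Poly n g → Poly n h
Poly-cong zero e p x = trans (sym (e x)) (p x)
Poly-cong (suc n) {g} {h} e p = Poly-cong n {∇ g} {∇ h} (λ x → cong₂ _-_ (e x) (e (x - 1ℚ))) p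

Poly-∇ : ∀ n {g} → Poly n g → Poly n (∇ g)
Poly-∇ zero p x = trans (cong₂ _-_ (p x) (p (x - 1ℚ))) (ℚP.+-inverseʳ 0ℚ)
Poly-∇ (suc n) {g} p = Poly-∇ n {∇ g} p

Poly-≤ : ∀ {m n g} → m ℕ.≤′ n → Poly m g → Poly n g
Poly-≤ (ℕ.≤′-reflexive refl) p = p
Poly-≤ {n = suc n} {g} (ℕ.≤′-step le) p = Poly-∇ n {g} (Poly-≤ {g = g} le p)

Poly-+ : ∀ n {g h} → Poly n g → Poly n h → Poly n (λ x → g x + h x)
Poly-+ zero p q x = trans (cong₂ _+_ (p x) (q x)) (ℚP.+-identityʳ 0ℚ)
Poly-+ (suc n) {g} {h} p q = Poly-cong n (λ x → lem (g x) (g (x - 1ℚ)) (h x) (h (x - 1ℚ))) (Poly-+ n {∇ g} {∇ h} p q)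
  where
  lem : ∀ a b c d → (a - b) + (c - d) ≡ (a + c) - (b + d)
  lem = solve-∀ ℚ-ring

Poly-* : ∀ n a {g} → Poly n g → Poly n (λ x → a * g x)
Poly-* zero a p x = trans (cong (a *_) (p x)) (ℚP.*-zeroʳ a)
Poly-* (suc n) a {g} p = Poly-cong n (λ x → lem a (g x) (g (x - 1ℚ))) (Poly-* n a {∇ g} p)
  where
  lem : ∀ a b c → a * (b - c) ≡ a * b - a * c
  lem = solve-∀ ℚ-ring

Poly-shift : ∀ n {g} → Poly n g → Poly n (λ x → g (x - 1ℚ))
Poly-shift zero p x = p (x - 1ℚ)
Poly-shift (suc n) {g} p = Poly-shift n {∇ g} p

-- Product rule: `∇ (x g) = x ∇ g + g(x - 1)`.
Poly-x* : ∀ n {g} → Poly n g → Poly (suc n) (λ x → x * g x)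
Poly-x* zero {g} p x = trans (cong₂ (λ a b → x * a - (x - 1ℚ) * b) (p x) (p (x - 1ℚ))) (lem x)
  where
  lem : ∀ x → x * 0ℚ - (x - 1ℚ) * 0ℚ ≡ 0ℚ
  lem = solve-∀ ℚ-ring
Poly-x* (suc n) {g} p = Poly-cong (suc n) (λ x → lem x (g x) (g (x - 1ℚ))) (Poly-+ (suc n) {λ x → x * ∇ g x} {λ x → g (x - 1ℚ)} (Poly-x* n {∇ g} p) (Poly-shift (suc n) {g} p))
  where
  lem : ∀ x a b → x * (a - b) + b ≡ x * a - (x - 1ℚ) * b
  lem = solve-∀ ℚ-ring

Poly-pow : ∀ i → Poly (suc i) (λ x → powℚ x i)
Poly-pow zero x = ℚP.+-inverseʳ 1ℚ
Poly-pow (suc i) = Poly-x* (suc i) {λ x → powℚ x i} (Poly-pow i)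

Poly-eval : ∀ E y → ∃ λ n → Poly n (λ x → eval2 E x y)
Poly-eval [] y = 0 , λ _ → refl
Poly-eval ((i , j , a) ∷ E) y with Poly-eval E y
... | n , p = suc i ℕ.+ n , Poly-cong (suc i ℕ.+ n) {λ x → monomial x + eval2 E x y} (λ x → cong (_+ eval2 E x y) (lem a (powℚ y j) (powℚ x i)))
      (Poly-+ (suc i ℕ.+ n) {monomial} {λ x → eval2 E x y}
        (Poly-≤ {g = monomial} (ℕP.≤⇒≤′ (ℕP.m≤m+n (suc i) n)) (Poly-* (suc i) (a * powℚ y j) {λ x → powℚ x i} (Poly-pow i)))
        (Poly-≤ {g = λ x → eval2 E x y} (ℕP.≤⇒≤′ (ℕP.m≤n+m n (suc i))) p))
  where
  monomial : ℚ → ℚ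
  monomial x = (a * powℚ y j) * powℚ x i
  lem : ∀ a b c → (a * b) * c ≡ a * c * b
  lem = solve-∀ ℚ-ring

ℕtoℚ-pred : ∀ n → ℕtoℚ (suc n) - 1ℚ ≡ ℕtoℚ n
ℕtoℚ-pred n = trans (cong (_- 1ℚ) (ℕtoℚ-+ 1 n)) (a+b-a≡b 1ℚ (ℕtoℚ n))

-- Zeros move down one step by `g(m) = g(m + 1) - ∇ g(m + 1)`: the function `∇ g` has a smaller
-- degree bound and vanishes beyond `m + 1`, hence by induction also at `m + 1`.
Poly-extend : ∀ n {g} → Poly n g → ∀ m → (∀ j → m ℕ.< j → g (ℕtoℚ j) ≡ 0ℚ) → g (ℕtoℚ m) ≡ 0ℚ
Poly-extend zero p m h = p (ℕtoℚ m)
Poly-extend (suc n) {g} p m h = begin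
  g (ℕtoℚ m) ≡⟨ cong g (sym (ℕtoℚ-pred m)) ⟩
  g (ℕtoℚ (suc m) - 1ℚ) ≡⟨ lem (g (ℕtoℚ (suc m))) (g (ℕtoℚ (suc m) - 1ℚ)) ⟩
  g (ℕtoℚ (suc m)) - ∇ g (ℕtoℚ (suc m)) ≡⟨ cong₂ _-_ (h (suc m) ℕP.≤-refl) (Poly-extend n {∇ g} p (suc m) ∇-vanishes) ⟩
  0ℚ - 0ℚ ≡⟨ ℚP.+-inverseʳ 0ℚ ⟩
  0ℚ ∎
  where
  open ≡-Reasoning
  lem : ∀ a b → b ≡ a - (a - b)
  lem = solve-∀ ℚ-ring
  ∇-vanishes : ∀ j → suc m ℕ.< j → ∇ g (ℕtoℚ j) ≡ 0ℚ
  ∇-vanishes (suc j) (ℕ.s≤s m<j) = trans (cong₂ _-_ (h (suc j) (ℕP.≤-trans m<j (ℕP.n≤1+n j))) (trans (cong g (ℕtoℚ-pred j)) (h j m<j))) (ℚP.+-inverseʳ 0ℚ)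

-- Alternating sums over subsets and iterated differences

alt : ∀ {A : Set} → (A → A → A) → ∀ k → (Vec Bool k → A) → A
alt _⊖_ zero f = f []
alt _⊖_ (suc k) f = alt _⊖_ k (f ∘ (false ∷_)) ⊖ alt _⊖_ k (f ∘ (true ∷_))

altℤ : ∀ k → (Vec Bool k → ℤ) → ℤ
altℤ = alt ℤ._-_

altℚ : ∀ k → (Vec Bool k → ℚ) → ℚ
altℚ = alt _-_

alt-cong : ∀ {A : Set} (_⊖_ : A → A → A) k {f g : Vec Bool k → A} → (∀ β → f β ≡ g β) → alt _⊖_ k f ≡ alt _⊖_ k g
alt-cong _⊖_ zero h = h []
alt-cong _⊖_ (suc k) h = cong₂ _⊖_ (alt-cong _⊖_ k (h ∘ (false ∷_))) (alt-cong _⊖_ k (h ∘ (true ∷_)))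

altℤ-0 : ∀ k {f : Vec Bool k → ℤ} → (∀ β → f β ≡ ℤ.0ℤ) → altℤ k f ≡ ℤ.0ℤ
altℤ-0 zero h = h []
altℤ-0 (suc k) h = cong₂ ℤ._-_ (altℤ-0 k (h ∘ (false ∷_))) (altℤ-0 k (h ∘ (true ∷_)))

altℤ-const : ∀ k c → altℤ (suc k) (λ _ → c) ≡ ℤ.0ℤ
altℤ-const k c = ℤP.+-inverseʳ (altℤ k (λ _ → c))

altℤ-minus : ∀ k (f g : Vec Bool k → ℤ) → altℤ k (λ β → f β ℤ.- g β) ≡ altℤ k f ℤ.- altℤ k g
altℤ-minus zero f g = refl
altℤ-minus (suc k) f g = trans (cong₂ ℤ._-_ (altℤ-minus k (f ∘ (false ∷_)) (g ∘ (false ∷_))) (altℤ-minus k (f ∘ (true ∷_)) (g ∘ (true ∷_))))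
  (lem (altℤ k (f ∘ (false ∷_))) (altℤ k (g ∘ (false ∷_))) (altℤ k (f ∘ (true ∷_))) (altℤ k (g ∘ (true ∷_))))
  where
  lem : ∀ a b c d → (a ℤ.- b) ℤ.- (c ℤ.- d) ≡ (a ℤ.- c) ℤ.- (b ℤ.- d)
  lem = ℤ-solve-∀

altℤ-sumL : ∀ {A : Set} k (f : A → Vec Bool k → ℤ) (xs : List A) → sumL (λ x → altℤ k (f x)) xs ≡ altℤ k (λ β → sumL (λ x → f x β) xs)
altℤ-sumL zero f xs = refl
altℤ-sumL (suc k) f xs = trans (sumL-+ (λ x → altℤ k (λ β → f x (false ∷ β))) (λ x → ℤ.- altℤ k (λ β → f x (true ∷ β))) xs)
  (cong₂ ℤ._+_ (altℤ-sumL k (λ x β → f x (false ∷ β)) xs)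
    (trans (sumL-neg (λ x → altℤ k (λ β → f x (true ∷ β))) xs) (cong ℤ.-_ (altℤ-sumL k (λ x β → f x (true ∷ β)) xs))))

ℤtoℚ-alt : ∀ k (f : Vec Bool k → ℤ) → ℤtoℚ (altℤ k f) ≡ altℚ k (ℤtoℚ ∘ f)
ℤtoℚ-alt zero f = refl
ℤtoℚ-alt (suc k) f = trans (ℤtoℚ-minus (altℤ k (f ∘ (false ∷_))) (altℤ k (f ∘ (true ∷_))))
  (cong₂ _-_ (ℤtoℚ-alt k (f ∘ (false ∷_))) (ℤtoℚ-alt k (f ∘ (true ∷_))))

#true : ∀ {k} → Vec Bool k → ℕ
#true [] = 0
#true (false ∷ β) = #true β
#true (true ∷ β) = suc (#true β)

#true≤ : ∀ {k} (β : Vec Bool k) → #true β ℕ.≤ k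
#true≤ [] = ℕ.z≤n
#true≤ (false ∷ β) = ℕP.≤-trans (#true≤ β) (ℕP.n≤1+n _)
#true≤ (true ∷ β) = ℕ.s≤s (#true≤ β)

∇^ : ℕ → (ℚ → ℚ) → ℚ → ℚ
∇^ zero g = g
∇^ (suc k) g = ∇ (∇^ k g)

Poly-∇^ : ∀ k n {g} → Poly n g → Poly n (∇^ k g)
Poly-∇^ zero n p = p
Poly-∇^ (suc k) n {g} p = Poly-∇ n {∇^ k g} (Poly-∇^ k n {g} p)

∇^-alt : ∀ k g x → ∇^ k g x ≡ altℚ k (λ β → g (x - ℕtoℚ (#true β)))
∇^-alt zero g x = cong g (sym (a-0≡a x))
∇^-alt (suc k) g x = cong₂ _-_ (∇^-alt k g x) (trans (∇^-alt k g (x - 1ℚ)) (alt-cong _-_ k (λ β → cong g (shift≡ (#true β)))))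
  where
  lem : ∀ x n → x - 1ℚ - n ≡ x - (1ℚ + n)
  lem = solve-∀ ℚ-ring
  shift≡ : ∀ n → x - 1ℚ - ℕtoℚ n ≡ x - ℕtoℚ (suc n)
  shift≡ n = trans (lem x (ℕtoℚ n)) (cong (λ z → x - z) (sym (ℕtoℚ-+ 1 n)))

signℤ : ℕ → ℤ
signℤ zero = ℤ.1ℤ
signℤ (suc k) = ℤ.- signℤ k

signℚ : ℕ → ℚ
signℚ k = ℤtoℚ (signℤ k)

-- The all-true vector enters with sign `(-1)^k`. In the application it is the one argument where
-- `f` continues a polynomial to -1 while `g` counts nothing.
altℚ-change : ∀ k (f g : Vec Bool k → ℚ) → (∀ β → #true β ℕ.< k → f β ≡ g β) →
  altℚ k f ≡ altℚ k g + signℚ k * (f (Vec.replicate k true) - g (Vec.replicate k true))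
altℚ-change zero f g h = lem (f []) (g [])
  where
  lem : ∀ a b → a ≡ b + 1ℚ * (a - b)
  lem = solve-∀ ℚ-ring
altℚ-change (suc k) f g h = trans
  (cong₂ _-_ (alt-cong _-_ k (λ β → h (false ∷ β) (ℕ.s≤s (#true≤ β)))) (altℚ-change k (f ∘ (true ∷_)) (g ∘ (true ∷_)) (λ β lt → h (true ∷ β) (ℕ.s≤s lt))))
  (trans (lem (altℚ k (g ∘ (false ∷_))) (altℚ k (g ∘ (true ∷_))) (signℚ k) (f (true ∷ Vec.replicate k true) - g (true ∷ Vec.replicate k true)))
    (cong (λ z → altℚ (suc k) g + z * (f (true ∷ Vec.replicate k true) - g (true ∷ Vec.replicate k true))) (sym (ℤtoℚ-neg (signℤ k)))))
  where
  lem : ∀ a b s d → a - (b + s * d) ≡ (a - b) + - s * d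
  lem = solve-∀ ℚ-ring

-- Exchanging the constraints on the weights

data Kind : Set where
  free ge le eq : Kind

In : Kind → ℚ → Set
In free w = 0ℚ ≤ w
In ge w = 1ℚ ≤ w
In le w = 0ℚ ≤ w × w ≤ 1ℚ
In eq w = w ≡ 1ℚ

kind₁ kind₂ : Bool → Kind
kind₁ false = free
kind₁ true = ge
kind₂ false = le
kind₂ true = eq

-- The exchange at one coordinate is required whatever the constraints on the others are, because
-- `Law-alt` replaces the coordinates one by one and passes through mixed vectors.
Law : ∀ k → (Vec Kind k → ℤ) → Set
Law zero f = ⊤
Law (suc k) f = (∀ κ → f (free ∷ κ) ℤ.- f (ge ∷ κ) ≡ f (le ∷ κ) ℤ.- f (eq ∷ κ)) × (∀ κ₀ → Law k (f ∘ (κ₀ ∷_)))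

Law-alt : ∀ k f → Law k f → altℤ k (f ∘ Vec.map kind₁) ≡ altℤ k (f ∘ Vec.map kind₂)
Law-alt zero f _ = refl
Law-alt (suc k) f (head-law , tail-law) = begin
  altℤ k (λ β → f (free ∷ Vec.map kind₁ β)) ℤ.- altℤ k (λ β → f (ge ∷ Vec.map kind₁ β))
    ≡⟨ cong₂ ℤ._-_ (Law-alt k (f ∘ (free ∷_)) (tail-law free)) (Law-alt k (f ∘ (ge ∷_)) (tail-law ge)) ⟩
  altℤ k (λ β → f (free ∷ Vec.map kind₂ β)) ℤ.- altℤ k (λ β → f (ge ∷ Vec.map kind₂ β))
    ≡⟨ sym (altℤ-minus k (λ β → f (free ∷ Vec.map kind₂ β)) (λ β → f (ge ∷ Vec.map kind₂ β))) ⟩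
  altℤ k (λ β → f (free ∷ Vec.map kind₂ β) ℤ.- f (ge ∷ Vec.map kind₂ β))
    ≡⟨ alt-cong ℤ._-_ k (λ β → head-law (Vec.map kind₂ β)) ⟩
  altℤ k (λ β → f (le ∷ Vec.map kind₂ β) ℤ.- f (eq ∷ Vec.map kind₂ β))
    ≡⟨ altℤ-minus k (λ β → f (le ∷ Vec.map kind₂ β)) (λ β → f (eq ∷ Vec.map kind₂ β)) ⟩
  altℤ k (λ β → f (le ∷ Vec.map kind₂ β)) ℤ.- altℤ k (λ β → f (eq ∷ Vec.map kind₂ β)) ∎
  where open ≡-Reasoning

Fits : ∀ {k} → Vec Kind k → Vec ℚ k → Set
Fits [] [] = ⊤
Fits (κ ∷ κs) (w ∷ ws) = In κ w × Fits κs ws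

Sol : ∀ {k} → Vec Kind k → (Vec ℚ k → Set) → Set
Sol κ C = ∃ λ w → Fits κ w × C w

Convex : ∀ {k} → (Vec ℚ k → Set) → Set
Convex C = ∀ {w v a b} → 0ℚ ≤ a → 0ℚ ≤ b → a + b ≡ 1ℚ → C w → C v → C ((a • w) ⊕ (b • v))

average-≥ : ∀ {l w v a b} → 0ℚ ≤ a → 0ℚ ≤ b → a + b ≡ 1ℚ → l ≤ w → l ≤ v → l ≤ a * w + b * v
average-≥ {l} {w} {v} {a} {b} a≥0 b≥0 a+b≡1 l≤w l≤v = 0≤-⇒≤ (subst (0ℚ ≤_)
  (trans (lem a b l w v) (cong (λ z → a * w + b * v - z) (trans (cong (_* l) a+b≡1) (ℚP.*-identityˡ l))))
  (nonneg+nonneg (nonneg*nonneg a≥0 (≤⇒0≤- l≤w)) (nonneg*nonneg b≥0 (≤⇒0≤- l≤v))))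
  where
  lem : ∀ a b l w v → a * (w - l) + b * (v - l) ≡ a * w + b * v - (a + b) * l
  lem = solve-∀ ℚ-ring

average-≤ : ∀ {l w v a b} → 0ℚ ≤ a → 0ℚ ≤ b → a + b ≡ 1ℚ → w ≤ l → v ≤ l → a * w + b * v ≤ l
average-≤ {l} {w} {v} {a} {b} a≥0 b≥0 a+b≡1 w≤l v≤l = 0≤-⇒≤ (subst (0ℚ ≤_)
  (trans (lem a b l w v) (cong (λ z → z - (a * w + b * v)) (trans (cong (_* l) a+b≡1) (ℚP.*-identityˡ l))))
  (nonneg+nonneg (nonneg*nonneg a≥0 (≤⇒0≤- w≤l)) (nonneg*nonneg b≥0 (≤⇒0≤- v≤l))))
  where
  lem : ∀ a b l w v → a * (l - w) + b * (l - v) ≡ (a + b) * l - (a * w + b * v)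
  lem = solve-∀ ℚ-ring

In-convex : ∀ κ {w v a b} → 0ℚ ≤ a → 0ℚ ≤ b → a + b ≡ 1ℚ → In κ w → In κ v → In κ (a * w + b * v)
In-convex free = average-≥
In-convex ge = average-≥
In-convex le a≥0 b≥0 s (w≥0 , w≤1) (v≥0 , v≤1) = average-≥ a≥0 b≥0 s w≥0 v≥0 , average-≤ a≥0 b≥0 s w≤1 v≤1
In-convex eq {a = a} {b} a≥0 b≥0 s refl refl = trans (cong₂ _+_ (ℚP.*-identityʳ a) (ℚP.*-identityʳ b)) s

Fits-convex : ∀ {k} (κ : Vec Kind k) → Convex (Fits κ)
Fits-convex [] {[]} {[]} _ _ _ _ _ = tt
Fits-convex (κ ∷ κs) {w ∷ ws} {v ∷ vs} a≥0 b≥0 s (i , f) (j , g) = In-convex κ a≥0 b≥0 s i j , Fits-convex κs a≥0 b≥0 s f g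

Slice : ∀ {k} → Kind → (Vec ℚ (suc k) → Set) → Vec ℚ k → Set
Slice κ C ws = ∃ λ w → In κ w × C (w ∷ ws)

Slice-convex : ∀ {k} κ {C : Vec ℚ (suc k) → Set} → Convex C → Convex (Slice κ C)
Slice-convex κ conv a≥0 b≥0 s (w , i , c) (v , j , d) = _ , In-convex κ a≥0 b≥0 s i j , conv a≥0 b≥0 s c d

-- A relation instead of a function on decisions: solvability of the weight systems is not decided,
-- yet indicator values of equivalent propositions can be compared.
IsInd : Set → ℤ → Set
IsInd A n = (A × n ≡ ℤ.1ℤ) ⊎ (¬ A × n ≡ ℤ.0ℤ)

IsInd-map : ∀ {A B n} → (A → B) → (B → A) → IsInd A n → IsInd B n
IsInd-map f g (inj₁ (a , e)) = inj₁ (f a , e)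
IsInd-map f g (inj₂ (¬a , e)) = inj₂ (¬a ∘ g , e)

IsInd-unique : ∀ {A m n} → IsInd A m → IsInd A n → m ≡ n
IsInd-unique (inj₁ (_ , refl)) (inj₁ (_ , refl)) = refl
IsInd-unique (inj₁ (a , _)) (inj₂ (¬a , _)) = ⊥-elim (¬a a)
IsInd-unique (inj₂ (¬a , _)) (inj₁ (a , _)) = ⊥-elim (¬a a)
IsInd-unique (inj₂ (_ , refl)) (inj₂ (_ , refl)) = refl

IsInd-yes : ∀ {A n} → A → IsInd A n → n ≡ ℤ.1ℤ
IsInd-yes a (inj₁ (_ , e)) = e
IsInd-yes a (inj₂ (¬a , _)) = ⊥-elim (¬a a)

IsInd-no : ∀ {A n} → ¬ A → IsInd A n → n ≡ ℤ.0ℤ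
IsInd-no ¬a (inj₁ (a , _)) = ⊥-elim (¬a a)
IsInd-no ¬a (inj₂ (_ , e)) = e

IsInd-¬ : ∀ {A B : Set} (d : Dec B) → (A → ¬ B) → (¬ B → A) → IsInd A (ℤ.1ℤ ℤ.- ind d)
IsInd-¬ (yes b) f g = inj₂ ((λ a → f a b) , refl)
IsInd-¬ (no ¬b) f g = inj₁ (g ¬b , refl)

IsInd-ind : ∀ {A : Set} (d : Dec A) → IsInd A (ind d)
IsInd-ind (yes a) = inj₁ (a , refl)
IsInd-ind (no ¬a) = inj₂ (¬a , refl)

crossing-one : ∀ {w v} → 1ℚ ≤ w → v ≤ 1ℚ → ∃₂ λ a b → 0ℚ ≤ a × 0ℚ ≤ b × a + b ≡ 1ℚ × a * w + b * v ≡ 1ℚ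
crossing-one {w} {v} 1≤w v≤1 with nonneg-cases (≤⇒0≤- (ℚP.≤-trans v≤1 1≤w))
... | inj₁ w-v≡0 = 1ℚ , 0ℚ , 0≤1 , ℚP.≤-refl , refl , trans (lem w v) (ℚP.≤-antisym w≤1 1≤w)
  where
  lem : ∀ w v → 1ℚ * w + 0ℚ * v ≡ w
  lem = solve-∀ ℚ-ring
  w≤1 : w ≤ 1ℚ
  w≤1 = subst (_≤ 1ℚ) (sym (trans (lem₂ w v) (trans (cong (_+ v) w-v≡0) (ℚP.+-identityˡ v)))) v≤1
    where
    lem₂ : ∀ w v → w ≡ (w - v) + v
    lem₂ = solve-∀ ℚ-ring
... | inj₂ w-v>0 with pos-recip w-v>0
...   | r , r>0 , rd = r * (1ℚ - v) , r * (w - 1ℚ) , nonneg*nonneg (ℚP.<⇒≤ r>0) (≤⇒0≤- v≤1) , nonneg*nonneg (ℚP.<⇒≤ r>0) (≤⇒0≤- 1≤w) ,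
        trans (lem₁ r w v) rd , trans (lem₂ r w v) rd
  where
  lem₁ : ∀ r w v → r * (1ℚ - v) + r * (w - 1ℚ) ≡ r * (w - v)
  lem₁ = solve-∀ ℚ-ring
  lem₂ : ∀ r w v → r * (1ℚ - v) * w + r * (w - 1ℚ) * v ≡ r * (w - v)
  lem₂ = solve-∀ ℚ-ring

-- A convex set with points on both sides of the hyperplane w = 1 also meets it.
convex-Law : ∀ k (C : Vec ℚ k → Set) → Convex C → ∀ f → (∀ κ → IsInd (Sol κ C) (f κ)) → Law k f
convex-Law zero C conv f h = tt
convex-Law (suc k) C conv f h = head-law , λ κ₀ → convex-Law k (Slice κ₀ C) (Slice-convex κ₀ {C} conv) (f ∘ (κ₀ ∷_))
    (λ κ → IsInd-map (λ { (w ∷ ws , (i , fit) , c) → ws , fit , w , i , c }) (λ { (ws , fit , w , i , c) → w ∷ ws , (i , fit) , c }) (h (κ₀ ∷ κ)))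
  where
  head-law : ∀ κ → f (free ∷ κ) ℤ.- f (ge ∷ κ) ≡ f (le ∷ κ) ℤ.- f (eq ∷ κ)
  head-law κ = cases (h (ge ∷ κ)) (h (le ∷ κ))
    where
    ge⇒free : Sol (ge ∷ κ) C → Sol (free ∷ κ) C
    ge⇒free (w ∷ ws , (i , fit) , c) = w ∷ ws , (ℚP.≤-trans 0≤1 i , fit) , c
    le⇒free : Sol (le ∷ κ) C → Sol (free ∷ κ) C
    le⇒free (w ∷ ws , (i , fit) , c) = w ∷ ws , (proj₁ i , fit) , c
    eq⇒ge : Sol (eq ∷ κ) C → Sol (ge ∷ κ) C
    eq⇒ge (w ∷ ws , (i , fit) , c) = w ∷ ws , (ℚP.≤-reflexive (sym i) , fit) , c
    eq⇒le : Sol (eq ∷ κ) C → Sol (le ∷ κ) C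
    eq⇒le (w ∷ ws , (i , fit) , c) = w ∷ ws , ((subst (0ℚ ≤_) (sym i) 0≤1 , ℚP.≤-reflexive i) , fit) , c
    free⇒ : Sol (free ∷ κ) C → Sol (ge ∷ κ) C ⊎ Sol (le ∷ κ) C
    free⇒ (w ∷ ws , (i , fit) , c) with ℚP.≤-total w 1ℚ
    ... | inj₁ w≤1 = inj₂ (w ∷ ws , ((i , w≤1) , fit) , c)
    ... | inj₂ 1≤w = inj₁ (w ∷ ws , (1≤w , fit) , c)
    both⇒eq : Sol (ge ∷ κ) C → Sol (le ∷ κ) C → Sol (eq ∷ κ) C
    both⇒eq (w ∷ ws , (i , fit) , c) (v ∷ vs , ((_ , j) , fit′) , c′) with crossing-one i j
    ... | a , b , a≥0 , b≥0 , s , e = (a * w + b * v) ∷ _ , (e , Fits-convex κ a≥0 b≥0 s fit fit′) , conv a≥0 b≥0 s c c′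
    cases : IsInd (Sol (ge ∷ κ) C) (f (ge ∷ κ)) → IsInd (Sol (le ∷ κ) C) (f (le ∷ κ)) → f (free ∷ κ) ℤ.- f (ge ∷ κ) ≡ f (le ∷ κ) ℤ.- f (eq ∷ κ)
    cases (inj₁ (g , eg)) (inj₁ (l , el)) = cong₂ ℤ._-_ (trans (IsInd-yes (ge⇒free g) (h (free ∷ κ))) (sym el)) (trans eg (sym (IsInd-yes (both⇒eq g l) (h (eq ∷ κ)))))
    cases (inj₁ (g , eg)) (inj₂ (¬l , el)) = trans (cong₂ ℤ._-_ (IsInd-yes (ge⇒free g) (h (free ∷ κ))) eg) (sym (cong₂ ℤ._-_ el (IsInd-no (¬l ∘ eq⇒le) (h (eq ∷ κ)))))
    cases (inj₂ (¬g , eg)) (inj₁ (l , el)) = cong₂ ℤ._-_ (trans (IsInd-yes (le⇒free l) (h (free ∷ κ))) (sym el)) (trans eg (sym (IsInd-no (¬g ∘ eq⇒ge) (h (eq ∷ κ)))))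
    cases (inj₂ (¬g , eg)) (inj₂ (¬l , el)) = cong₂ ℤ._-_ (trans (IsInd-no (λ s → case free⇒ s of λ { (inj₁ g) → ¬g g ; (inj₂ l) → ¬l l }) (h (free ∷ κ))) (sym el))
      (trans eg (sym (IsInd-no (¬g ∘ eq⇒ge) (h (eq ∷ κ)))))

-- Excluded middle for a single proposition is irrefutable, and there are only finitely many vectors
-- of kinds, so the choices can be combined. This suffices for equalities of integers, which are
-- stable under double negation.
¬¬-indicators : ∀ {k} (A : Vec Kind k → Set) → ¬ ¬ (∃ λ (f : Vec Kind k → ℤ) → ∀ κ → IsInd (A κ) (f κ))
¬¬-indicators {zero} A none = absurd (λ a → none ((λ _ → ℤ.1ℤ) , λ { [] → inj₁ (a , refl) }))
  where
  absurd : ¬ ¬ A []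
  absurd ¬a = none ((λ _ → ℤ.0ℤ) , λ { [] → inj₂ (¬a , refl) })
¬¬-indicators {suc k} A none =
  ¬¬-indicators (A ∘ (free ∷_)) λ (f₁ , h₁) →
  ¬¬-indicators (A ∘ (ge ∷_)) λ (f₂ , h₂) →
  ¬¬-indicators (A ∘ (le ∷_)) λ (f₃ , h₃) →
  ¬¬-indicators (A ∘ (eq ∷_)) λ (f₄ , h₄) →
  none ((λ { (free ∷ κ) → f₁ κ ; (ge ∷ κ) → f₂ κ ; (le ∷ κ) → f₃ κ ; (eq ∷ κ) → f₄ κ }) ,
      (λ { (free ∷ κ) → h₁ κ ; (ge ∷ κ) → h₂ κ ; (le ∷ κ) → h₃ κ ; (eq ∷ κ) → h₄ κ }))

-- Lattice points of mP + Q and weights on the generators of P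

infixl 6 _+ᶻ_
_+ᶻ_ : ∀ {d} → LPt d → LPt d → LPt d
_+ᶻ_ = Vec.zipWith ℤ._+_

0ᶻ : ∀ {d} → LPt d
0ᶻ = Vec.replicate _ ℤ.0ℤ

negᶻ : ∀ {d} → LPt d → LPt d
negᶻ = Vec.map (λ z → ℤ.- z)

+ᶻ-cancelʳ : ∀ {d} (x g : LPt d) → (x +ᶻ g) +ᶻ negᶻ g ≡ x
+ᶻ-cancelʳ [] [] = refl
+ᶻ-cancelʳ (x ∷ xs) (g ∷ gs) = cong₂ _∷_ (lem x g) (+ᶻ-cancelʳ xs gs)
  where
  lem : ∀ x g → (x ℤ.+ g) ℤ.+ ℤ.- g ≡ x
  lem = ℤ-solve-∀

+ᶻ-cancelʳ′ : ∀ {d} (x g : LPt d) → (x +ᶻ negᶻ g) +ᶻ g ≡ x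
+ᶻ-cancelʳ′ [] [] = refl
+ᶻ-cancelʳ′ (x ∷ xs) (g ∷ gs) = cong₂ _∷_ (lem x g) (+ᶻ-cancelʳ′ xs gs)
  where
  lem : ∀ x g → (x ℤ.+ ℤ.- g) ℤ.+ g ≡ x
  lem = ℤ-solve-∀

+ᶻ-injective : ∀ {d} (g : LPt d) {x y} → x +ᶻ g ≡ y +ᶻ g → x ≡ y
+ᶻ-injective g {x} {y} e = trans (sym (+ᶻ-cancelʳ x g)) (trans (cong (_+ᶻ negᶻ g) e) (+ᶻ-cancelʳ y g))

embed-+ : ∀ {d} (x y : LPt d) → embed (x +ᶻ y) ≡ embed x ⊕ embed y
embed-+ [] [] = refl
embed-+ (x ∷ xs) (y ∷ ys) = cong₂ _∷_ (ℤtoℚ-+ x y) (embed-+ xs ys)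

embed-0 : ∀ {d} → embed (0ᶻ {d}) ≡ 0ᵥ
embed-0 {zero} = refl
embed-0 {suc d} = cong (0ℚ ∷_) embed-0

⊕-cancelˡ : ∀ {n} (a : Pt n) {b c} → a ⊕ b ≡ a ⊕ c → b ≡ c
⊕-cancelˡ a {b} {c} e = trans (sym (undo b)) (trans (cong (neg a ⊕_) e) (undo c))
  where
  undo : ∀ b → neg a ⊕ (a ⊕ b) ≡ b
  undo b = trans (sym (⊕-assoc (neg a) a b)) (trans (cong (_⊕ b) (trans (⊕-comm (neg a) a) (⊕-neg a))) (⊕-identityˡ b))

+-cancelˡ : ∀ a {b c : ℚ} → a + b ≡ a + c → b ≡ c
+-cancelˡ a {b} {c} e = trans (sym (a+b-a≡b a b)) (trans (cong (λ z → z - a) e) (a+b-a≡b a c))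

shiftᶻ : ∀ {d k} → (Fin k → LPt d) → Vec Bool k → LPt d
shiftᶻ g [] = 0ᶻ
shiftᶻ g (false ∷ β) = shiftᶻ (g ∘ suc) β
shiftᶻ g (true ∷ β) = g zero +ᶻ shiftᶻ (g ∘ suc) β

bits : ∀ {k} → Vec Bool k → Fin k → ℚ
bits (b ∷ β) zero = if b then 1ℚ else 0ℚ
bits (b ∷ β) (suc i) = bits β i

bits-all : ∀ {k} (i : Fin k) → bits (Vec.replicate k true) i ≡ 1ℚ
bits-all zero = refl
bits-all (suc i) = bits-all i

sumF-bits : ∀ {k} (β : Vec Bool k) → sumF (bits β) ≡ ℕtoℚ (#true β)
sumF-bits [] = refl
sumF-bits (false ∷ β) = trans (ℚP.+-identityˡ (sumF (bits β))) (sumF-bits β)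
sumF-bits (true ∷ β) = trans (cong (1ℚ +_) (sumF-bits β)) (sym (ℕtoℚ-+ 1 (#true β)))

combo-bits : ∀ {d k} (g : Fin k → LPt d) (β : Vec Bool k) → combo (bits β) (λ i → embed (g i)) ≡ embed (shiftᶻ g β)
combo-bits g [] = sym embed-0
combo-bits g (false ∷ β) = trans (cong (_⊕ combo (bits β) (λ i → embed (g (suc i)))) (•-zeroˡ (embed (g zero)))) (trans (⊕-identityˡ _) (combo-bits (g ∘ suc) β))
combo-bits g (true ∷ β) = trans (cong₂ _⊕_ (•-identity (embed (g zero))) (combo-bits (g ∘ suc) β)) (sym (embed-+ (g zero) (shiftᶻ (g ∘ suc) β)))

sumF-mono : ∀ {k} {f g : Fin k → ℚ} → (∀ i → f i ≤ g i) → sumF f ≤ sumF g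
sumF-mono {zero} h = ℚP.≤-refl
sumF-mono {suc k} h = ℚP.+-mono-≤ (h zero) (sumF-mono (h ∘ suc))

sumF-1 : ∀ k → sumF {k} (λ _ → 1ℚ) ≡ ℕtoℚ k
sumF-1 zero = refl
sumF-1 (suc k) = trans (cong (1ℚ +_) (sumF-1 k)) (sym (ℕtoℚ-+ 1 k))

term≤sumF : ∀ {k} {f : Fin k → ℚ} → (∀ i → 0ℚ ≤ f i) → ∀ i → f i ≤ sumF f
term≤sumF {f = f} h zero = subst (_≤ sumF f) (ℚP.+-identityʳ (f zero)) (ℚP.+-monoʳ-≤ (f zero) (sumF-nonneg (h ∘ suc)))
term≤sumF {f = f} h (suc i) = ℚP.≤-trans (term≤sumF (h ∘ suc) i) (subst (_≤ sumF f) (ℚP.+-identityˡ (sumF (f ∘ suc))) (ℚP.+-monoˡ-≤ (sumF (f ∘ suc)) (h zero)))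

lookup-Fits : ∀ {k} (κ : Vec Kind k) (w : Vec ℚ k) → (∀ i → In (lookup κ i) (lookup w i)) → Fits κ w
lookup-Fits [] [] h = tt
lookup-Fits (κ ∷ κs) (w ∷ ws) h = h zero , lookup-Fits κs ws (h ∘ suc)

Fits₁⇒bits≤ : ∀ {k} (β : Vec Bool k) (w : Vec ℚ k) → Fits (Vec.map kind₁ β) w → ∀ i → bits β i ≤ lookup w i
Fits₁⇒bits≤ (false ∷ β) (w ∷ ws) (i , fit) zero = i
Fits₁⇒bits≤ (true ∷ β) (w ∷ ws) (i , fit) zero = i
Fits₁⇒bits≤ (_ ∷ β) (w ∷ ws) (i , fit) (suc j) = Fits₁⇒bits≤ β ws fit j

bits≤⇒Fits₁ : ∀ {k} (β : Vec Bool k) (w : Vec ℚ k) → (∀ i → bits β i ≤ lookup w i) → Fits (Vec.map kind₁ β) w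
bits≤⇒Fits₁ [] [] h = tt
bits≤⇒Fits₁ (false ∷ β) (w ∷ ws) h = h zero , bits≤⇒Fits₁ β ws (h ∘ suc)
bits≤⇒Fits₁ (true ∷ β) (w ∷ ws) h = h zero , bits≤⇒Fits₁ β ws (h ∘ suc)

bits-nonneg : ∀ {k} (β : Vec Bool k) i → 0ℚ ≤ bits β i
bits-nonneg (false ∷ β) zero = ℚP.≤-refl
bits-nonneg (true ∷ β) zero = 0≤1
bits-nonneg (_ ∷ β) (suc i) = bits-nonneg β i

-- Keeps the entries marked `false`. Under `kind₂` the mark `true` fixes a weight `w` to 1, so
-- `1 - w` vanishes there; the kept generators are those that may carry weight after this
-- substitution.
select : ∀ {A : Set} {k} → (Fin k → A) → Vec Bool k → List A
select h [] = []
select h (false ∷ β) = h zero ∷ select (h ∘ suc) β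
select h (true ∷ β) = select (h ∘ suc) β

select-⊆ : ∀ {A : Set} {k} (h : Fin k → A) β {v} → v ∈ select h β → ∃ λ i → v ≡ h i
select-⊆ h (false ∷ β) (here refl) = zero , refl
select-⊆ h (false ∷ β) (there m) = let i , e = select-⊆ (h ∘ suc) β m in suc i , e
select-⊆ h (true ∷ β) m = let i , e = select-⊆ (h ∘ suc) β m in suc i , e

Fits₂⇒select : ∀ {A : Set} {k} (h : Fin k → A) (β : Vec Bool k) (w : Vec ℚ k) → Fits (Vec.map kind₂ β) w →
  ∀ i → lookup w i ≤ 1ℚ × (h i ∈ select h β ⊎ lookup w i ≡ 1ℚ)
Fits₂⇒select h (false ∷ β) (w ∷ ws) (i , fit) zero = proj₂ i , inj₁ (here refl)
Fits₂⇒select h (true ∷ β) (w ∷ ws) (i , fit) zero = ℚP.≤-reflexive i , inj₂ i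
Fits₂⇒select h (false ∷ β) (w ∷ ws) (i , fit) (suc j) = let l , s = Fits₂⇒select (h ∘ suc) β ws fit j in l , ⊎-map there (λ x → x) s
Fits₂⇒select h (true ∷ β) (w ∷ ws) (i , fit) (suc j) = Fits₂⇒select (h ∘ suc) β ws fit j

-- `E` collects the entries marked `false`, while `altℤ` takes its sign from those marked `true`;
-- the two signs differ by `(-1)^k`.
sum-splits-select : ∀ {A : Set} k (h : Fin k → A) (φ : List A → ℤ) →
  sumL (λ (E , S) → sgn E ℤ.* φ E) (splits (List.tabulate h)) ≡ signℤ k ℤ.* altℤ k (λ β → φ (select h β))
sum-splits-select zero h φ = ℤP.+-identityʳ _
sum-splits-select (suc k) h φ = begin
  sumL (λ (E , S) → sgn E ℤ.* φ E) (splits (h zero ∷ V))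
    ≡⟨ sum-splits-∷ (λ (E , S) → sgn E ℤ.* φ E) (h zero) V ⟩
  sumL (λ (E , S) → ℤ.- sgn E ℤ.* φ (h zero ∷ E)) (splits V) ℤ.+ sumL (λ (E , S) → sgn E ℤ.* φ E) (splits V)
    ≡⟨ cong₂ ℤ._+_ (trans (sumL-cong (splits V) (λ {(E , S)} _ → sym (ℤP.neg-distribˡ-* (sgn E) (φ (h zero ∷ E)))))
         (trans (sumL-neg (λ (E , S) → sgn E ℤ.* φ (h zero ∷ E)) (splits V)) (cong ℤ.-_ (sum-splits-select k (h ∘ suc) (λ E → φ (h zero ∷ E))))))
         (sum-splits-select k (h ∘ suc) φ) ⟩
  ℤ.- (signℤ k ℤ.* a) ℤ.+ signℤ k ℤ.* b
    ≡⟨ lem (signℤ k) a b ⟩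
  ℤ.- signℤ k ℤ.* (a ℤ.- b) ∎
  where
  open ≡-Reasoning
  V = List.tabulate (h ∘ suc)
  a = altℤ k (λ β → φ (h zero ∷ select (h ∘ suc) β))
  b = altℤ k (λ β → φ (select (h ∘ suc) β))
  lem : ∀ s a b → ℤ.- (s ℤ.* a) ℤ.+ s ℤ.* b ≡ ℤ.- s ℤ.* (a ℤ.- b)
  lem = ℤ-solve-∀

-- Nonnegative combinations in which, unlike in InHull, repeated vectors have separate coefficients.
ListCone : ∀ {n} → List (Pt n) → Pt n → Set
ListCone [] z = z ≡ 0ᵥ
ListCone (e ∷ E) z = ∃₂ λ u z′ → 0ℚ ≤ u × ListCone E z′ × z ≡ (u • e) ⊕ z′

ListCone-0 : ∀ {n} (E : List (Pt n)) → ListCone E 0ᵥ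
ListCone-0 [] = refl
ListCone-0 (e ∷ E) = 0ℚ , 0ᵥ , ℚP.≤-refl , ListCone-0 E , sym (trans (cong (_⊕ 0ᵥ) (•-zeroˡ e)) (⊕-identityʳ 0ᵥ))

ListCone-⊕ : ∀ {n} (E : List (Pt n)) {x y} → ListCone E x → ListCone E y → ListCone E (x ⊕ y)
ListCone-⊕ [] refl refl = ⊕-identityʳ 0ᵥ
ListCone-⊕ (e ∷ E) (u , x , u≥0 , cx , refl) (v , y , v≥0 , cy , refl) = u + v , x ⊕ y , nonneg+nonneg u≥0 v≥0 , ListCone-⊕ E cx cy ,
  trans (⊕-interchange (u • e) x (v • e) y) (cong (_⊕ (x ⊕ y)) (sym (•-distribʳ u v e)))

ListCone-• : ∀ {n} (E : List (Pt n)) {a x} → 0ℚ ≤ a → ListCone E x → ListCone E (a • x)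
ListCone-• [] {a} _ refl = •-zeroʳ a
ListCone-• (e ∷ E) {a} a≥0 (u , x , u≥0 , cx , refl) = a * u , a • x , nonneg*nonneg a≥0 u≥0 , ListCone-• E a≥0 cx ,
  trans (•-distribˡ a (u • e) x) (cong (_⊕ (a • x)) (sym (•-assoc a u e)))

∈⇒ListCone : ∀ {n} {E : List (Pt n)} {e} → e ∈ E → ListCone E e
∈⇒ListCone {E = e ∷ E} (here refl) = 1ℚ , 0ᵥ , 0≤1 , ListCone-0 E , sym (trans (⊕-identityʳ (1ℚ • e)) (•-identity e))
∈⇒ListCone {E = e ∷ E} {x} (there m) = 0ℚ , x , ℚP.≤-refl , ∈⇒ListCone m , sym (trans (cong (_⊕ x) (•-zeroˡ e)) (⊕-identityˡ x))

combo⇒ListCone : ∀ {n l} (E : List (Pt n)) (w : Fin l → ℚ) (p : Fin l → Pt n) → (∀ i → 0ℚ ≤ w i) → (∀ i → p i ∈ E ⊎ w i ≡ 0ℚ) → ListCone E (combo w p)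
combo⇒ListCone {l = zero} E w p w≥0 h = ListCone-0 E
combo⇒ListCone {l = suc l} E w p w≥0 h = ListCone-⊕ E (term (h zero)) (combo⇒ListCone E (w ∘ suc) (p ∘ suc) (w≥0 ∘ suc) (h ∘ suc))
  where
  term : p zero ∈ E ⊎ w zero ≡ 0ℚ → ListCone E (w zero • p zero)
  term (inj₁ m) = ListCone-• E (w≥0 zero) (∈⇒ListCone m)
  term (inj₂ z) = subst (ListCone E) (sym (trans (cong (_• p zero) z) (•-zeroˡ (p zero)))) (ListCone-0 E)

ListCone-select : ∀ {n k} (h : Fin k → Pt n) (β : Vec Bool k) {z} → ListCone (select h β) z →
  ∃ λ (u : Fin k → ℚ) → (∀ i → 0ℚ ≤ u i) × (∀ i → lookup β i ≡ false ⊎ u i ≡ 0ℚ) × combo u h ≡ z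
ListCone-select h [] refl = (λ ()) , (λ ()) , (λ ()) , refl
ListCone-select h (false ∷ β) (u , z′ , u≥0 , c , refl) with ListCone-select (h ∘ suc) β c
... | v , v≥0 , sv , refl = consF u v , (λ { zero → u≥0 ; (suc i) → v≥0 i }) , (λ { zero → inj₁ refl ; (suc i) → sv i }) , refl
ListCone-select h (true ∷ β) c with ListCone-select (h ∘ suc) β c
... | v , v≥0 , sv , refl = consF 0ℚ v , (λ { zero → ℚP.≤-refl ; (suc i) → v≥0 i }) , (λ { zero → inj₂ refl ; (suc i) → sv i }) ,
      trans (cong (_⊕ combo v (h ∘ suc)) (•-zeroˡ (h zero))) (⊕-identityˡ _)

module Fibre {d} (P Q : LatticePolytope d) where

  K = k P

  G : Fin K → Pt d
  G i = embed (gen P i)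

  -- Weights on the generators of P exhibiting x as a point of mP + Q, when they are nonnegative.
  Weights : ℕ → Pt d → (Fin K → ℚ) → Set
  Weights m x w = sumF w ≡ ℕtoℚ m × ∃ λ q → q ∈P Q × combo w G ⊕ q ≡ x

  C : ℕ → Pt d → Vec ℚ K → Set
  C m x w = Weights m x (lookup w)

  C-convex : ∀ m x → Convex (C m x)
  C-convex m x {w} {v} {a} {b} a≥0 b≥0 a+b≡1 (sw , q , q∈ , ew) (sv , r , r∈ , ev) =
    trans (sumF-cong pointwise) (trans (sumF-+ (λ i → a * lookup w i) (λ i → b * lookup v i))
      (trans (cong₂ _+_ (trans (sumF-* a (lookup w)) (cong (a *_) sw)) (trans (sumF-* b (lookup v)) (cong (b *_) sv)))
        (trans (sym (ℚP.*-distribʳ-+ (ℕtoℚ m) a b)) (trans (cong (_* ℕtoℚ m) a+b≡1) (ℚP.*-identityˡ (ℕtoℚ m)))))) ,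
    (a • q) ⊕ (b • r) , ∈P-convex Q q∈ r∈ a≥0 b≥0 a+b≡1 ,
    trans (cong (_⊕ ((a • q) ⊕ (b • r))) (trans (combo-congˡ G pointwise) (trans (combo-+ (λ i → a * lookup w i) (λ i → b * lookup v i) G)
        (cong₂ _⊕_ (combo-* a (lookup w) G) (combo-* b (lookup v) G)))))
      (trans (⊕-interchange (a • combo (lookup w) G) (b • combo (lookup v) G) (a • q) (b • r))
        (trans (cong₂ _⊕_ (trans (sym (•-distribˡ a (combo (lookup w) G) q)) (cong (a •_) ew)) (trans (sym (•-distribˡ b (combo (lookup v) G) r)) (cong (b •_) ev)))
          (trans (sym (•-distribʳ a b x)) (trans (cong (_• x) a+b≡1) (•-identity x)))))
    where
    pointwise : ∀ i → lookup ((a • w) ⊕ (b • v)) i ≡ a * lookup w i + b * lookup v i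
    pointwise i = trans (lookup-⊕ (a • w) (b • v) i) (cong₂ _+_ (lookup-• a w i) (lookup-• b v i))

  C-tabulate : ∀ m x w → Weights m x w → C m x (Vec.tabulate w)
  C-tabulate m x w (s , q , q∈ , e) = trans (sumF-cong (VecP.lookup∘tabulate w)) s , q , q∈ ,
    trans (cong (_⊕ q) (combo-congˡ G (VecP.lookup∘tabulate w))) e

  Mink⇒Weights : ∀ m {z} → Mink m 1 P Q z → ∃ λ w → (∀ i → 0ℚ ≤ w i) × Weights m z w
  Mink⇒Weights m (a , b , (u , u≥0 , Σu , e) , b∈ , refl) = (λ i → ℕtoℚ m * u i) , (λ i → nonneg*nonneg (ℕtoℚ-nonneg m) (u≥0 i)) ,
    trans (sumF-* (ℕtoℚ m) u) (trans (cong (ℕtoℚ m *_) Σu) (ℚP.*-identityʳ (ℕtoℚ m))) , b , b∈ ,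
    cong₂ _⊕_ (trans (combo-* (ℕtoℚ m) u G) (cong (ℕtoℚ m •_) e)) (sym (•-identity b))

  normalize-weights : ∀ {t} → 0ℚ < t → ∀ w → (∀ i → 0ℚ ≤ w i) → sumF w ≡ t → ∃ λ a → a ∈P P × combo w G ≡ t • a
  normalize-weights {t} t>0 w w≥0 s =
    let r , r>0 , rt = pos-recip t>0 in r • combo w G ,
    ((λ i → r * w i) , (λ i → nonneg*nonneg (ℚP.<⇒≤ r>0) (w≥0 i)) , trans (sumF-* r w) (trans (cong (r *_) s) rt) , combo-* r w G) ,
    sym (trans (sym (•-assoc t r (combo w G))) (trans (cong (_• combo w G) (trans (ℚP.*-comm t r) rt)) (•-identity (combo w G))))

  Weights⇒Mink : NonEmpty P → ∀ m {z} w → (∀ i → 0ℚ ≤ w i) → Weights m z w → Mink m 1 P Q z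
  -- Weights with sum 0 cannot be normalized to a point of `P`; any point of `P`, multiplied by 0,
  -- does instead.
  Weights⇒Mink (a , a∈) zero w w≥0 (s , q , q∈ , e) = a , q , a∈ , q∈ , trans (sym e)
    (cong₂ _⊕_ (trans (combo-congˡ G (sumF-nonneg≡0 w≥0 s)) (trans (combo-0 G) (sym (•-zeroˡ a)))) (sym (•-identity q)))
  Weights⇒Mink _ (suc m) w w≥0 (s , q , q∈ , e) =
    let a , a∈ , c = normalize-weights (ℕtoℚ-suc-pos m) w w≥0 s in
    a , q , a∈ , q∈ , trans (sym e) (cong₂ _⊕_ c (sym (•-identity q)))

  #true≤m : ∀ {m x} β → Sol (Vec.map kind₁ β) (C m x) → #true β ℕ.≤ m
  #true≤m {m} β (w , fit , s , _) = ℕP.≮⇒≥ λ lt → ℚP.<-irrefl refl (ℚP.<-≤-trans (ℕtoℚ-mono-< lt)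
    (subst₂ _≤_ (sumF-bits β) s (sumF-mono (Fits₁⇒bits≤ β w fit))))

  -- One unit of weight is taken from every generator marked by `β`. This translates the point by
  -- `shiftᶻ` and lowers the total weight by `#true β`; the remaining weights are nonnegative
  -- exactly because of the constraints `w ≥ 1`.
  Sol₁⇒Mink : NonEmpty P → ∀ j β y → Sol (Vec.map kind₁ β) (C (#true β ℕ.+ j) (embed (y +ᶻ shiftᶻ (gen P) β))) → Mink j 1 P Q (embed y)
  Sol₁⇒Mink ne j β y (w , fit , s , q , q∈ , e) = Weights⇒Mink ne j u (λ i → ≤⇒0≤- (Fits₁⇒bits≤ β w fit i))
    ( +-cancelˡ (ℕtoℚ (#true β)) (begin
        ℕtoℚ (#true β) + sumF u ≡⟨ cong (_+ sumF u) (sym (sumF-bits β)) ⟩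
        sumF (bits β) + sumF u ≡⟨ sym (sumF-+ (bits β) u) ⟩
        sumF (λ i → bits β i + u i) ≡⟨ sumF-cong restore ⟩
        sumF (lookup w) ≡⟨ trans s (ℕtoℚ-+ (#true β) j) ⟩
        ℕtoℚ (#true β) + ℕtoℚ j ∎)
    , q , q∈ , ⊕-cancelˡ (embed σ) (begin
        embed σ ⊕ (combo u G ⊕ q) ≡⟨ sym (⊕-assoc (embed σ) (combo u G) q) ⟩
        (embed σ ⊕ combo u G) ⊕ q ≡⟨ cong (λ z → (z ⊕ combo u G) ⊕ q) (sym (combo-bits (gen P) β)) ⟩
        (combo (bits β) G ⊕ combo u G) ⊕ q ≡⟨ cong (_⊕ q) (trans (sym (combo-+ (bits β) u G)) (combo-congˡ G restore)) ⟩
        combo (lookup w) G ⊕ q ≡⟨ e ⟩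
        embed (y +ᶻ σ) ≡⟨ trans (embed-+ y σ) (⊕-comm (embed y) (embed σ)) ⟩
        embed σ ⊕ embed y ∎))
    where
    open ≡-Reasoning
    σ = shiftᶻ (gen P) β
    u : Fin K → ℚ
    u i = lookup w i - bits β i
    restore : ∀ i → bits β i + u i ≡ lookup w i
    restore i = lem (bits β i) (lookup w i)
      where
      lem : ∀ b w → b + (w - b) ≡ w
      lem = solve-∀ ℚ-ring

  Mink⇒Sol₁ : ∀ j β y → Mink j 1 P Q (embed y) → Sol (Vec.map kind₁ β) (C (#true β ℕ.+ j) (embed (y +ᶻ shiftᶻ (gen P) β)))
  Mink⇒Sol₁ j β y mink with Mink⇒Weights j mink
  ... | u , u≥0 , s , q , q∈ , e = Vec.tabulate w ,
      bits≤⇒Fits₁ β (Vec.tabulate w) (λ i → subst (bits β i ≤_) (sym (VecP.lookup∘tabulate w i)) (subst (_≤ w i) (ℚP.+-identityʳ (bits β i)) (ℚP.+-monoʳ-≤ (bits β i) (u≥0 i)))) ,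
      C-tabulate (#true β ℕ.+ j) (embed (y +ᶻ σ)) w ( trans (sumF-+ (bits β) u) (trans (cong₂ _+_ (sumF-bits β) s) (sym (ℕtoℚ-+ (#true β) j)))
                 , q , q∈ , (begin
        combo w G ⊕ q ≡⟨ cong (_⊕ q) (trans (combo-+ (bits β) u G) (cong (_⊕ combo u G) (combo-bits (gen P) β))) ⟩
        (embed σ ⊕ combo u G) ⊕ q ≡⟨ ⊕-assoc (embed σ) (combo u G) q ⟩
        embed σ ⊕ (combo u G ⊕ q) ≡⟨ cong (embed σ ⊕_) e ⟩
        embed σ ⊕ embed y ≡⟨ trans (⊕-comm (embed σ) (embed y)) (sym (embed-+ y σ)) ⟩
        embed (y +ᶻ σ) ∎))
    where
    open ≡-Reasoning
    σ = shiftᶻ (gen P) β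
    w : Fin K → ℚ
    w i = bits β i + u i

  Sol₁⇒Weights : ∀ {m x} β → Sol (Vec.map kind₁ β) (C m x) → ∃ λ w → (∀ i → 0ℚ ≤ w i) × Weights m x w
  Sol₁⇒Weights β (w , fit , c) = lookup w , (λ i → ℚP.≤-trans (bits-nonneg β i) (Fits₁⇒bits≤ β w fit i)) , c

  Sol₂-bound : ∀ {m x} β → Sol (Vec.map kind₂ β) (C m x) → m ℕ.≤ K
  Sol₂-bound {m} β (w , fit , s , _) = ℕP.≮⇒≥ λ lt → ℚP.<-irrefl refl (ℚP.<-≤-trans (ℕtoℚ-mono-< lt)
    (subst₂ _≤_ s (sumF-1 K) (sumF-mono (λ i → proj₁ (Fits₂⇒select (λ i → i) β w fit i)))))

  total : LPt d
  total = shiftᶻ (gen P) (Vec.replicate K true)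

  combo-1 : combo (λ _ → 1ℚ) G ≡ embed total
  combo-1 = trans (combo-congˡ G (sym ∘ bits-all)) (combo-bits (gen P) (Vec.replicate K true))

  complement : (Fin K → ℚ) → Fin K → ℚ
  complement w i = 1ℚ - w i

  w+complement : ∀ w i → w i + complement w i ≡ 1ℚ
  w+complement w i = lem (w i)
    where
    lem : ∀ a → a + (1ℚ - a) ≡ 1ℚ
    lem = solve-∀ ℚ-ring

  sum-complement : ∀ w → sumF w + sumF (complement w) ≡ ℕtoℚ K
  sum-complement w = trans (sym (sumF-+ w (complement w))) (trans (sumF-cong (w+complement w)) (sumF-1 K))

  combo-complement : ∀ w → combo w G ⊕ combo (complement w) G ≡ embed total
  combo-complement w = trans (sym (combo-+ w (complement w) G)) (trans (combo-congˡ G (w+complement w)) combo-1)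

  combo-translate : ∀ p u → sumF u ≡ 1ℚ → combo u (λ i → embed (gen (translate P p) i)) ≡ combo u G ⊕ embed p
  combo-translate p u Σu = trans (combo-congʳ u (λ i → embed-+ (gen P i) p)) (trans (combo-⊕ u G (embed p))
    (cong (combo u G ⊕_) (trans (cong (_• embed p) Σu) (•-identity (embed p)))))

  balance : ∀ p (a b q : Pt d) → a ⊕ b ≡ embed total → (a ⊕ q ≡ embed (p +ᶻ total) → b ⊕ embed p ≡ q) × (b ⊕ embed p ≡ q → a ⊕ q ≡ embed (p +ᶻ total))
  balance p a b q ab = (λ e → ⊕-cancelˡ a (trans same (sym e))) , (λ e → trans (cong (a ⊕_) (sym e)) same)
    where
    same : a ⊕ (b ⊕ embed p) ≡ embed (p +ᶻ total)
    same = trans (sym (⊕-assoc a b (embed p))) (trans (cong (_⊕ embed p) ab) (trans (⊕-comm (embed total) (embed p)) (sym (embed-+ p total))))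

  module _ {k′} (K≡ : K ≡ suc k′) (p : LPt d) (β : Vec Bool K) where

    P+p = translate P p
    E = select (homGen P+p) β

    -- The substitution u = 1 - w.
    Sol₂⇒¬Feas : Sol (Vec.map kind₂ β) (C k′ (embed (p +ᶻ total))) → ¬ Feas [] (E ++ avoid Q)
    Sol₂⇒¬Feas (w , fit , s , q , q∈ , e) = meets⇒¬Feas P+p Q {E} {q}
      (u , (λ i → ≤⇒0≤- (proj₁ (Fits₂⇒select (homGen P+p) β w fit i))) , Σu ,
        (λ i → ⊎-map (λ m → m) (λ z → trans (cong (λ z → 1ℚ - z) z) (ℚP.+-inverseʳ 1ℚ)) (proj₂ (Fits₂⇒select (homGen P+p) β w fit i))) ,
        trans (combo-translate p u Σu) (proj₁ (balance p (combo (lookup w) G) (combo u G) q (combo-complement (lookup w))) e)) q∈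
      where
      u = complement (lookup w)
      -- `K - (K - 1) = 1`: total weight `k′` is the one whose complement is a convex combination.
      Σu : sumF u ≡ 1ℚ
      Σu = +-cancelˡ (ℕtoℚ k′) (trans (cong (_+ sumF u) (sym s)) (trans (sum-complement (lookup w)) (trans (cong ℕtoℚ K≡) (trans (ℕtoℚ-+ 1 k′) (ℚP.+-comm 1ℚ (ℕtoℚ k′))))))

    -- `InHull` lets a generator marked `true` carry weight if an equal one is selected. The
    -- constraint `w = 1` needs complementary weight 0 at that very index, so the point is first
    -- rewritten with coefficients on the entries of the list `E`.
    ¬Feas⇒Sol₂ : ¬ Feas [] (E ++ avoid Q) → Sol (Vec.map kind₂ β) (C k′ (embed (p +ᶻ total)))
    ¬Feas⇒Sol₂ ¬f with ¬Feas⇒meets P+p Q {E} (λ m → let i , e = select-⊆ (homGen P+p) β m in subst (_∈ homGens P+p) (sym e) (∈-tabulate⁺ i)) ¬f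
    ... | q , hull , q∈ with InHull⇒HomCone P+p hull
    ...   | v , v≥0 , sv , v-hom with ListCone-select (homGen P+p) β (subst (ListCone E) v-hom (combo⇒ListCone E v (homGen P+p) v≥0 sv))
    ...     | u , u≥0 , su , u-hom = Vec.tabulate w , fits , C-tabulate k′ (embed (p +ᶻ total)) w (Σw , q , q∈ , proj₂ (balance p (combo w G) (combo u G) q w⊕u) u-combo)
      where
      e′ : sumF u ∷ combo u (λ i → embed (gen P+p i)) ≡ hom q
      e′ = trans (sym (combo-homGen P+p u)) u-hom
      Σu : sumF u ≡ 1ℚ
      Σu = cong Vec.head e′
      u-combo : combo u G ⊕ embed p ≡ q
      u-combo = trans (sym (combo-translate p u Σu)) (cong Vec.tail e′)
      w = complement u
      w⊕u : combo w G ⊕ combo u G ≡ embed total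
      w⊕u = trans (⊕-comm (combo w G) (combo u G)) (combo-complement u)
      Σw : sumF w ≡ ℕtoℚ k′
      Σw = +-cancelˡ 1ℚ (trans (cong (_+ sumF w) (sym Σu)) (trans (sum-complement u) (trans (cong ℕtoℚ K≡) (ℕtoℚ-+ 1 k′))))
      in-range : ∀ i b → b ≡ false ⊎ u i ≡ 0ℚ → In (kind₂ b) (w i)
      in-range i false _ = ≤⇒0≤- (subst (u i ≤_) Σu (term≤sumF u≥0 i)) , 0≤-⇒≤ (subst (0ℚ ≤_) (lem (u i)) (u≥0 i))
        where
        lem : ∀ a → a ≡ 1ℚ - (1ℚ - a)
        lem = solve-∀ ℚ-ring
      in-range i true (inj₂ z) = cong (λ z → 1ℚ - z) z
      fits : Fits (Vec.map kind₂ β) (Vec.tabulate w)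
      fits = lookup-Fits (Vec.map kind₂ β) (Vec.tabulate w) (λ i →
        subst₂ In (sym (VecP.lookup-map i kind₂ β)) (sym (VecP.lookup∘tabulate w i)) (in-range i (lookup β i) (su i)))

-- Reciprocity

_≟ᶻ_ : ∀ {d} (x y : LPt d) → Dec (x ≡ y)
_≟ᶻ_ = VecP.≡-dec ℤ._≟_

_∈ᶻ?_ : ∀ {d} (x : LPt d) L → Dec (x ∈ L)
x ∈ᶻ? L = Any.any? (x ≟ᶻ_) L

sum-delta : ∀ {d} (L : List (LPt d)) → Unique L → ∀ {y} → y ∈ L → sumL (λ x → ind (x ≟ᶻ y)) L ≡ ℤ.1ℤ
sum-delta (x ∷ L) (x∉ ∷ u) {y} (here refl) = cong₂ ℤ._+_ (ind-yes (x ≟ᶻ x) refl)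
  (sumL-0 L (λ {z} m → ind-no (z ≟ᶻ x) (λ e → All.lookup x∉ m (sym e))))
sum-delta (x ∷ L) (x∉ ∷ u) {y} (there m) = cong₂ ℤ._+_ (ind-no (x ≟ᶻ y) (All.lookup x∉ m)) (sum-delta L u m)

count-members : ∀ {d} (L M : List (LPt d)) → Unique L → Unique M → (∀ {x} → x ∈ M → x ∈ L) →
  sumL (λ x → ind (x ∈ᶻ? M)) L ≡ ℤ.+ length M
count-members L [] uL uM sub = sumL-0 L (λ {x} _ → ind-no (x ∈ᶻ? []) λ ())
count-members L (y ∷ M) uL (y∉ ∷ uM) sub = trans
  (sumL-cong L (λ {x} _ → disjoint x))
  (trans (sumL-+ (λ x → ind (x ≟ᶻ y)) (λ x → ind (x ∈ᶻ? M)) L) (cong₂ ℤ._+_ (sum-delta L uL (sub (here refl))) (count-members L M uL uM (sub ∘ there))))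
  where
  disjoint : ∀ x → ind (x ∈ᶻ? (y ∷ M)) ≡ ind (x ≟ᶻ y) ℤ.+ ind (x ∈ᶻ? M)
  disjoint x = cases (x ≟ᶻ y) (x ∈ᶻ? M)
    where
    cases : (a : Dec (x ≡ y)) (b : Dec (x ∈ M)) → ind (x ∈ᶻ? (y ∷ M)) ≡ ind a ℤ.+ ind b
    cases (yes refl) (yes m) = ⊥-elim (All.lookup y∉ m refl)
    cases (yes refl) (no _) = ind-yes (x ∈ᶻ? (y ∷ M)) (here refl)
    cases (no _) (yes m) = ind-yes (x ∈ᶻ? (y ∷ M)) (there m)
    cases (no x≢y) (no x∉M) = ind-no (x ∈ᶻ? (y ∷ M)) λ { (here e) → x≢y e ; (there m) → x∉M m }

#true-replicate : ∀ k → #true (Vec.replicate k true) ≡ k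
#true-replicate zero = refl
#true-replicate (suc k) = cong suc (#true-replicate k)

signℤ-cases : ∀ k → signℤ k ≡ ℤ.1ℤ ⊎ signℤ k ≡ ℤ.-1ℤ
signℤ-cases zero = inj₁ refl
signℤ-cases (suc k) with signℤ-cases k
... | inj₁ e = inj₂ (cong ℤ.-_ e)
... | inj₂ e = inj₁ (cong ℤ.-_ e)

signℤ-cancel : ∀ k {z} → signℤ k ℤ.* z ≡ ℤ.0ℤ → z ≡ ℤ.0ℤ
signℤ-cancel k {z} e with signℤ k | signℤ-cases k
... | _ | inj₁ refl = trans (sym (ℤP.*-identityˡ z)) e
... | _ | inj₂ refl = trans (lem z) (cong ℤ.-_ e)
  where
  lem : ∀ z → z ≡ ℤ.- (ℤ.-1ℤ ℤ.* z)
  lem = ℤ-solve-∀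

signℤ-solve : ∀ k s y → ℤtoℚ (signℤ k ℤ.* s) + signℚ k * y ≡ 0ℚ → y ≡ ℤtoℚ (ℤ.- s)
signℤ-solve k s y e with signℤ k | signℤ-cases k
... | _ | inj₁ refl = trans (lem (ℤtoℚ s) y) (trans (cong (λ z → z - ℤtoℚ s) (trans (cong (λ z → ℤtoℚ z + 1ℚ * y) (sym (ℤP.*-identityˡ s))) e))
      (trans (ℚP.+-identityˡ (- ℤtoℚ s)) (sym (ℤtoℚ-neg s))))
  where
  lem : ∀ a y → y ≡ (a + 1ℚ * y) - a
  lem = solve-∀ ℚ-ring
... | _ | inj₂ refl = trans (lem (ℤtoℚ (ℤ.- s)) y) (trans (cong (λ z → ℤtoℚ (ℤ.- s) - z) (trans (cong (λ z → ℤtoℚ z + - 1ℚ * y) (sym (ℤP.-1*i≡-i s))) e)) (a-0≡a (ℤtoℚ (ℤ.- s))))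
  where
  lem : ∀ a y → y ≡ a - (a + - 1ℚ * y)
  lem = solve-∀ ℚ-ring

module Reciprocity {d} (P Q : LatticePolytope d) (nonEmpty : NonEmpty P) {k′} (K≡ : k P ≡ suc k′)
  (poly : Poly2) (ehrhart : IsEhrhartPoly P Q poly) where

  open Fibre P Q

  points : ℕ → List (LPt d)
  points m = proj₁ (proj₁ (proj₂ (ehrhart m 1)))

  points-unique : ∀ m → Unique (points m)
  points-unique m = proj₁ (proj₂ (proj₁ (proj₂ (ehrhart m 1))))

  points⇒Mink : ∀ {m x} → x ∈ points m → Mink m 1 P Q (embed x)
  points⇒Mink {m} = All.lookup (proj₁ (proj₂ (proj₂ (proj₁ (proj₂ (ehrhart m 1))))))

  Mink⇒points : ∀ {m x} → Mink m 1 P Q (embed x) → x ∈ points m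
  Mink⇒points {m} {x} = proj₁ (proj₂ (proj₂ (proj₂ (proj₁ (proj₂ (ehrhart m 1)))))) x

  e : ℚ → ℚ
  e x = eval2 poly x 1ℚ

  e-counts : ∀ m → e (ℕtoℚ m) ≡ ℤtoℚ (ℤ.+ length (points m))
  e-counts m = trans (proj₂ (proj₂ (ehrhart m 1))) (cong ℕtoℚ (sym (proj₂ (proj₂ (proj₂ (proj₂ (proj₁ (proj₂ (ehrhart m 1)))))))))

  shifted : ℕ → Vec Bool K → List (LPt d)
  shifted m β = List.map (_+ᶻ shiftᶻ (gen P) β) (points (m ℕ.∸ #true β))

  -- The bound guards against truncated subtraction: without it, a `β` with `#true β` above `m`
  -- would be credited with the points of `0 P + Q` instead of none.
  Member : ℕ → LPt d → Vec Bool K → Set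
  Member m x β = #true β ℕ.≤ m × x ∈ shifted m β

  Member? : ∀ m x β → Dec (Member m x β)
  Member? m x β = (#true β ℕ.≤? m) ×-dec (x ∈ᶻ? shifted m β)

  F : ℕ → LPt d → Vec Bool K → ℤ
  F m x β = ind (Member? m x β)

  Member⇒Sol : ∀ m x β → Member m x β → Sol (Vec.map kind₁ β) (C m (embed x))
  Member⇒Sol m x β (#≤m , x∈) with ∈-map⁻ (_+ᶻ shiftᶻ (gen P) β) x∈
  ... | y , y∈ , refl = subst (λ n → Sol (Vec.map kind₁ β) (C n (embed x))) (ℕP.m+[n∸m]≡n #≤m) (Mink⇒Sol₁ (m ℕ.∸ #true β) β y (points⇒Mink y∈))

  Sol⇒Member : ∀ m x β → Sol (Vec.map kind₁ β) (C m (embed x)) → Member m x β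
  Sol⇒Member m x β s = #≤m , subst (_∈ shifted m β) x≡ (∈-map⁺ (_+ᶻ σ) (Mink⇒points (Sol₁⇒Mink nonEmpty (m ℕ.∸ #true β) β y
      (subst₂ (λ n z → Sol (Vec.map kind₁ β) (C n (embed z))) (sym (ℕP.m+[n∸m]≡n #≤m)) (sym x≡) s))))
    where
    σ = shiftᶻ (gen P) β
    y = x +ᶻ negᶻ σ
    #≤m = #true≤m β s
    x≡ : y +ᶻ σ ≡ x
    x≡ = +ᶻ-cancelʳ′ x σ

  F-indicates : ∀ m x β → IsInd (Sol (Vec.map kind₁ β) (C m (embed x))) (F m x β)
  F-indicates m x β = IsInd-map (Member⇒Sol m x β) (Sol⇒Member m x β) (IsInd-ind (Member? m x β))

  Member⇒points : ∀ m x β → Member m x β → x ∈ points m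
  Member⇒points m x β mem = let w , w≥0 , h = Sol₁⇒Weights {m} {embed x} β (Member⇒Sol m x β mem) in Mink⇒points (Weights⇒Mink nonEmpty m w w≥0 h)

  -- All the shifted lists lie in `mP + Q`, so the count can be taken over `points m` for every `β`;
  -- this common range lets the alternating sum be exchanged with the sum over `x`.
  sum-F : ∀ m β → #true β ℕ.≤ m → sumL (λ x → F m x β) (points m) ≡ ℤ.+ length (points (m ℕ.∸ #true β))
  sum-F m β #≤m = trans
    (sumL-cong (points m) (λ {x} _ → ind-cong (Member? m x β) (x ∈ᶻ? shifted m β) proj₂ (#≤m ,_)))
    (trans (count-members (points m) (shifted m β) (points-unique m)
        (UniqueP.map⁺ (+ᶻ-injective (shiftᶻ (gen P) β)) (points-unique (m ℕ.∸ #true β)))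
        (λ {x} x∈ → Member⇒points m x β (#≤m , x∈)))
      (cong ℤ.+_ (length-map (_+ᶻ shiftᶻ (gen P) β) (points (m ℕ.∸ #true β)))))

  alt-F : ∀ m x → (f : Vec Kind K → ℤ) → (∀ κ → IsInd (Sol κ (C m (embed x))) (f κ)) → altℤ K (F m x) ≡ altℤ K (f ∘ Vec.map kind₂)
  alt-F m x f h = trans (alt-cong ℤ._-_ K (λ β → IsInd-unique (F-indicates m x β) (h (Vec.map kind₁ β))))
    (Law-alt K f (convex-Law K (C m (embed x)) (λ {w} {v} → C-convex m (embed x) {w} {v}) f h))

  with-indicators : ∀ m x {a b : ℤ} → (∀ (f : Vec Kind K → ℤ) → (∀ κ → IsInd (Sol κ (C m (embed x))) (f κ)) → a ≡ b) → a ≡ b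
  with-indicators m x {a} {b} h = decidable-stable (a ℤ.≟ b) λ a≢b → ¬¬-indicators (λ κ → Sol κ (C m (embed x))) λ (f , hf) → a≢b (h f hf)

  alt-large : ∀ m x → K ℕ.< m → altℤ K (F m x) ≡ ℤ.0ℤ
  alt-large m x K<m = with-indicators m x λ f h → trans (alt-F m x f h)
    (altℤ-0 K (λ β → IsInd-no (λ s → ℕP.<⇒≱ K<m (Sol₂-bound β s)) (h (Vec.map kind₂ β))))

  alternating : LPt d → ℤ
  alternating p = alternatingSum Q (translate P p)

  alternating≡ : ∀ p → alternating p ≡ signℤ K ℤ.* altℤ K (λ β → ind (Feas? [] (select (homGen (translate P p)) β ++ avoid Q)))
  alternating≡ p = sum-splits-select K (homGen (translate P p)) (λ E → ind (Feas? [] (E ++ avoid Q)))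

  alt-const≡0 : ∀ {k} → k ≡ suc k′ → altℤ k (λ _ → ℤ.1ℤ) ≡ ℤ.0ℤ
  alt-const≡0 refl = altℤ-const k′ ℤ.1ℤ

  -- After the exchange the summand says that the hull of the selected generators meets `Q`, so it
  -- is 1 minus the indicator of separation. The constant 1 alternates to 0 because there is at
  -- least one generator, and `signℤ K` squares to 1.
  alt-value : ∀ p → altℤ K (F k′ (p +ᶻ total)) ≡ signℤ K ℤ.* (ℤ.- alternating p)
  alt-value p = with-indicators k′ (p +ᶻ total) λ f h → begin
    altℤ K (F k′ (p +ᶻ total)) ≡⟨ alt-F k′ (p +ᶻ total) f h ⟩
    altℤ K (f ∘ Vec.map kind₂) ≡⟨ alt-cong ℤ._-_ K (λ β → IsInd-unique (h (Vec.map kind₂ β)) (feas-ind β)) ⟩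
    altℤ K (λ β → ℤ.1ℤ ℤ.- feas β) ≡⟨ altℤ-minus K (λ _ → ℤ.1ℤ) feas ⟩
    altℤ K (λ _ → ℤ.1ℤ) ℤ.- altℤ K feas ≡⟨ cong (ℤ._- altℤ K feas) (alt-const≡0 K≡) ⟩
    ℤ.0ℤ ℤ.- altℤ K feas ≡⟨ sign-lemma (altℤ K feas) ⟩
    signℤ K ℤ.* (ℤ.- (signℤ K ℤ.* altℤ K feas)) ≡⟨ cong (λ z → signℤ K ℤ.* (ℤ.- z)) (sym (alternating≡ p)) ⟩
    signℤ K ℤ.* (ℤ.- alternating p) ∎
    where
    open ≡-Reasoning
    feas : Vec Bool K → ℤ
    feas β = ind (Feas? [] (select (homGen (translate P p)) β ++ avoid Q))
    feas-ind : ∀ β → IsInd (Sol (Vec.map kind₂ β) (C k′ (embed (p +ᶻ total)))) (ℤ.1ℤ ℤ.- feas β)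
    feas-ind β = IsInd-¬ (Feas? [] (select (homGen (translate P p)) β ++ avoid Q)) (Sol₂⇒¬Feas K≡ p β) (¬Feas⇒Sol₂ K≡ p β)
    sign-lemma : ∀ a → ℤ.0ℤ ℤ.- a ≡ signℤ K ℤ.* (ℤ.- (signℤ K ℤ.* a))
    sign-lemma a with signℤ K | signℤ-cases K
    ... | _ | inj₁ refl = lem a
      where
      lem : ∀ a → ℤ.0ℤ ℤ.- a ≡ ℤ.1ℤ ℤ.* (ℤ.- (ℤ.1ℤ ℤ.* a))
      lem = ℤ-solve-∀
    ... | _ | inj₂ refl = lem a
      where
      lem : ∀ a → ℤ.0ℤ ℤ.- a ≡ ℤ.-1ℤ ℤ.* (ℤ.- (ℤ.-1ℤ ℤ.* a))
      lem = ℤ-solve-∀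

  term≡ : ∀ m β → #true β ℕ.≤ m → e (ℕtoℚ m - ℕtoℚ (#true β)) ≡ ℤtoℚ (sumL (λ x → F m x β) (points m))
  term≡ m β #≤m = begin
    e (ℕtoℚ m - ℕtoℚ (#true β)) ≡⟨ cong (λ n → e (ℕtoℚ n - ℕtoℚ (#true β))) (sym (ℕP.m+[n∸m]≡n #≤m)) ⟩
    e (ℕtoℚ (#true β ℕ.+ j) - ℕtoℚ (#true β)) ≡⟨ cong e (trans (cong (_- ℕtoℚ (#true β)) (ℕtoℚ-+ (#true β) j)) (a+b-a≡b (ℕtoℚ (#true β)) (ℕtoℚ j))) ⟩
    e (ℕtoℚ j) ≡⟨ e-counts j ⟩
    ℤtoℚ (ℤ.+ length (points j)) ≡⟨ cong ℤtoℚ (sym (sum-F m β #≤m)) ⟩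
    ℤtoℚ (sumL (λ x → F m x β) (points m)) ∎
    where
    open ≡-Reasoning
    j = m ℕ.∸ #true β

  alt-sum : ∀ m → altℚ K (λ β → ℤtoℚ (sumL (λ x → F m x β) (points m))) ≡ ℤtoℚ (sumL (λ x → altℤ K (F m x)) (points m))
  alt-sum m = trans (sym (ℤtoℚ-alt K (λ β → sumL (λ x → F m x β) (points m)))) (cong ℤtoℚ (sym (altℤ-sumL K (F m) (points m))))

  ∇^-large : ∀ m → K ℕ.< m → ∇^ K e (ℕtoℚ m) ≡ 0ℚ
  ∇^-large m K<m = begin
    ∇^ K e (ℕtoℚ m) ≡⟨ ∇^-alt K e (ℕtoℚ m) ⟩
    altℚ K (λ β → e (ℕtoℚ m - ℕtoℚ (#true β))) ≡⟨ alt-cong _-_ K (λ β → term≡ m β (ℕP.≤-trans (#true≤ β) (ℕP.<⇒≤ K<m))) ⟩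
    altℚ K (λ β → ℤtoℚ (sumL (λ x → F m x β) (points m))) ≡⟨ alt-sum m ⟩
    ℤtoℚ (sumL (λ x → altℤ K (F m x)) (points m)) ≡⟨ cong ℤtoℚ (sumL-0 (points m) (λ {x} _ → alt-large m x K<m)) ⟩
    0ℚ ∎
    where open ≡-Reasoning

  -- The counting argument is applied for `m > K` only, since at `m = K` the weights that are all 1
  -- survive the exchange. `Poly-extend` is then used twice, to reach `K` and next `K - 1 = k′`.
  ∇^-k′ : ∇^ K e (ℕtoℚ k′) ≡ 0ℚ
  ∇^-k′ = Poly-extend D {∇^ K e} p k′ λ j k′<j → case ℕP.m≤n⇒m<n∨m≡n k′<j of λ where
      (inj₁ lt) → ∇^-large j (subst (ℕ._< j) (sym K≡) lt)
      (inj₂ refl) → at-K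
    where
    D = proj₁ (Poly-eval poly 1ℚ)
    p : Poly D (∇^ K e)
    p = Poly-∇^ K D {e} (proj₂ (Poly-eval poly 1ℚ))
    at-K : ∇^ K e (ℕtoℚ (suc k′)) ≡ 0ℚ
    at-K = subst (λ n → ∇^ K e (ℕtoℚ n) ≡ 0ℚ) K≡ (Poly-extend D {∇^ K e} p K ∇^-large)

  translations : List (LPt d)
  translations = List.map (_+ᶻ negᶻ total) (points k′)

  s : ℤ
  s = sumL (λ p → ℤ.- alternating p) translations

  sum-alt : sumL (λ x → altℤ K (F k′ x)) (points k′) ≡ signℤ K ℤ.* s
  sum-alt = begin
    sumL (λ x → altℤ K (F k′ x)) (points k′)
      ≡⟨ sumL-cong (points k′) (λ {x} _ → trans (cong (λ z → altℤ K (F k′ z)) (sym (+ᶻ-cancelʳ′ x total))) (alt-value (x +ᶻ negᶻ total))) ⟩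
    sumL (λ x → signℤ K ℤ.* (ℤ.- alternating (x +ᶻ negᶻ total))) (points k′)
      ≡⟨ sumL-* (signℤ K) (λ x → ℤ.- alternating (x +ᶻ negᶻ total)) (points k′) ⟩
    signℤ K ℤ.* sumL (λ x → ℤ.- alternating (x +ᶻ negᶻ total)) (points k′)
      ≡⟨ cong (signℤ K ℤ.*_) (sym (sumL-map (λ p → ℤ.- alternating p) (_+ᶻ negᶻ total) (points k′))) ⟩
    signℤ K ℤ.* s ∎
    where open ≡-Reasoning

  all-true : Vec Bool K
  all-true = Vec.replicate K true

  -- Here `f` evaluates the polynomial and `g` counts points. They agree while `k′ - #true β` is a
  -- natural number; at `all-true` it is -1, where `f` gives `e(-1)` and `g` gives 0. As the whole
  -- difference vanishes, `e(-1)` balances the counted part.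
  reciprocity : e (- 1ℚ) ≡ ℤtoℚ (ℤ.- s)
  reciprocity = signℤ-solve K s (e (- 1ℚ)) (begin
    ℤtoℚ (signℤ K ℤ.* s) + signℚ K * e (- 1ℚ)
      ≡⟨ cong₂ _+_ (trans (cong ℤtoℚ (sym sum-alt)) (sym (alt-sum k′))) (cong (signℚ K *_) (sym difference)) ⟩
    altℚ K g + signℚ K * (f all-true - g all-true)
      ≡⟨ sym (altℚ-change K f g (λ β lt → term≡ k′ β (ℕP.≤-pred (subst (#true β ℕ.<_) K≡ lt)))) ⟩
    altℚ K f ≡⟨ sym (∇^-alt K e (ℕtoℚ k′)) ⟩
    ∇^ K e (ℕtoℚ k′) ≡⟨ ∇^-k′ ⟩
    0ℚ ∎)
    where
    open ≡-Reasoning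
    f g : Vec Bool K → ℚ
    f β = e (ℕtoℚ k′ - ℕtoℚ (#true β))
    g β = ℤtoℚ (sumL (λ x → F k′ x β) (points k′))
    #all-true : #true all-true ≡ suc k′
    #all-true = trans (#true-replicate K) K≡
    g≡0 : g all-true ≡ 0ℚ
    g≡0 = cong ℤtoℚ (sumL-0 (points k′) (λ {x} _ → ind-no (Member? k′ x all-true)
      (λ mem → ℕP.<-irrefl refl (subst (ℕ._≤ k′) #all-true (proj₁ mem)))))
    lem : ∀ a → a - (1ℚ + a) ≡ - 1ℚ
    lem = solve-∀ ℚ-ring
    difference : f all-true - g all-true ≡ e (- 1ℚ)
    difference = trans (cong₂ (λ a b → e a - b)
      (trans (cong (λ n → ℕtoℚ k′ - ℕtoℚ n) #all-true) (trans (cong (λ z → ℕtoℚ k′ - z) (ℕtoℚ-+ 1 k′)) (lem (ℕtoℚ k′)))) g≡0) (a-0≡a (e (- 1ℚ)))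

  -- Everything counted by `F k′` lies in `k′P + Q`. For `p` off the list all terms of the
  -- alternating sum are therefore 0, and `alt-value` identifies this sum with the summand up to
  -- sign.
  outside : ∀ p → p ∉ translations → ∀ z → RedEuler Q (translate P p) z → z ≡ ℤ.0ℤ
  outside p p∉ z red = trans (RedEuler-value Q (translate P p) red) (signℤ-cancel K (trans (sym (alt-value p)) (altℤ-0 K (λ β →
    ind-no (Member? k′ (p +ᶻ total) β) (λ mem → p∉ (subst (_∈ translations) (+ᶻ-cancelʳ p total)
      (∈-map⁺ (_+ᶻ negᶻ total) (Member⇒points k′ (p +ᶻ total) β mem))))))))

  translations-unique : Unique translations
  translations-unique = UniqueP.map⁺ (+ᶻ-injective (negᶻ total)) (points-unique k′)

-- The relation SumOn is local to the definition of SumOverTranslates and cannot be named; unification recovers it.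
module SumOnRecovery {d} (Q P : LatticePolytope d) (s : ℤ) where

  sumOn-total : ∃ λ (B : List (LPt d) → Set) → ∀ L → Unique L →
    (∀ p → p ∉ L → ∀ z → RedEuler Q (translate P p) z → z ≡ ℤ.0ℤ) → B L → SumOverTranslates Q P s
  sumOn-total = _ , λ L u o b → L , u , o , b

  sumOn-step : ∃ λ (A : List (LPt d) → ℤ → Set) → ∀ p L →
    (∃₂ λ z s′ → RedEuler Q (translate P p) z × A L s′ × s ≡ z ℤ.+ s′) → proj₁ sumOn-total (p ∷ L)
  sumOn-step = _ , λ p L h → h

  SumOn : List (LPt d) → ℤ → Set
  SumOn = proj₁ sumOn-step

  sumOn : ∀ L → SumOn L (sumL (λ p → ℤ.- alternatingSum Q (translate P p)) L)
  sumOn [] = refl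
  sumOn (p ∷ L) = _ , _ , Faces.redEuler (translate P p) Q , sumOn L , refl

sumF≡1⇒suc : ∀ {k} (w : Fin k → ℚ) → sumF w ≡ 1ℚ → ∃ λ k′ → k ≡ suc k′
sumF≡1⇒suc {zero} w e = ⊥-elim (ℚP.1≢0 (sym e))
sumF≡1⇒suc {suc k} w e = k , refl

theorem4p8 : ∀ (d : ℕ) (P Q : LatticePolytope d) → NonEmpty P → NonEmpty Q →
    IsValuation (λ X z → RedEuler Q X z) ×
    (∀ (E : Poly2) → IsEhrhartPoly P Q E →
    ∃ λ (s : ℤ) → SumOverTranslates Q P s × (eval2 E (ℚ.- ℚ.1ℚ) ℚ.1ℚ ≡ ℤtoℚ (ℤ.- s)))
theorem4p8 d P Q nonEmpty _ = isValuation Q , λ E ehrhart →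
  let (x , w , _ , Σw≡1 , _) = nonEmpty
      -- Weights with sum 1 exist, so there is at least one generator and `K - 1` is a natural
      -- number.
      k′ , K≡ = sumF≡1⇒suc w Σw≡1
      open Reciprocity P Q nonEmpty K≡ E ehrhart
  in s , proj₂ (SumOnRecovery.sumOn-total Q P s) translations translations-unique outside (SumOnRecovery.sumOn Q P s translations) , reciprocity
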